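{- Fix a prime $q$ and a positive integer $t$. For primes $p\ne q$ let $f_q(p)$ be the multiplicative order of $q$ modulo $p$ and let $t_p=\dfrac{p-1}{f_q(p)}$. Let $\psi_t$ be the completely multiplicative function on the positive integers with $\psi_t(p)=-1$ if $p\neq q$ is a prime with $t_p=t$, and $\psi_t(p)=1$ for all other primes $p$. Let $C(s,\psi_t)=\sum_{m\ge1}\psi_t(m)m^{ -s}$. Then for real $s>1$, $$2\sum_{p\,:\,t_p=t}p^{ -s}=\log\zeta(s)-\log C(s,\psi_t)+O(1),$$ where the sum is over primes $p\neq q$ with $t_p=t$; that is, there is a constant $K$ such that the difference between the left-hand side and $\log\zeta(s)-\log C(s,\psi_t)$ has absolute value at most $K$ for all real $s>1$.
   Context: $\zeta(s)$ is the Riemann zeta function. For real $s>1$ the series $C(s,\psi_t)$ converges absolutely and equals the positive real number $\prod_p(1-\psi_t(p)p^{ -s})^{ -1}$, and $\log$ is the real natural logarithm. A completely multiplicative function is determined by its values at primes, with value $1$ at $1$. -}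

module Defs where

open import Data.Nat.Base as ℕ using (ℕ; zero; suc; NonZero; _!)
open import Data.Nat.Divisibility using (_∣?_)
import Data.Nat.Properties as ℕ
open import Data.Nat.Primality using (Prime; prime?)
open import Data.Nat.Primality.Factorisation using (factors; factorise)
open import Data.Integer.Base as ℤ using (ℤ; 0ℤ; 1ℤ; -1ℤ)
open import Data.Rational.Base as ℚ using (ℚ; 0ℚ; 1ℚ; ½)
import Data.Rational.Properties as ℚ
open import Data.Rational.Solver using (module +-*-Solver)
open import Data.Bool.Base using (if_then_else_)
open import Data.List.Base using (map; foldr)
open import Data.Product.Base using (Σ; ∃; _×_; _,_)
open import Data.Sum.Base using (inj₁; inj₂)
open import Relation.Binary.PropositionalEquality using (_≡_; _≢_; refl; sym; trans; cong; cong₂; subst)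
open import Relation.Nullary.Decidable using (Dec; does; _×-dec_; ¬?)

infix  8 -_
infixl 7 _*_
infixl 6 _+_ _-_
infixr 8 _^_
infix  4 _≤_ _<_ _⟶_

-- Real numbers are Cauchy sequences of rationals with a modulus of
-- convergence; the representatives are not quotiented, and the order and
-- limit relations below depend only on the real number represented.

Cauchy : (ℕ → ℚ) → Set
Cauchy x = ∀ ε → 0ℚ ℚ.< ε → ∃ λ N → ∀ m n → N ℕ.≤ m → N ℕ.≤ n →
  ℚ.∣ x m ℚ.- x n ∣ ℚ.< ε

record ℝ : Set where
  constructor mkℝ
  field
    seq    : ℕ → ℚ
    cauchy : Cauchy seq

open ℝ public

private

  half+half : ∀ ε → ½ ℚ.* ε ℚ.+ ½ ℚ.* ε ≡ ε
  half+half ε = trans (sym (ℚ.*-distribʳ-+ ε ½ ½)) (ℚ.*-identityˡ ε)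

  half>0 : ∀ {ε} → 0ℚ ℚ.< ε → 0ℚ ℚ.< ½ ℚ.* ε
  half>0 {ε} 0<ε = subst (ℚ._< ½ ℚ.* ε) (ℚ.*-zeroʳ ½) (ℚ.*-monoʳ-<-pos ½ 0<ε)

  +-rearrange : ∀ a b c d → (a ℚ.+ b) ℚ.- (c ℚ.+ d) ≡ (a ℚ.- c) ℚ.+ (b ℚ.- d)
  +-rearrange = solve 4 (λ a b c d →
    (a :+ b) :+ (:- (c :+ d)) := (a :+ (:- c)) :+ (b :+ (:- d))) refl
    where open +-*-Solver

  *-rearrange : ∀ a b c d →
    a ℚ.* b ℚ.- c ℚ.* d ≡ a ℚ.* (b ℚ.- d) ℚ.+ (a ℚ.- c) ℚ.* d
  *-rearrange = solve 4 (λ a b c d →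
    (a :* b) :+ (:- (c :* d)) := (a :* (b :+ (:- d))) :+ ((a :+ (:- c)) :* d)) refl
    where open +-*-Solver

  neg-rearrange : ∀ a b → (ℚ.- a) ℚ.- (ℚ.- b) ≡ ℚ.- (a ℚ.- b)
  neg-rearrange = solve 2 (λ a b →
    (:- a) :+ (:- (:- b)) := :- (a :+ (:- b))) refl
    where open +-*-Solver

  sub-add : ∀ a b → (a ℚ.- b) ℚ.+ b ≡ a
  sub-add = solve 2 (λ a b → (a :+ (:- b)) :+ b := a) refl
    where open +-*-Solver

  add-sub : ∀ a b → (a ℚ.+ b) ℚ.- b ≡ a
  add-sub = solve 2 (λ a b → (a :+ b) :+ (:- b) := a) refl
    where open +-*-Solver

  neg-sub : ∀ a b → ℚ.- (a ℚ.- b) ≡ b ℚ.- a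
  neg-sub = solve 2 (λ a b → :- (a :+ (:- b)) := b :+ (:- a)) refl
    where open +-*-Solver

  ∣a∣≤∣a-b∣+∣b∣ : ∀ a b → ℚ.∣ a ∣ ℚ.≤ ℚ.∣ a ℚ.- b ∣ ℚ.+ ℚ.∣ b ∣
  ∣a∣≤∣a-b∣+∣b∣ a b =
    subst (λ z → ℚ.∣ z ∣ ℚ.≤ ℚ.∣ a ℚ.- b ∣ ℚ.+ ℚ.∣ b ∣) (sub-add a b)
      (ℚ.∣p+q∣≤∣p∣+∣q∣ (a ℚ.- b) b)

  ∣a∣-∣b∣≤∣a-b∣ : ∀ a b → ℚ.∣ a ∣ ℚ.- ℚ.∣ b ∣ ℚ.≤ ℚ.∣ a ℚ.- b ∣
  ∣a∣-∣b∣≤∣a-b∣ a b =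
    subst (ℚ.∣ a ∣ ℚ.- ℚ.∣ b ∣ ℚ.≤_) (add-sub ℚ.∣ a ℚ.- b ∣ ℚ.∣ b ∣)
      (ℚ.+-monoˡ-≤ (ℚ.- ℚ.∣ b ∣) (∣a∣≤∣a-b∣+∣b∣ a b))

  ∣-∣-swap : ∀ a b → ℚ.∣ a ℚ.- b ∣ ≡ ℚ.∣ b ℚ.- a ∣
  ∣-∣-swap a b = trans (sym (ℚ.∣-p∣≡∣p∣ (a ℚ.- b))) (cong ℚ.∣_∣ (neg-sub a b))

  ∣∣a∣-∣b∣∣≤∣a-b∣ : ∀ a b → ℚ.∣ ℚ.∣ a ∣ ℚ.- ℚ.∣ b ∣ ∣ ℚ.≤ ℚ.∣ a ℚ.- b ∣
  ∣∣a∣-∣b∣∣≤∣a-b∣ a b with ℚ.∣p∣≡p∨∣p∣≡-p (ℚ.∣ a ∣ ℚ.- ℚ.∣ b ∣)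
  ... | inj₁ eq = subst (ℚ._≤ ℚ.∣ a ℚ.- b ∣) (sym eq) (∣a∣-∣b∣≤∣a-b∣ a b)
  ... | inj₂ eq = subst (ℚ._≤ ℚ.∣ a ℚ.- b ∣)
    (sym (trans eq (neg-sub ℚ.∣ a ∣ ℚ.∣ b ∣)))
    (subst (ℚ.∣ b ∣ ℚ.- ℚ.∣ a ∣ ℚ.≤_) (∣-∣-swap b a) (∣a∣-∣b∣≤∣a-b∣ b a))

  ⊔-left : ∀ {M N n} → M ℕ.⊔ N ℕ.≤ n → M ℕ.≤ n
  ⊔-left {M} {N} = ℕ.≤-trans (ℕ.m≤m⊔n M N)

  ⊔-right : ∀ {M N n} → M ℕ.⊔ N ℕ.≤ n → N ℕ.≤ n
  ⊔-right {M} {N} = ℕ.≤-trans (ℕ.m≤n⊔m M N)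

  constant-cauchy : ∀ q → Cauchy (λ _ → q)
  constant-cauchy q ε 0<ε = 0 , λ _ _ _ _ →
    subst (ℚ._< ε) (sym (cong ℚ.∣_∣ (ℚ.+-inverseʳ q))) 0<ε

  neg-cauchy : ∀ {x} → Cauchy x → Cauchy (λ n → ℚ.- x n)
  neg-cauchy {x} cx ε 0<ε = let N , h = cx ε 0<ε in N , λ m n p r →
    subst (ℚ._< ε)
      (sym (trans (cong ℚ.∣_∣ (neg-rearrange (x m) (x n))) (ℚ.∣-p∣≡∣p∣ (x m ℚ.- x n))))
      (h m n p r)

  abs-cauchy : ∀ {x} → Cauchy x → Cauchy (λ n → ℚ.∣ x n ∣)
  abs-cauchy {x} cx ε 0<ε = let N , h = cx ε 0<ε in N , λ m n p r →
    ℚ.≤-<-trans (∣∣a∣-∣b∣∣≤∣a-b∣ (x m) (x n)) (h m n p r)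

  add-cauchy : ∀ {x y} → Cauchy x → Cauchy y → Cauchy (λ n → x n ℚ.+ y n)
  add-cauchy {x} {y} cx cy ε 0<ε =
    let M , g = cx (½ ℚ.* ε) (half>0 0<ε)
        N , h = cy (½ ℚ.* ε) (half>0 0<ε)
    in M ℕ.⊔ N , λ m n p r →
      let open ℚ.≤-Reasoning in begin-strict
        ℚ.∣ (x m ℚ.+ y m) ℚ.- (x n ℚ.+ y n) ∣
          ≡⟨ cong ℚ.∣_∣ (+-rearrange (x m) (y m) (x n) (y n)) ⟩
        ℚ.∣ (x m ℚ.- x n) ℚ.+ (y m ℚ.- y n) ∣
          ≤⟨ ℚ.∣p+q∣≤∣p∣+∣q∣ (x m ℚ.- x n) (y m ℚ.- y n) ⟩
        ℚ.∣ x m ℚ.- x n ∣ ℚ.+ ℚ.∣ y m ℚ.- y n ∣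
          <⟨ ℚ.+-mono-< (g m n (⊔-left p) (⊔-left r))
               (h m n (⊔-right {M} p) (⊔-right {M} r)) ⟩
        ½ ℚ.* ε ℚ.+ ½ ℚ.* ε
          ≡⟨ half+half ε ⟩
        ε ∎

  eventually-bounded : ∀ {x} → Cauchy x → ∃ λ B → ∃ λ N →
    0ℚ ℚ.< B × (∀ n → N ℕ.≤ n → ℚ.∣ x n ∣ ℚ.≤ B)
  eventually-bounded {x} cx =
    let N , h = cx 1ℚ (ℚ.positive⁻¹ 1ℚ)
    in 1ℚ ℚ.+ ℚ.∣ x N ∣ , N
     , ℚ.+-mono-<-≤ {0ℚ} {1ℚ} {0ℚ} (ℚ.positive⁻¹ 1ℚ) (ℚ.0≤∣p∣ (x N))
     , λ n p → ℚ.≤-trans (∣a∣≤∣a-b∣+∣b∣ (x n) (x N))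
         (ℚ.+-monoˡ-≤ ℚ.∣ x N ∣ (ℚ.<⇒≤ (h n N p ℕ.≤-refl)))

  scaled-< : ∀ {B η} a d → 0ℚ ℚ.< B → ℚ.∣ a ∣ ℚ.≤ B → ℚ.∣ d ∣ ℚ.< η →
    ℚ.∣ a ℚ.* d ∣ ℚ.< B ℚ.* η
  scaled-< {B} {η} a d 0<B a≤B d<η =
    let instance
          B>0 : ℚ.Positive B
          B>0 = ℚ.positive 0<B
          d≥0 : ℚ.NonNegative ℚ.∣ d ∣
          d≥0 = ℚ.∣-∣-nonNeg d
        open ℚ.≤-Reasoning
    in begin-strict
      ℚ.∣ a ℚ.* d ∣          ≡⟨ ℚ.∣p*q∣≡∣p∣*∣q∣ a d ⟩
      ℚ.∣ a ∣ ℚ.* ℚ.∣ d ∣    ≤⟨ ℚ.*-monoʳ-≤-nonNeg ℚ.∣ d ∣ a≤B ⟩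
      B ℚ.* ℚ.∣ d ∣          <⟨ ℚ.*-monoʳ-<-pos B d<η ⟩
      B ℚ.* η                ∎

  quotient : ∀ {B ε} → 0ℚ ℚ.< B → 0ℚ ℚ.< ε → ∃ λ η → 0ℚ ℚ.< η × B ℚ.* η ≡ ε
  quotient {B} {ε} 0<B 0<ε =
    let instance
          B>0 : ℚ.Positive B
          B>0 = ℚ.positive 0<B
          B≢0 : ℚ.NonZero B
          B≢0 = ℚ.pos⇒nonZero B
          1/B>0 : ℚ.Positive (ℚ.1/ B)
          1/B>0 = ℚ.1/pos⇒pos B
    in (ℚ.1/ B) ℚ.* ε
     , subst (ℚ._< (ℚ.1/ B) ℚ.* ε) (ℚ.*-zeroʳ (ℚ.1/ B)) (ℚ.*-monoʳ-<-pos (ℚ.1/ B) 0<ε)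
     , trans (sym (ℚ.*-assoc B (ℚ.1/ B) ε))
         (trans (cong (ℚ._* ε) (ℚ.*-inverseʳ B)) (ℚ.*-identityˡ ε))

  mul-cauchy : ∀ {x y} → Cauchy x → Cauchy y → Cauchy (λ n → x n ℚ.* y n)
  mul-cauchy {x} {y} cx cy ε 0<ε =
    let A , K , 0<A , boundx = eventually-bounded cx
        B , L , 0<B , boundy = eventually-bounded cy
        η , 0<η , Aη≡ = quotient 0<A (half>0 0<ε)
        θ , 0<θ , Bθ≡ = quotient 0<B (half>0 0<ε)
        M , g = cx θ 0<θ
        N , h = cy η 0<η
    in (K ℕ.⊔ L) ℕ.⊔ (M ℕ.⊔ N) , λ m n p r →
      let open ℚ.≤-Reasoning in begin-strict
        ℚ.∣ x m ℚ.* y m ℚ.- x n ℚ.* y n ∣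
          ≡⟨ cong ℚ.∣_∣ (*-rearrange (x m) (y m) (x n) (y n)) ⟩
        ℚ.∣ x m ℚ.* (y m ℚ.- y n) ℚ.+ (x m ℚ.- x n) ℚ.* y n ∣
          ≤⟨ ℚ.∣p+q∣≤∣p∣+∣q∣ (x m ℚ.* (y m ℚ.- y n)) ((x m ℚ.- x n) ℚ.* y n) ⟩
        ℚ.∣ x m ℚ.* (y m ℚ.- y n) ∣ ℚ.+ ℚ.∣ (x m ℚ.- x n) ℚ.* y n ∣
          ≡⟨ cong (λ z → ℚ.∣ x m ℚ.* (y m ℚ.- y n) ∣ ℚ.+ ℚ.∣ z ∣) (ℚ.*-comm (x m ℚ.- x n) (y n)) ⟩
        ℚ.∣ x m ℚ.* (y m ℚ.- y n) ∣ ℚ.+ ℚ.∣ y n ℚ.* (x m ℚ.- x n) ∣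
          <⟨ ℚ.+-mono-<
               (scaled-< (x m) (y m ℚ.- y n) 0<A
                 (boundx m (⊔-left {K} {L} (⊔-left p)))
                 (h m n (⊔-right {M} (⊔-right {K ℕ.⊔ L} p)) (⊔-right {M} (⊔-right {K ℕ.⊔ L} r))))
               (scaled-< (y n) (x m ℚ.- x n) 0<B
                 (boundy n (⊔-right {K} {L} (⊔-left r)))
                 (g m n (⊔-left {M} (⊔-right {K ℕ.⊔ L} p)) (⊔-left {M} (⊔-right {K ℕ.⊔ L} r)))) ⟩
        A ℚ.* η ℚ.+ B ℚ.* θ
          ≡⟨ cong₂ ℚ._+_ Aη≡ Bθ≡ ⟩
        ½ ℚ.* ε ℚ.+ ½ ℚ.* ε
          ≡⟨ half+half ε ⟩
        ε ∎

fromℚ : ℚ → ℝ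
fromℚ q = mkℝ (λ _ → q) (constant-cauchy q)

fromℤ : ℤ → ℝ
fromℤ i = fromℚ (i ℚ./ 1)

fromℕ : ℕ → ℝ
fromℕ n = fromℤ (ℤ.+ n)

-_ : ℝ → ℝ
- x = mkℝ (λ n → ℚ.- seq x n) (neg-cauchy {seq x} (cauchy x))

∣_∣ : ℝ → ℝ
∣ x ∣ = mkℝ (λ n → ℚ.∣ seq x n ∣) (abs-cauchy {seq x} (cauchy x))

_+_ : ℝ → ℝ → ℝ
x + y = mkℝ (λ n → seq x n ℚ.+ seq y n) (add-cauchy {seq x} {seq y} (cauchy x) (cauchy y))

_-_ : ℝ → ℝ → ℝ
x - y = x + (- y)

_*_ : ℝ → ℝ → ℝ
x * y = mkℝ (λ n → seq x n ℚ.* seq y n) (mul-cauchy {seq x} {seq y} (cauchy x) (cauchy y))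

_^_ : ℝ → ℕ → ℝ
x ^ zero  = fromℕ 1
x ^ suc k = x * x ^ k

_≤_ : ℝ → ℝ → Set
x ≤ y = ∀ ε → 0ℚ ℚ.< ε → ∃ λ N → ∀ n → N ℕ.≤ n → seq x n ℚ.≤ seq y n ℚ.+ ε

_<_ : ℝ → ℝ → Set
x < y = ∃ λ ε → 0ℚ ℚ.< ε × ∃ λ N → ∀ n → N ℕ.≤ n → seq x n ℚ.+ ε ℚ.≤ seq y n

_⟶_ : (ℕ → ℝ) → ℝ → Set
a ⟶ ℓ = ∀ ε → 0ℚ ℚ.< ε → ∃ λ N → ∀ n → N ℕ.≤ n → ∣ a n - ℓ ∣ < fromℚ ε

partialSum : (ℕ → ℝ) → ℕ → ℝ
partialSum a zero    = fromℕ 0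
partialSum a (suc n) = partialSum a n + a n

HasSum : (ℕ → ℝ) → ℝ → Set
HasSum a S = partialSum a ⟶ S

-- exp, log and powers are given by their graphs: `IsExp x y` says y = e^x,
-- `IsLog x y` says y = log x (in particular x > 0), and `IsPower b x y` says
-- y = b^x = e^(x log b).

IsExp : ℝ → ℝ → Set
IsExp x y = HasSum (λ k → x ^ k * fromℚ ((1ℤ ℚ./ (k !)) {{k ℕ.!≢0}})) y

IsLog : ℝ → ℝ → Set
IsLog x y = IsExp y x

IsPower : ℕ → ℝ → ℝ → Set
IsPower b x y = ∃ λ l → IsLog (fromℕ b) l × IsExp (x * l) y

-- `IsDirichletSeries a s S` says that Σ_{m ≥ 1} a(m) m^(-s) converges to S;
-- the term of index m in the code is the one for the integer m + 1.

IsDirichletSeries : (∀ m → .{{NonZero m}} → ℤ) → ℝ → ℝ → Set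
IsDirichletSeries a s S = Σ (ℕ → ℝ) λ pow →
  (∀ m → IsPower (suc m) (- s) (pow m)) ×
  HasSum (λ m → fromℤ (a (suc m)) * pow m) S

Isζ : ℝ → ℝ → Set
Isζ = IsDirichletSeries (λ _ → 1ℤ)

-- The multiplicative order of q modulo p, as the least k ≥ 1 with
-- p ∣ q^k - 1.  `orderSearch fuel k` is the predecessor of the least such exponent
-- exceeding k, giving up after `fuel` failures.  When p is a prime not
-- dividing q the order is at most p - 1, so fuel p is enough; the value is
-- irrelevant for other p.

module _ (q p : ℕ) where

  orderSearch : ℕ → ℕ → ℕ
  orderSearch zero       k = k
  orderSearch (suc fuel) k =
    if does (p ∣? (q ℕ.^ suc k ℕ.∸ 1)) then k else orderSearch fuel (suc k)

  order : ℕ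
  order = suc (orderSearch p 0)

  index : ℕ
  index = (p ℕ.∸ 1) ℕ./ order

HasIndex : ℕ → ℕ → ℕ → Set
HasIndex q t p = Prime p × p ≢ q × index q p ≡ t

hasIndex? : ∀ q t p → Dec (HasIndex q t p)
hasIndex? q t p = prime? p ×-dec ¬? (p ℕ.≟ q) ×-dec (index q p ℕ.≟ t)

ψ-prime : ℕ → ℕ → ℕ → ℤ
ψ-prime q t p = if does (hasIndex? q t p) then -1ℤ else 1ℤ

ψ : ℕ → ℕ → ∀ m → .{{NonZero m}} → ℤ
ψ q t m = foldr ℤ._*_ 1ℤ (map (ψ-prime q t) (factors (factorise m)))

indexIndicator : ℕ → ℕ → ∀ m → .{{NonZero m}} → ℤ
indexIndicator q t m = if does (hasIndex? q t m) then 1ℤ else 0ℤ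

IsC : ℕ → ℕ → ℝ → ℝ → Set
IsC q t = IsDirichletSeries (ψ q t)

-- The sum of p^(-s) over the primes p ≠ q with index t, taken in increasing
-- order of p.

IsIndexPrimeSum : ℕ → ℕ → ℝ → ℝ → Set
IsIndexPrimeSum q t = IsDirichletSeries (indexIndicator q t)

{-# OPTIONS --safe #-}

-- Sieving out the primes up to k one after another multiplies Z = ζ(s) and
-- C = C(s, ψ_t) by the finite products U_k = Π (1 - p^(-s)) and
-- V_k = Π (1 - ψ_t(p) p^(-s)) and leaves 1 plus a tail of the series, so U_k Z → 1
-- and V_k C → 1.  The factors of V_k / U_k differ from 1 only for the p with t_p = t,
-- where they are (1 + x) / (1 - x) with x = p^(-s) ≤ 1/2, hence e^(2x) up to a factor
-- e^(O(x²)).  As Σ x² ≤ Σ 1/m² is bounded uniformly in s > 1, Z / C lies between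
-- e^(2P - 4) and e^(2P + 4) for P = Σ p^(-s) over these p.
--
-- All of this is constructive: e^x is the limit of its series, logarithms of positive
-- reals come from Newton's iteration, and m^(-s) is dominated by the telescoping
-- difference ((m - 1)^(1 - s) - m^(1 - s)) / (s - 1).

module Submission where

open import Algebra.Bundles using (CommutativeRing)
open import Algebra.Structures using (IsCommutativeRing)
import Algebra.Solver.Ring as RingSolver
open import Algebra.Solver.Ring.AlmostCommutativeRing using (fromCommutativeRing; _-Raw-AlmostCommutative⟶_)
open import Data.Bool.Base using (Bool; true; false; if_then_else_)
open import Data.Empty using (⊥-elim)
open import Data.Integer.Base as ℤ using (ℤ; +_; 1ℤ; -1ℤ)
import Data.Integer.Properties as ℤ
open import Data.List.Base using (List; []; _∷_; _++_; map; foldr)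
open import Data.List.Relation.Unary.All using (All; []; _∷_)
import Data.List.Relation.Unary.All.Properties as All
open import Data.List.Relation.Binary.Permutation.Propositional as ↭ using (_↭_)
open import Data.Maybe.Base using (Maybe; just; nothing)
open import Data.Nat as ℕ using (ℕ; zero; suc; NonZero; _!)
import Data.Nat.Properties as ℕ
open import Data.Nat.Coprimality using (1-coprimeTo)
import Data.Nat.Coprimality as Coprimality
open import Data.Nat.Divisibility using (_∣_; _∣?_; divides; ∣1⇒≡1; ∣⇒≤; m∣m*n; ∣n⇒∣m*n)
open import Data.Nat.ListAction using (product)
open import Data.Nat.ListAction.Properties using (product-++)
open import Data.Nat.Primality using (Prime; prime?; euclidsLemma; prime⇒irreducible; ¬prime[1])
open import Data.Nat.Primality.Factorisation
  using (PrimeFactorisation; factors; factorise; factorisationUnique; primeFactorisation[p])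
open import Data.Product using (Σ; ∃; _×_; _,_; proj₁; proj₂; swap)
open import Data.Rational.Base as ℚ using (ℚ; 0ℚ; 1ℚ; ½)
import Data.Rational.Properties as ℚ
open import Data.Rational.Solver using (module +-*-Solver)
import Data.Rational.Unnormalised.Base as ℚᵘ
import Data.Rational.Unnormalised.Properties as ℚᵘ
open import Data.Sum.Base using (_⊎_; inj₁; inj₂)
open import Function.Base using (id)
open import Level using (0ℓ)
open import Relation.Binary.Bundles using (Preorder)
import Relation.Binary.Reasoning.Preorder as PreorderReasoning
open import Relation.Binary.PropositionalEquality
  using (_≡_; refl; sym; trans; cong; cong₂; subst; subst₂; module ≡-Reasoning)
open import Relation.Nullary using (¬_; Dec; yes; no; contradiction)
open import Relation.Nullary.Decidable using (does; _×-dec_; dec-true; dec-false)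

import Defs as D
open D using (ℝ; mkℝ; seq; cauchy)

-- Two bounds on the terms play different roles. The telescoping majorant of m^(-s) carries a factor
-- 1 / (s - 1) and blows up as s tends to 1, so it serves only for convergence at a fixed s. The
-- constant of the theorem comes solely from p^(-s) ≤ 1/p, which is uniform in s. Sieving is chosen
-- over expanding the Euler product because each stage is an identity between finite sums, S(M) -
-- a(p) S(M / p), so that no infinite series is rearranged. The products are compared without
-- division, in the form U e^(2P - w) ≤ V ≤ U e^(2P + w); as U and V approach 1/Z and 1/C, the
-- bounds for V/U become bounds for Z/C. The same limits give rational lower bounds for Z and C,
-- which the construction of their logarithms requires. The order of constructive reals is
-- undecidable, so intermediate claims are kept as non-strict inequalities, for which a case
-- distinction on the order is still legitimate.

Eventually : (ℕ → Set) → Set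
Eventually P = ∃ λ N → ∀ n → N ℕ.≤ n → P n

eventually₁ : ∀ {P Q : ℕ → Set} → (∀ n → P n → Q n) → Eventually P → Eventually Q
eventually₁ f (N , p) = N , λ n h → f n (p n h)

eventually₂ : ∀ {P Q S : ℕ → Set} → (∀ n → P n → Q n → S n) →
              Eventually P → Eventually Q → Eventually S
eventually₂ f (M , p) (N , q) = M ℕ.⊔ N , λ n h →
  f n (p n (ℕ.m⊔n≤o⇒m≤o M N h)) (q n (ℕ.m⊔n≤o⇒n≤o M N h))

-- Rational numbers

*-pos : ∀ {p q} → 0ℚ ℚ.< p → 0ℚ ℚ.< q → 0ℚ ℚ.< p ℚ.* q
*-pos {p} {q} 0<p 0<q =
  subst (ℚ._< p ℚ.* q) (ℚ.*-zeroʳ p) (ℚ.*-monoʳ-<-pos p {{ℚ.positive 0<p}} 0<q)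

½>0 : 0ℚ ℚ.< ½
½>0 = ℚ.positive⁻¹ ½

half>0 : ∀ {ε} → 0ℚ ℚ.< ε → 0ℚ ℚ.< ½ ℚ.* ε
half>0 = *-pos ½>0

abstract
  -- The quotient ε / B is returned with its defining equation, so that later estimates can be tuned
  -- to end exactly at ε.
  divide : ∀ {B} → 0ℚ ℚ.< B → ∀ ε → 0ℚ ℚ.< ε → ∃ λ η → 0ℚ ℚ.< η × B ℚ.* η ≡ ε
  divide {B} 0<B ε 0<ε = let instance
                               B>0 = ℚ.positive 0<B
                               B≢0 = ℚ.pos⇒nonZero B
                         in
    ℚ.1/ B ℚ.* ε
    , *-pos (ℚ.positive⁻¹ (ℚ.1/ B) {{ℚ.1/pos⇒pos B}}) 0<ε
    , trans (sym (ℚ.*-assoc B (ℚ.1/ B) ε))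
        (trans (cong (ℚ._* ε) (ℚ.*-inverseʳ B)) (ℚ.*-identityˡ ε))

-- recip k is 1 / (k + 1).
recip : ℕ → ℚ
recip k = ℚ.mkℚ (+ 1) k (1-coprimeTo (suc k))

recip>0 : ∀ k → 0ℚ ℚ.< recip k
recip>0 k = ℚ.positive⁻¹ (recip k)

recip-antimono : ∀ {j k} → j ℕ.≤ k → recip k ℚ.≤ recip j
recip-antimono j≤k = ℚ.*≤* (ℤ.*-monoˡ-≤-nonNeg (+ 1) (ℤ.+≤+ (ℕ.s≤s j≤k)))

-- A positive rational has numerator at least 1, hence is at least the reciprocal of its own
-- denominator; that denominator, shifted as in `recip`, is the witness.
recip-small : ∀ ε → 0ℚ ℚ.< ε → ∃ λ N → recip N ℚ.≤ ε
recip-small ε@(ℚ.mkℚ (+ zero) b _) 0<ε = ⊥-elim (ℚ.<-irrefl (sym (ℚ.↥p≡0⇒p≡0 ε refl)) 0<ε)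
recip-small (ℚ.mkℚ ℤ.+[1+ a ] b _) 0<ε =
  b , ℚ.*≤* (ℤ.*-monoʳ-≤-nonNeg (+ suc b) {+ 1} {+ suc a} (ℤ.+≤+ (ℕ.s≤s ℕ.z≤n)))
recip-small (ℚ.mkℚ (ℤ.-[1+ a ]) b _) (ℚ.*<* ())

half+half : ∀ ε → ½ ℚ.* ε ℚ.+ ½ ℚ.* ε ≡ ε
half+half ε = trans (sym (ℚ.*-distribʳ-+ ε ½ ½)) (ℚ.*-identityˡ ε)

p≤∣p∣ : ∀ p → p ℚ.≤ ℚ.∣ p ∣
p≤∣p∣ p with ℚ.≤-total 0ℚ p
... | inj₁ 0≤p = ℚ.≤-reflexive (sym (ℚ.0≤p⇒∣p∣≡p 0≤p))
... | inj₂ p≤0 = ℚ.≤-trans p≤0 (ℚ.0≤∣p∣ p)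

nat : ℕ → ℚ
nat n = ℚ.mkℚ (+ n) 0 (Coprimality.sym (1-coprimeTo n))

nat-+ : ∀ m n → nat (m ℕ.+ n) ≡ nat m ℚ.+ nat n
nat-+ m n = ℚ.toℚᵘ-injective (ℚᵘ.≃-trans
  (ℚᵘ.*≡* (cong (ℤ._* (+ 1 ℤ.* + 1)) (sym (cong₂ ℤ._+_ (ℤ.*-identityʳ (+ m)) (ℤ.*-identityʳ (+ n))))))
  (ℚᵘ.≃-sym (ℚ.toℚᵘ-homo-+ (nat m) (nat n))))

nat-* : ∀ m n → nat (m ℕ.* n) ≡ nat m ℚ.* nat n
nat-* m n = ℚ.toℚᵘ-injective (ℚᵘ.≃-trans
  (ℚᵘ.*≡* (cong (ℤ._* (+ 1 ℤ.* + 1)) (ℤ.pos-* m n)))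
  (ℚᵘ.≃-sym (ℚ.toℚᵘ-homo-* (nat m) (nat n))))

recip-* : ∀ k → recip k ℚ.* nat (suc k) ≡ 1ℚ
recip-* k = ℚ.toℚᵘ-injective (ℚᵘ.≃-trans (ℚ.toℚᵘ-homo-* (recip k) (nat (suc k)))
  (ℚᵘ.*≡* (trans (ℤ.*-identityʳ _) (trans (ℤ.*-identityˡ (+ suc k))
      (sym (trans (ℤ.*-identityˡ _) (ℤ.*-identityʳ (+ suc k))))))))

nat-mono : ∀ {m n} → m ℕ.≤ n → nat m ℚ.≤ nat n
nat-mono m≤n = ℚ.*≤* (ℤ.*-monoʳ-≤-nonNeg (+ 1) (ℤ.+≤+ m≤n))

nat-suc : ∀ n → nat (suc n) ≡ 1ℚ ℚ.+ nat n
nat-suc n = nat-+ 1 n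

archimedes : ∀ δ → 0ℚ ℚ.< δ → ∃ λ N → ∀ n → N ℕ.≤ n → 1ℚ ℚ.≤ nat n ℚ.* δ
archimedes δ 0<δ = let N , small = recip-small δ 0<δ in suc N , λ n N<n → begin
  1ℚ                       ≡⟨ sym (trans (ℚ.*-comm (nat (suc N)) (recip N)) (recip-* N)) ⟩
  nat (suc N) ℚ.* recip N  ≤⟨ ℚ.*-monoˡ-≤-nonNeg (nat (suc N)) small ⟩
  nat (suc N) ℚ.* δ        ≤⟨ ℚ.*-monoʳ-≤-nonNeg δ {{ℚ.nonNegative (ℚ.<⇒≤ 0<δ)}} (nat-mono N<n) ⟩
  nat n ℚ.* δ              ∎
  where open ℚ.≤-Reasoning

nat-large : ∀ Q → 0ℚ ℚ.< Q → ∃ λ N → ∀ n → N ℕ.≤ n → Q ℚ.≤ nat n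
nat-large Q 0<Q =
  let q , 0<q , Qq≡1 = divide 0<Q 1ℚ (ℚ.positive⁻¹ 1ℚ)
      N , h = archimedes q 0<q
  in N , λ n N≤n → ℚ.*-cancelʳ-≤-pos q {{ℚ.positive 0<q}} (subst (ℚ._≤ nat n ℚ.* q) (sym Qq≡1) (h n N≤n))

¼ : ℚ
¼ = + 1 ℚ./ 4

4ℚ : ℚ
4ℚ = + 4 ℚ./ 1

nat≡/1 : ∀ n → nat n ≡ + n ℚ./ 1
nat≡/1 n = sym (ℚ.normalize-coprime (Coprimality.sym (1-coprimeTo n)))

1/n*n≡1 : ∀ n .{{_ : NonZero n}} → (1ℤ ℚ./ n) ℚ.* nat n ≡ 1ℚ
1/n*n≡1 (suc k) = trans (cong (ℚ._* nat (suc k)) (ℚ.normalize-coprime (1-coprimeTo (suc k)))) (recip-* k)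

invFactorial : ℕ → ℚ
invFactorial k = (1ℤ ℚ./ (k !)) {{k ℕ.!≢0}}

-- Both sides are inverses of (k + 1)!, and inverses are unique; the normalised fractions themselves
-- are never compared.
invFactorial-suc : ∀ k → invFactorial (suc k) ≡ recip k ℚ.* invFactorial k
invFactorial-suc k = begin
  a                      ≡⟨ sym (ℚ.*-identityʳ a) ⟩
  a ℚ.* 1ℚ               ≡⟨ cong (a ℚ.*_) (sym b*c≡1) ⟩
  a ℚ.* (b ℚ.* c)        ≡⟨ sym (ℚ.*-assoc a b c) ⟩
  (a ℚ.* b) ℚ.* c        ≡⟨ cong (ℚ._* c) (ℚ.*-comm a b) ⟩
  (b ℚ.* a) ℚ.* c        ≡⟨ ℚ.*-assoc b a c ⟩
  b ℚ.* (a ℚ.* c)        ≡⟨ cong (b ℚ.*_) (1/n*n≡1 (suc k !) {{suc k ℕ.!≢0}}) ⟩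
  b ℚ.* 1ℚ               ≡⟨ ℚ.*-identityʳ b ⟩
  b                      ∎
  where
  open ≡-Reasoning
  a = invFactorial (suc k)
  b = recip k ℚ.* invFactorial k
  c = nat (suc k !)
  b*c≡1 : b ℚ.* c ≡ 1ℚ
  b*c≡1 = begin
    (recip k ℚ.* invFactorial k) ℚ.* c
      ≡⟨ cong ((recip k ℚ.* invFactorial k) ℚ.*_)
          (trans (nat-* (suc k) (k !)) (ℚ.*-comm (nat (suc k)) (nat (k !)))) ⟩
    (recip k ℚ.* invFactorial k) ℚ.* (nat (k !) ℚ.* nat (suc k)) ≡⟨ ℚ.*-assoc (recip k) (invFactorial k) _ ⟩
    recip k ℚ.* (invFactorial k ℚ.* (nat (k !) ℚ.* nat (suc k)))
      ≡⟨ cong (recip k ℚ.*_) (sym (ℚ.*-assoc (invFactorial k) (nat (k !)) (nat (suc k)))) ⟩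
    recip k ℚ.* ((invFactorial k ℚ.* nat (k !)) ℚ.* nat (suc k))
      ≡⟨ cong (λ z → recip k ℚ.* (z ℚ.* nat (suc k))) (1/n*n≡1 (k !) {{k ℕ.!≢0}}) ⟩
    recip k ℚ.* (1ℚ ℚ.* nat (suc k))
      ≡⟨ cong (recip k ℚ.*_) (ℚ.*-identityˡ (nat (suc k))) ⟩
    recip k ℚ.* nat (suc k)                                     ≡⟨ recip-* k ⟩
    1ℚ                                                          ∎

-- Prime factors and multiples

-- The motive is a predicate on the Boolean, so that several conditionals on the same test can be
-- split at once; `if-elim` serves a single conditional.
does-elim : ∀ {P : Set} (C : Bool → Set) (d : Dec P) → (P → C true) → (¬ P → C false) → C (does d)
does-elim C (yes p) f g = f p
does-elim C (no ¬p) f g = g ¬p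

if-elim : ∀ {A P : Set} (C : A → Set) (d : Dec P) {x y : A} →
          (P → C x) → (¬ P → C y) → C (if does d then x else y)
if-elim C d {x} {y} = does-elim (λ b → C (if b then x else y)) d

if-yes : ∀ {A P : Set} (d : Dec P) {x y : A} → P → (if does d then x else y) ≡ x
if-yes d p rewrite dec-true d p = refl

if-no : ∀ {A P : Set} (d : Dec P) {x y : A} → ¬ P → (if does d then x else y) ≡ y
if-no d ¬p rewrite dec-false d ¬p = refl

prime-divisor : ∀ m → 2 ℕ.≤ m → ∃ λ p → Prime p × p ∣ m
prime-divisor m@(suc (suc _)) _ = first (factors f) (isFactorisation f) (factorsPrime f)
  where
  open PrimeFactorisation
  f = factorise m
  first : ∀ ps → m ≡ product ps → All Prime ps → ∃ λ p → Prime p × p ∣ m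
  first []       ()
  first (p ∷ ps) m≡ (p-prime ∷ _) = p , p-prime , subst (p ∣_) (sym m≡) (m∣m*n (product ps))
prime-divisor (suc zero) (ℕ.s≤s ())

-- This is the floor of M / p, counted step by step so that it grows exactly when a sum up to M
-- meets a multiple of p.
multiples : ℕ → ℕ → ℕ
multiples p zero    = 0
multiples p (suc M) = if does (p ∣? suc M) then suc (multiples p M) else multiples p M

-- M + 1 lies strictly above pc and does not exceed p(c + 1), and the only multiple of p in that
-- range is the right end.
quotient-unique : ∀ k c M → let p = suc k in
  p ℕ.* c ℕ.≤ M → M ℕ.< p ℕ.* suc c → p ∣ suc M → suc M ≡ p ℕ.* suc c
quotient-unique k c M pc≤M M<p[1+c] (divides q 1+M≡q*p) = trans 1+M≡p*q
    (cong (suc k ℕ.*_) (ℕ.≤-antisym q≤1+c 1+c≤q))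
  where
  1+M≡p*q : suc M ≡ suc k ℕ.* q
  1+M≡p*q = trans 1+M≡q*p (ℕ.*-comm q (suc k))
  q≤1+c : q ℕ.≤ suc c
  q≤1+c = ℕ.*-cancelˡ-≤ (suc k) (subst (ℕ._≤ suc k ℕ.* suc c) 1+M≡p*q M<p[1+c])
  1+c≤q : suc c ℕ.≤ q
  1+c≤q = ℕ.*-cancelˡ-< (suc k) c q (subst (suc k ℕ.* c ℕ.<_) 1+M≡p*q (ℕ.s≤s pc≤M))

multiples-bounds : ∀ k M → let p = suc k in p ℕ.* multiples p M ℕ.≤ M × M ℕ.< p ℕ.* suc (multiples p M)
multiples-bounds k zero    = ℕ.≤-reflexive (ℕ.*-zeroʳ k) , ℕ.s≤s ℕ.z≤n
multiples-bounds k (suc M) = if-elim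
  (λ c → suc k ℕ.* c ℕ.≤ suc M × suc M ℕ.< suc k ℕ.* suc c) (suc k ∣? suc M)
  (λ h → let eq = quotient-unique k c M lower′ upper′ h in
     ℕ.≤-reflexive (sym eq) , subst (ℕ._< suc k ℕ.* suc (suc c)) (sym eq) (ℕ.*-monoʳ-< (suc k) ℕ.≤-refl))
  (λ ¬h → ℕ.m≤n⇒m≤1+n lower′ ,
     ℕ.≤∧≢⇒< upper′ λ eq → ¬h (divides (suc c) (trans eq (ℕ.*-comm (suc k) (suc c)))))
  where
  c = multiples (suc k) M
  lower′ = proj₁ (multiples-bounds k M)
  upper′ = proj₂ (multiples-bounds k M)

next-multiple : ∀ k M → let p = suc k in p ∣ suc M → suc M ≡ p ℕ.* suc (multiples p M)
next-multiple k M = quotient-unique k _ M (proj₁ (multiples-bounds k M)) (proj₂ (multiples-bounds k M))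

multiples-large : ∀ k N → ∃ λ M → ∀ n → M ℕ.≤ n → N ℕ.≤ multiples (suc k) n
multiples-large k N = suc k ℕ.* N , λ n h → ℕ.s≤s⁻¹
  (ℕ.*-cancelˡ-< (suc k) N _ (ℕ.≤-<-trans h (proj₂ (multiples-bounds k n))))

factorisation-* : ∀ {m n} → PrimeFactorisation m → PrimeFactorisation n → PrimeFactorisation (m ℕ.* n)
factorisation-* f g = record
  { factors = factors f ++ factors g
  ; isFactorisation = trans (cong₂ ℕ._*_ (isFactorisation f) (isFactorisation g))
      (sym (product-++ (factors f) (factors g)))
  ; factorsPrime = All.++⁺ (factorsPrime f) (factorsPrime g)
  }
  where open PrimeFactorisation using (isFactorisation; factorsPrime)

module _ (f : ℕ → ℤ) where

  listProduct : List ℕ → ℤ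
  listProduct ps = foldr ℤ._*_ 1ℤ (map f ps)

  listProduct-++ : ∀ ps qs → listProduct (ps ++ qs) ≡ listProduct ps ℤ.* listProduct qs
  listProduct-++ []       qs = sym (ℤ.*-identityˡ _)
  listProduct-++ (p ∷ ps) qs = trans (cong (f p ℤ.*_) (listProduct-++ ps qs))
      (sym (ℤ.*-assoc (f p) (listProduct ps) (listProduct qs)))

  listProduct-↭ : ∀ {ps qs} → ps ↭ qs → listProduct ps ≡ listProduct qs
  listProduct-↭ ↭.refl         = refl
  listProduct-↭ (↭.prep p r)   = cong (f p ℤ.*_) (listProduct-↭ r)
  listProduct-↭ (↭.swap {xs} {ys} p q r) = begin
    f p ℤ.* (f q ℤ.* listProduct xs)   ≡⟨ sym (ℤ.*-assoc (f p) (f q) _) ⟩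
    (f p ℤ.* f q) ℤ.* listProduct xs   ≡⟨ cong₂ ℤ._*_ (ℤ.*-comm (f p) (f q)) (listProduct-↭ r) ⟩
    (f q ℤ.* f p) ℤ.* listProduct ys   ≡⟨ ℤ.*-assoc (f q) (f p) _ ⟩
    f q ℤ.* (f p ℤ.* listProduct ys)   ∎
    where open ≡-Reasoning
  listProduct-↭ (↭.trans r r′) = trans (listProduct-↭ r) (listProduct-↭ r′)

-- Knowing that the values are 1 or -1 reduces multiplicativity of the embedding of ℤ to four
-- products of concrete rationals.
data Sign : ℤ → Set where
  plus  : Sign 1ℤ
  minus : Sign -1ℤ

Sign-* : ∀ {i j} → Sign i → Sign j → Sign (i ℤ.* j)
Sign-* plus  plus  = plus
Sign-* plus  minus = minus
Sign-* minus plus  = minus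
Sign-* minus minus = plus

module _ (q t : ℕ) where

  -- The concatenated factor lists are a factorisation of the product, so by unique factorisation a
  -- permutation of the chosen one, and `listProduct` does not see the order.
  ψ-* : ∀ m n → D.ψ q t (suc m ℕ.* suc n) ≡ D.ψ q t (suc m) ℤ.* D.ψ q t (suc n)
  ψ-* m n = trans
    (listProduct-↭ (D.ψ-prime q t) (factorisationUnique (factorise (suc m ℕ.* suc n))
        (factorisation-* (factorise (suc m)) (factorise (suc n)))))
    (listProduct-++ (D.ψ-prime q t) (factors (factorise (suc m))) (factors (factorise (suc n))))

  ψ-at-prime : ∀ {p} .{{_ : NonZero p}} → Prime p → D.ψ q t p ≡ D.ψ-prime q t p
  ψ-at-prime {p} p-prime = trans
    (listProduct-↭ (D.ψ-prime q t) (factorisationUnique (factorise p) (primeFactorisation[p] p-prime)))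
    (ℤ.*-identityʳ _)

  ψ-prime-sign : ∀ p → Sign (D.ψ-prime q t p)
  ψ-prime-sign p = if-elim Sign (D.hasIndex? q t p) (λ _ → minus) (λ _ → plus)

  ψ-sign : ∀ m → Sign (D.ψ q t (suc m))
  ψ-sign m = signs (factors (factorise (suc m)))
    where
    signs : ∀ ps → Sign (listProduct (D.ψ-prime q t) ps)
    signs []       = plus
    signs (p ∷ ps) = Sign-* (ψ-prime-sign p) (signs ps)

-- Real numbers as a complete Archimedean ordered field

record Reals : Set₁ where
  infix  4 _≈_ _≤_
  infixl 6 _+_
  infixl 7 _*_
  infix  8 -_
  field
    R           : Set
    _≈_ _≤_     : R → R → Set
    _+_ _*_     : R → R → R
    -_          : R → R
    ι           : ℚ → R
    isCommutativeRing : IsCommutativeRing _≈_ _+_ _*_ -_ (ι 0ℚ) (ι 1ℚ)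
    ≤-reflexive : ∀ {x y} → x ≈ y → x ≤ y
    ≤-antisym   : ∀ {x y} → x ≤ y → y ≤ x → x ≈ y
    ≤-trans     : ∀ {x y z} → x ≤ y → y ≤ z → x ≤ z
    +-mono-≤    : ∀ {x y u v} → x ≤ y → u ≤ v → x + u ≤ y + v
    *-nonNeg    : ∀ {x y} → ι 0ℚ ≤ x → ι 0ℚ ≤ y → ι 0ℚ ≤ x * y
    ι-+         : ∀ p q → ι (p ℚ.+ q) ≈ ι p + ι q
    ι-*         : ∀ p q → ι (p ℚ.* q) ≈ ι p * ι q
    ι-neg       : ∀ p → ι (ℚ.- p) ≈ - ι p
    ι-mono      : ∀ {p q} → p ℚ.≤ q → ι p ≤ ι q
    ι-cancel    : ∀ {p q} → ι p ≤ ι q → p ℚ.≤ q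
    ≤-closed    : ∀ {x y} → (∀ ε → 0ℚ ℚ.< ε → x ≤ y + ι ε) → x ≤ y
    -- This replaces deciding the order: the two alternatives overlap, and one of them can always be
    -- found from a finite approximation.
    ≤-or-apart  : ∀ x y ε → 0ℚ ℚ.< ε →
                  x ≤ y + ι ε ⊎ ∃ λ δ → 0ℚ ℚ.< δ × y + ι δ ≤ x
    approximate : ∀ x ε → 0ℚ ℚ.< ε → ∃ λ q → x ≤ ι q + ι ε × ι q ≤ x + ι ε
    -- One inequality suffices in the Cauchy condition, since `m` and `n` may be exchanged.
    complete    : ∀ (a : ℕ → R) →
                  (∀ ε → 0ℚ ℚ.< ε → ∃ λ N → ∀ m n → N ℕ.≤ m → N ℕ.≤ n → a m ≤ a n + ι ε) →
                  ∃ λ ℓ → ∀ ε → 0ℚ ℚ.< ε → ∃ λ N → ∀ n → N ℕ.≤ n →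
                  a n ≤ ℓ + ι ε × ℓ ≤ a n + ι ε

-- Cauchy sequences of rationals form such a field

module CauchyReals where

  open D using (_≤_; _+_; _*_)
  open +-*-Solver

  infix 4 _≈_

  _≈_ : ℝ → ℝ → Set
  x ≈ y = x ≤ y × y ≤ x

  +half+half : ∀ a ε → (a ℚ.+ ½ ℚ.* ε) ℚ.+ ½ ℚ.* ε ≡ a ℚ.+ ε
  +half+half a ε = trans (ℚ.+-assoc a (½ ℚ.* ε) (½ ℚ.* ε)) (cong (a ℚ.+_) (half+half ε))

  p≤p+ε : ∀ p {ε} → 0ℚ ℚ.< ε → p ℚ.≤ p ℚ.+ ε
  p≤p+ε p {ε} 0<ε = subst (ℚ._≤ p ℚ.+ ε) (ℚ.+-identityʳ p) (ℚ.+-monoʳ-≤ p (ℚ.<⇒≤ 0<ε))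

  ∣p-q∣≤⇒p≤q+ : ∀ {p q ε} → ℚ.∣ p ℚ.- q ∣ ℚ.≤ ε → p ℚ.≤ q ℚ.+ ε
  ∣p-q∣≤⇒p≤q+ {p} {q} {ε} h = subst (ℚ._≤ q ℚ.+ ε)
    (solve 2 (λ p q → q :+ (p :+ (:- q)) := p) refl p q)
    (ℚ.+-monoʳ-≤ q (ℚ.≤-trans (p≤∣p∣ (p ℚ.- q)) h))

  cauchy≤ : ∀ (x : ℝ) ε → 0ℚ ℚ.< ε → ∃ λ N → ∀ m n → N ℕ.≤ m → N ℕ.≤ n →
            seq x m ℚ.≤ seq x n ℚ.+ ε
  cauchy≤ x ε 0<ε = let N , h = cauchy x ε 0<ε in
    N , λ m n p r → ∣p-q∣≤⇒p≤q+ (ℚ.<⇒≤ (h m n p r))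

  ≤-pointwise : ∀ (x y : ℝ) → (∀ n → seq x n ℚ.≤ seq y n) → x ≤ y
  ≤-pointwise x y h ε 0<ε = 0 , λ n _ → ℚ.≤-trans (h n) (p≤p+ε (seq y n) 0<ε)

  ≈-pointwise : ∀ (x y : ℝ) → (∀ n → seq x n ≡ seq y n) → x ≈ y
  ≈-pointwise x y h =
    ≤-pointwise x y (λ n → ℚ.≤-reflexive (h n)) ,
    ≤-pointwise y x (λ n → ℚ.≤-reflexive (sym (h n)))

  ≤-refl : ∀ x → x ≤ x
  ≤-refl x = ≤-pointwise x x (λ n → ℚ.≤-refl)

  ≤-trans : ∀ x y z → x ≤ y → y ≤ z → x ≤ z
  ≤-trans x y z p q ε 0<ε = eventually₂
    (λ n h k → ℚ.≤-trans h (ℚ.≤-trans (ℚ.+-monoˡ-≤ (½ ℚ.* ε) k)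
       (ℚ.≤-reflexive (+half+half (seq z n) ε))))
    (p (½ ℚ.* ε) (half>0 0<ε)) (q (½ ℚ.* ε) (half>0 0<ε))

  +-mono-≤ : ∀ x y u v → x ≤ y → u ≤ v → x + u ≤ y + v
  +-mono-≤ x y u v p q ε 0<ε = eventually₂
    (λ n h k → ℚ.≤-trans (ℚ.+-mono-≤ h k) (ℚ.≤-reflexive
       (solve 3 (λ y v ε → (y :+ con ½ :* ε) :+ (v :+ con ½ :* ε) := (y :+ v) :+ ε)
         refl (seq y n) (seq v n) ε)))
    (p (½ ℚ.* ε) (half>0 0<ε)) (q (½ ℚ.* ε) (half>0 0<ε))

  neg-antimono : ∀ x y → x ≤ y → D.- y ≤ D.- x
  neg-antimono x y p ε 0<ε = eventually₁
    (λ n h → subst₂ ℚ._≤_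
      (solve 3 (λ x y ε → x :+ ((:- x) :+ (:- y)) := :- y) refl (seq x n) (seq y n) ε)
      (solve 3 (λ x y ε → (y :+ ε) :+ ((:- x) :+ (:- y)) := (:- x) :+ ε) refl (seq x n) (seq y n) ε)
      (ℚ.+-monoˡ-≤ ((ℚ.- seq x n) ℚ.+ (ℚ.- seq y n)) h))
    (p ε 0<ε)

  eventually-bounded : ∀ x → ∃ λ B → 0ℚ ℚ.< B × Eventually (λ n → ℚ.∣ seq x n ∣ ℚ.≤ B)
  eventually-bounded x =
    let N , h = cauchy x 1ℚ (ℚ.positive⁻¹ 1ℚ)
        a = ℚ.∣ seq x N ∣
    in 1ℚ ℚ.+ a
     , ℚ.+-mono-<-≤ {0ℚ} {1ℚ} {0ℚ} (ℚ.positive⁻¹ 1ℚ) (ℚ.0≤∣p∣ (seq x N))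
     , N , λ n p → let open ℚ.≤-Reasoning in begin
         ℚ.∣ seq x n ∣
           ≡⟨ cong ℚ.∣_∣ (solve 2 (λ a b → a := (a :+ (:- b)) :+ b) refl (seq x n) (seq x N)) ⟩
         ℚ.∣ (seq x n ℚ.- seq x N) ℚ.+ seq x N ∣
           ≤⟨ ℚ.∣p+q∣≤∣p∣+∣q∣ (seq x n ℚ.- seq x N) (seq x N) ⟩
         ℚ.∣ seq x n ℚ.- seq x N ∣ ℚ.+ a
           ≤⟨ ℚ.+-monoˡ-≤ a (ℚ.<⇒≤ (h n N p ℕ.≤-refl)) ⟩
         1ℚ ℚ.+ a ∎

  p≤q+ε⇒p-q≤ε : ∀ {p q ε} → p ℚ.≤ q ℚ.+ ε → p ℚ.- q ℚ.≤ ε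
  p≤q+ε⇒p-q≤ε {p} {q} {ε} h = subst (p ℚ.- q ℚ.≤_)
    (solve 2 (λ q ε → (q :+ ε) :+ (:- q) := ε) refl q ε) (ℚ.+-monoˡ-≤ (ℚ.- q) h)

  ∣p-q∣≤ε : ∀ {p q ε} → p ℚ.≤ q ℚ.+ ε → q ℚ.≤ p ℚ.+ ε → ℚ.∣ p ℚ.- q ∣ ℚ.≤ ε
  ∣p-q∣≤ε {p} {q} {ε} h k with ℚ.∣p∣≡p∨∣p∣≡-p (p ℚ.- q)
  ... | inj₁ eq = subst (ℚ._≤ ε) (sym eq) (p≤q+ε⇒p-q≤ε h)
  ... | inj₂ eq = subst (ℚ._≤ ε)
    (sym (trans eq (solve 2 (λ p q → :- (p :+ (:- q)) := q :+ (:- p)) refl p q)))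
    (p≤q+ε⇒p-q≤ε k)

  -- Along the representatives, multiplication by x is Lipschitz with constant an eventual bound B
  -- of |x|, so it is enough that y and z differ by at most ε / B.
  *-congˡ-≤ : ∀ x y z → y ≈ z → x * y ≤ x * z
  *-congˡ-≤ x y z (y≤z , z≤y) ε 0<ε =
    let B , 0<B , bound = eventually-bounded x
        η , 0<η , Bη≡ε = divide 0<B ε 0<ε
    in eventually₂
      (λ n (h , k) b → let instance
                             _ = ℚ.∣-∣-nonNeg (seq y n ℚ.- seq z n)
                             _ = ℚ.pos⇒nonNeg B {{ℚ.positive 0<B}}
                           open ℚ.≤-Reasoning
                       in ∣p-q∣≤⇒p≤q+ (begin
         ℚ.∣ seq x n ℚ.* seq y n ℚ.- seq x n ℚ.* seq z n ∣
           ≡⟨ cong ℚ.∣_∣ (factor (seq x n) (seq y n) (seq z n)) ⟩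
         ℚ.∣ seq x n ℚ.* (seq y n ℚ.- seq z n) ∣
           ≡⟨ ℚ.∣p*q∣≡∣p∣*∣q∣ (seq x n) (seq y n ℚ.- seq z n) ⟩
         ℚ.∣ seq x n ∣ ℚ.* ℚ.∣ seq y n ℚ.- seq z n ∣
           ≤⟨ ℚ.*-monoʳ-≤-nonNeg ℚ.∣ seq y n ℚ.- seq z n ∣ b ⟩
         B ℚ.* ℚ.∣ seq y n ℚ.- seq z n ∣
           ≤⟨ ℚ.*-monoˡ-≤-nonNeg B (∣p-q∣≤ε h k) ⟩
         B ℚ.* η
           ≡⟨ Bη≡ε ⟩
         ε ∎))
      (eventually₂ (λ _ → _,_) (y≤z η 0<η) (z≤y η 0<η)) bound
    where
    factor : ∀ x y z → x ℚ.* y ℚ.- x ℚ.* z ≡ x ℚ.* (y ℚ.- z)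
    factor = solve 3 (λ x y z → x :* y :+ (:- (x :* z)) := x :* (y :+ (:- z))) refl

  *-congˡ : ∀ x y z → y ≈ z → (x * y) ≈ (x * z)
  *-congˡ x y z e = *-congˡ-≤ x y z e , *-congˡ-≤ x z y (swap e)

  ≈-trans : ∀ x y z → x ≈ y → y ≈ z → x ≈ z
  ≈-trans x y z (p , p′) (q , q′) = ≤-trans x y z p q , ≤-trans z y x q′ p′

  *-comm : ∀ x y → (x * y) ≈ (y * x)
  *-comm x y = ≈-pointwise (x * y) (y * x) (λ n → ℚ.*-comm (seq x n) (seq y n))

  *-cong : ∀ {x y u v} → x ≈ y → u ≈ v → (x * u) ≈ (y * v)
  *-cong {x} {y} {u} {v} p q =
    ≈-trans (x * u) (x * v) (y * v) (*-congˡ x u v q)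
      (≈-trans (x * v) (v * x) (y * v) (*-comm x v)
        (≈-trans (v * x) (v * y) (y * v) (*-congˡ v x y p) (*-comm v y)))

  -- The rational terms of a nonnegative real may be slightly negative. If both are, their product
  -- is nonnegative; if one is, it exceeds minus the tolerance, and the tolerance times the bound of
  -- the other factor is ε.
  *-nonNeg : ∀ x y → D.fromℚ 0ℚ ≤ x → D.fromℚ 0ℚ ≤ y → D.fromℚ 0ℚ ≤ x * y
  *-nonNeg x y 0≤x 0≤y ε 0<ε =
    let A , 0<A , boundx = eventually-bounded x
        B , 0<B , boundy = eventually-bounded y
        η , 0<η , Aη≡ε = divide 0<A ε 0<ε
        θ , 0<θ , Bθ≡ε = divide 0<B ε 0<ε
    in eventually₂ (λ n → λ { (b , h) (c , k) → bound (seq x n)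
            (seq y n) b c h k 0<A 0<B 0<η 0<θ Aη≡ε Bθ≡ε })
         (eventually₂ (λ _ → _,_) boundx (0≤x θ 0<θ)) (eventually₂ (λ _ → _,_) boundy (0≤y η 0<η))
    where
    move : ∀ {p ε} → 0ℚ ℚ.≤ p ℚ.+ ε → ℚ.- p ℚ.≤ ε
    move {p} {ε} h = subst₂ ℚ._≤_ (ℚ.+-identityˡ (ℚ.- p))
      (solve 2 (λ p ε → (p :+ ε) :+ (:- p) := ε) refl p ε) (ℚ.+-monoˡ-≤ (ℚ.- p) h)

    scale : ∀ {p q A η ε} → 0ℚ ℚ.≤ p → p ℚ.≤ A → 0ℚ ℚ.≤ q ℚ.+ η → 0ℚ ℚ.< η → A ℚ.* η ≡ ε →
            0ℚ ℚ.≤ p ℚ.* q ℚ.+ ε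
    scale {p} {q} {A} {η} {ε} 0≤p p≤A h 0<η eq = let open ℚ.≤-Reasoning in begin
      0ℚ                                ≡⟨ sym (ℚ.*-zeroʳ p) ⟩
      p ℚ.* 0ℚ                          ≤⟨ ℚ.*-monoˡ-≤-nonNeg p {{ℚ.nonNegative 0≤p}} h ⟩
      p ℚ.* (q ℚ.+ η)                   ≡⟨ ℚ.*-distribˡ-+ p q η ⟩
      p ℚ.* q ℚ.+ p ℚ.* η
        ≤⟨ ℚ.+-monoʳ-≤ (p ℚ.* q) (ℚ.*-monoʳ-≤-nonNeg η {{ℚ.nonNegative (ℚ.<⇒≤ 0<η)}} p≤A) ⟩
      p ℚ.* q ℚ.+ A ℚ.* η               ≡⟨ cong (p ℚ.* q ℚ.+_) eq ⟩
      p ℚ.* q ℚ.+ ε                     ∎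

    bound : ∀ p q {A B η θ ε} → ℚ.∣ p ∣ ℚ.≤ A → ℚ.∣ q ∣ ℚ.≤ B →
            0ℚ ℚ.≤ p ℚ.+ θ → 0ℚ ℚ.≤ q ℚ.+ η →
            0ℚ ℚ.< A → 0ℚ ℚ.< B → 0ℚ ℚ.< η → 0ℚ ℚ.< θ → A ℚ.* η ≡ ε → B ℚ.* θ ≡ ε →
            0ℚ ℚ.≤ p ℚ.* q ℚ.+ ε
    bound p q {A} {B} {η} {θ} {ε} b c h k 0<A 0<B 0<η 0<θ eq eq′ with ℚ.≤-total 0ℚ p | ℚ.≤-total 0ℚ q
    ... | inj₁ 0≤p | _ = scale 0≤p (ℚ.≤-trans (p≤∣p∣ p) b) k 0<η eq
    ... | inj₂ p≤0 | inj₁ 0≤q = subst (λ z → 0ℚ ℚ.≤ z ℚ.+ ε) (ℚ.*-comm q p)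
      (scale 0≤q (ℚ.≤-trans (p≤∣p∣ q) c) h 0<θ eq′)
    ... | inj₂ p≤0 | inj₂ q≤0 = ℚ.≤-trans
      (ℚ.nonNegative⁻¹ (p ℚ.* q) {{ℚ.nonPos*nonPos⇒nonPos p {{ℚ.nonPositive p≤0}} q {{ℚ.nonPositive q≤0}}}})
      (p≤p+ε (p ℚ.* q) (subst (0ℚ ℚ.<_) eq (*-pos 0<A 0<η)))

  -- If q < p, a rational m strictly between them and the tolerance m - q would force p ≤ m.
  ι-cancel : ∀ p q → D.fromℚ p ≤ D.fromℚ q → p ℚ.≤ q
  ι-cancel p q h with p ℚ.≤? q
  ... | yes p≤q = p≤q
  ... | no  p≰q =
    let q<p = ℚ.≰⇒> p≰q
        m , q<m , m<p = ℚ.<-dense q<p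
        0<m-q = subst (ℚ._< m ℚ.- q) (ℚ.+-inverseʳ q) (ℚ.+-monoˡ-< (ℚ.- q) q<m)
        N , k = h (m ℚ.- q) 0<m-q
    in ⊥-elim (ℚ.<-irrefl refl (ℚ.<-≤-trans m<p (subst (p ℚ.≤_)
         (solve 2 (λ q m → q :+ (m :+ (:- q)) := m) refl q m) (k N ℕ.≤-refl))))

  ≤-closed : ∀ x y → (∀ ε → 0ℚ ℚ.< ε → x ≤ y + D.fromℚ ε) → x ≤ y
  ≤-closed x y h ε 0<ε = eventually₁ (λ n k → ℚ.≤-trans k (ℚ.≤-reflexive (+half+half (seq y n) ε)))
    (h (½ ℚ.* ε) (half>0 0<ε) (½ ℚ.* ε) (half>0 0<ε))

  three = + 3 ℚ./ 1

  -- A single rational comparison at the index N decides for all later indices. The drift of the two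
  -- sequences costs up to 2η: added to the threshold 3η it gives the bound 5η, subtracted from it
  -- it leaves the gap η.
  gap : ∀ x y η → 0ℚ ℚ.< η → ∀ N →
        (∀ m n → N ℕ.≤ m → N ℕ.≤ n → seq x m ℚ.≤ seq x n ℚ.+ η) →
        (∀ m n → N ℕ.≤ m → N ℕ.≤ n → seq y m ℚ.≤ seq y n ℚ.+ η) →
        (∀ n → N ℕ.≤ n → seq x n ℚ.≤ seq y n ℚ.+ ((η ℚ.+ η) ℚ.+ three ℚ.* η)) ⊎
        (∀ n → N ℕ.≤ n → seq y n ℚ.+ η ℚ.≤ seq x n)
  gap x y η 0<η N cx cy with seq x N ℚ.≤? seq y N ℚ.+ three ℚ.* η
  ... | yes h = inj₁ λ n N≤n → let open ℚ.≤-Reasoning in begin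
      seq x n                                   ≤⟨ cx n N N≤n ℕ.≤-refl ⟩
      seq x N ℚ.+ η                             ≤⟨ ℚ.+-monoˡ-≤ η h ⟩
      (seq y N ℚ.+ three ℚ.* η) ℚ.+ η
        ≤⟨ ℚ.+-monoˡ-≤ η (ℚ.+-monoˡ-≤ (three ℚ.* η) (cy N n ℕ.≤-refl N≤n)) ⟩
      ((seq y n ℚ.+ η) ℚ.+ three ℚ.* η) ℚ.+ η
        ≡⟨ solve 3 (λ y η θ → ((y :+ η) :+ θ) :+ η := y :+ ((η :+ η) :+ θ)) refl (seq y n) η (three ℚ.* η) ⟩
      seq y n ℚ.+ ((η ℚ.+ η) ℚ.+ three ℚ.* η)   ∎
  ... | no ¬h = inj₂ λ n N≤n → let open ℚ.≤-Reasoning in begin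
      seq y n ℚ.+ η                             ≤⟨ ℚ.+-monoˡ-≤ η (cy n N N≤n ℕ.≤-refl) ⟩
      (seq y N ℚ.+ η) ℚ.+ η
        ≡⟨ solve 2 (λ y η → (y :+ η) :+ η := (y :+ con three :* η) :+ (:- η)) refl (seq y N) η ⟩
      (seq y N ℚ.+ three ℚ.* η) ℚ.- η           ≤⟨ ℚ.+-monoˡ-≤ (ℚ.- η) (ℚ.<⇒≤ (ℚ.≰⇒> ¬h)) ⟩
      seq x N ℚ.- η                             ≤⟨ ℚ.+-monoˡ-≤ (ℚ.- η) (cx N n ℕ.≤-refl N≤n) ⟩
      (seq x n ℚ.+ η) ℚ.- η
        ≡⟨ solve 2 (λ x η → (x :+ η) :+ (:- η) := x) refl (seq x n) η ⟩
      seq x n                                   ∎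

  ≤-or-apart : ∀ x y ε → 0ℚ ℚ.< ε → x ≤ y + D.fromℚ ε ⊎ ∃ λ δ → 0ℚ ℚ.< δ × y + D.fromℚ δ ≤ x
  ≤-or-apart x y ε 0<ε = separate (divide (ℚ.positive⁻¹ five) ε 0<ε)
    where
    five = + 5 ℚ./ 1

    conclude : ∀ η → 0ℚ ℚ.< η → five ℚ.* η ≡ ε → ∀ N →
               (∀ n → N ℕ.≤ n → seq x n ℚ.≤ seq y n ℚ.+ ((η ℚ.+ η) ℚ.+ three ℚ.* η)) ⊎
               (∀ n → N ℕ.≤ n → seq y n ℚ.+ η ℚ.≤ seq x n) →
               x ≤ y + D.fromℚ ε ⊎ ∃ λ δ → 0ℚ ℚ.< δ × y + D.fromℚ δ ≤ x
    conclude η 0<η 5η≡ε N (inj₁ h) = inj₁ λ θ 0<θ → N , λ n N≤n →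
      ℚ.≤-trans (subst (λ z → seq x n ℚ.≤ seq y n ℚ.+ z) (trans (collect η) 5η≡ε) (h n N≤n))
        (p≤p+ε (seq y n ℚ.+ ε) 0<θ)
      where
      collect : ∀ η → (η ℚ.+ η) ℚ.+ three ℚ.* η ≡ five ℚ.* η
      collect = solve 1 (λ η → (η :+ η) :+ con three :* η := con five :* η) refl
    conclude η 0<η 5η≡ε N (inj₂ h) = inj₂ (η , 0<η , λ θ 0<θ → N , λ n N≤n →
      ℚ.≤-trans (h n N≤n) (p≤p+ε (seq x n) 0<θ))

    separate : (∃ λ η → 0ℚ ℚ.< η × five ℚ.* η ≡ ε) →
               x ≤ y + D.fromℚ ε ⊎ ∃ λ δ → 0ℚ ℚ.< δ × y + D.fromℚ δ ≤ x
    separate (η , 0<η , 5η≡ε) =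
      let M , cx = cauchy≤ x η 0<η
          N , cy = cauchy≤ y η 0<η
      in conclude η 0<η 5η≡ε (M ℕ.⊔ N) (gap x y η 0<η (M ℕ.⊔ N)
           (λ m n p q → cx m n (ℕ.m⊔n≤o⇒m≤o M N p) (ℕ.m⊔n≤o⇒m≤o M N q))
               (λ m n p q → cy m n (ℕ.m⊔n≤o⇒n≤o M N p) (ℕ.m⊔n≤o⇒n≤o M N q)))

  approximate : ∀ x ε → 0ℚ ℚ.< ε → ∃ λ q → x ≤ D.fromℚ q + D.fromℚ ε × D.fromℚ q ≤ x + D.fromℚ ε
  approximate x ε 0<ε = let N , h = cauchy≤ x ε 0<ε in
    seq x N
    , (λ θ 0<θ → N , λ n N≤n → ℚ.≤-trans (h n N N≤n ℕ.≤-refl) (p≤p+ε _ 0<θ))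
    , (λ θ 0<θ → N , λ n N≤n → ℚ.≤-trans (h N n ℕ.≤-refl N≤n) (p≤p+ε _ 0<θ))

  -- Diagonal construction: `b k` is a rational within 1/(k + 1) of `a k`, and the sequence `b` is
  -- itself a representative of the limit.
  module Completion (a : ℕ → ℝ)
    (a-cauchy : ∀ ε → 0ℚ ℚ.< ε → ∃ λ N → ∀ m n → N ℕ.≤ m → N ℕ.≤ n → a m ≤ a n + D.fromℚ ε) where

    b : ℕ → ℚ
    b k = proj₁ (approximate (a k) (recip k) (recip>0 k))

    a≤b : ∀ k → a k ≤ D.fromℚ (b k) + D.fromℚ (recip k)
    a≤b k = proj₁ (proj₂ (approximate (a k) (recip k) (recip>0 k)))

    b≤a : ∀ k → D.fromℚ (b k) ≤ a k + D.fromℚ (recip k)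
    b≤a k = proj₂ (proj₂ (approximate (a k) (recip k) (recip>0 k)))

    -- One η for each passage: from `b j` to `a j`, from `a j` to `a k`, and from `a k` to `b k`.
    b-cauchy≤ : ∀ η → 0ℚ ℚ.< η → ∃ λ N → ∀ j k → N ℕ.≤ j → N ℕ.≤ k →
                b j ℚ.≤ ((b k ℚ.+ η) ℚ.+ η) ℚ.+ η
    b-cauchy≤ η 0<η =
      let M , close = a-cauchy η 0<η
          N , small = recip-small η 0<η
      in M ℕ.⊔ N , λ j k p q →
        let rj≤η = ℚ.≤-trans (recip-antimono (ℕ.m⊔n≤o⇒n≤o M N p)) small
            rk≤η = ℚ.≤-trans (recip-antimono (ℕ.m⊔n≤o⇒n≤o M N q)) small
            bj = D.fromℚ (b j)
            bk = D.fromℚ (b k)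
            rj = D.fromℚ (recip j)
            rk = D.fromℚ (recip k)
            e  = D.fromℚ η
            step₁ = b≤a j
            step₂ = +-mono-≤ (a j) (a k + e) rj e
              (close j k (ℕ.m⊔n≤o⇒m≤o M N p) (ℕ.m⊔n≤o⇒m≤o M N q))
              (≤-pointwise rj e (λ _ → rj≤η))
            step₃ = +-mono-≤ (a k + e) ((bk + e) + e) e e
              (+-mono-≤ (a k) (bk + e) e e
                (≤-trans (a k) (bk + rk) (bk + e) (a≤b k)
                  (+-mono-≤ bk bk rk e (≤-refl bk) (≤-pointwise rk e (λ _ → rk≤η))))
                (≤-refl e))
              (≤-refl e)
        in ι-cancel (b j) (((b k ℚ.+ η) ℚ.+ η) ℚ.+ η)
             (≤-trans bj (a j + rj) (((bk + e) + e) + e) step₁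
               (≤-trans (a j + rj) ((a k + e) + e) (((bk + e) + e) + e) step₂ step₃))

    ℓ-cauchy : D.Cauchy b
    -- Three quarters of ε are spent by `b-cauchy≤`; the fourth makes the inequality strict.
    ℓ-cauchy ε 0<ε = conclude (divide (ℚ.positive⁻¹ four) ε 0<ε)
      where
      four = + 4 ℚ./ 1

      collect : ∀ b η → ((b ℚ.+ η) ℚ.+ η) ℚ.+ η ≡ b ℚ.+ three ℚ.* η
      collect = solve 2 (λ b η → ((b :+ η) :+ η) :+ η := b :+ con three :* η) refl

      four-thirds : ∀ η → three ℚ.* η ℚ.+ η ≡ four ℚ.* η
      four-thirds = solve 1 (λ η → con three :* η :+ η := con four :* η) refl

      conclude : (∃ λ η → 0ℚ ℚ.< η × four ℚ.* η ≡ ε) →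
                 ∃ λ N → ∀ m n → N ℕ.≤ m → N ℕ.≤ n → ℚ.∣ b m ℚ.- b n ∣ ℚ.< ε
      conclude (η , 0<η , 4η≡ε) = let N , h = b-cauchy≤ η 0<η in
        N , λ m n p q → ℚ.≤-<-trans
          (∣p-q∣≤ε (subst (b m ℚ.≤_) (collect (b n) η) (h m n p q))
                   (subst (b n ℚ.≤_) (collect (b m) η) (h n m q p)))
          (subst₂ ℚ._<_ (ℚ.+-identityʳ (three ℚ.* η)) (trans (four-thirds η) 4η≡ε)
            (ℚ.+-monoʳ-< (three ℚ.* η) 0<η))

    ℓ : ℝ
    ℓ = mkℝ b ℓ-cauchy

    a⟶ℓ : ∀ ε → 0ℚ ℚ.< ε → ∃ λ N → ∀ n → N ℕ.≤ n → a n ≤ ℓ + D.fromℚ ε × ℓ ≤ a n + D.fromℚ ε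
    a⟶ℓ ε 0<ε = conclude (divide (ℚ.positive⁻¹ four) ε 0<ε)
      where
      four = + 4 ℚ./ 1

      widen : ∀ b η → (((b ℚ.+ η) ℚ.+ η) ℚ.+ η) ℚ.+ η ≡ b ℚ.+ four ℚ.* η
      widen = solve 2 (λ b η → (((b :+ η) :+ η) :+ η) :+ η := b :+ con four :* η) refl

      reorder : ∀ a θ η → ((((a ℚ.+ η) ℚ.+ θ) ℚ.+ η) ℚ.+ η) ℚ.+ η ≡ (a ℚ.+ four ℚ.* η) ℚ.+ θ
      reorder = solve 3 (λ a θ η → ((((a :+ η) :+ θ) :+ η) :+ η) :+ η := (a :+ con four :* η) :+ θ) refl

      conclude : (∃ λ η → 0ℚ ℚ.< η × four ℚ.* η ≡ ε) →
                 ∃ λ N → ∀ n → N ℕ.≤ n → a n ≤ ℓ + D.fromℚ ε × ℓ ≤ a n + D.fromℚ ε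
      conclude (η , 0<η , 4η≡ε) =
        let M , close = b-cauchy≤ η 0<η
            N , small = recip-small η 0<η
        in M ℕ.⊔ N , λ n p →
          let M≤n = ℕ.m⊔n≤o⇒m≤o M N p
              r≤η = ℚ.≤-trans (recip-antimono (ℕ.m⊔n≤o⇒n≤o M N p)) small
          in (λ θ 0<θ → eventually₂
                (λ k h g → ℚ.≤-trans h (ℚ.+-monoˡ-≤ θ (ℚ.≤-trans (ℚ.+-mono-≤ g r≤η)
                  (ℚ.≤-reflexive (trans (widen (b k) η) (cong (b k ℚ.+_) 4η≡ε))))))
                (a≤b n θ 0<θ) (M , λ k M≤k → close n k M≤n M≤k))
           , (λ θ 0<θ → eventually₂
                (λ k h g → ℚ.≤-trans g (ℚ.≤-trans
                  (ℚ.+-monoˡ-≤ η (ℚ.+-monoˡ-≤ η (ℚ.+-monoˡ-≤ η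
                    (ℚ.≤-trans h (ℚ.+-monoˡ-≤ θ (ℚ.+-monoʳ-≤ (seq (a n) k) r≤η))))))
                  (ℚ.≤-reflexive (trans (reorder (seq (a n) k) θ η)
                    (cong (λ z → (seq (a n) k ℚ.+ z) ℚ.+ θ) 4η≡ε)))))
                (b≤a n θ 0<θ) (M , λ k M≤k → close k n M≤k M≤n))

  cauchyReals : Reals
  cauchyReals = record
    { R = ℝ
    ; _≈_ = _≈_
    ; _≤_ = _≤_
    ; _+_ = _+_
    ; _*_ = _*_
    ; -_ = D.-_
    ; ι = D.fromℚ
    ; isCommutativeRing = record
      { isRing = record
        { +-isAbelianGroup = record
          { isGroup = record
            { isMonoid = record
              { isSemigroup = record
                { isMagma = record
                  { isEquivalence = record
                    { refl = λ {x} → ≤-refl x , ≤-refl x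
                    ; sym = swap
                    ; trans = λ {x} {y} {z} → ≈-trans x y z
                    }
                  ; ∙-cong = λ {x} {y} {u} {v} (p , p′) (q , q′) →
                      +-mono-≤ x y u v p q , +-mono-≤ y x v u p′ q′
                  }
                ; assoc = λ x y z → ≈-pointwise ((x + y) + z) (x + (y + z))
                    λ n → ℚ.+-assoc (seq x n) (seq y n) (seq z n)
                }
              ; identity =
                  (λ x → ≈-pointwise (D.fromℚ 0ℚ + x) x λ n → ℚ.+-identityˡ (seq x n)) ,
                  (λ x → ≈-pointwise (x + D.fromℚ 0ℚ) x λ n → ℚ.+-identityʳ (seq x n))
              }
            ; inverse =
                (λ x → ≈-pointwise ((D.- x) + x) (D.fromℚ 0ℚ) λ n → ℚ.+-inverseˡ (seq x n)) ,
                (λ x → ≈-pointwise (x + (D.- x)) (D.fromℚ 0ℚ) λ n → ℚ.+-inverseʳ (seq x n))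
            ; ⁻¹-cong = λ {x} {y} (p , p′) → neg-antimono y x p′ , neg-antimono x y p
            }
          ; comm = λ x y → ≈-pointwise (x + y) (y + x) λ n → ℚ.+-comm (seq x n) (seq y n)
          }
        ; *-cong = λ {x} {y} {u} {v} → *-cong {x} {y} {u} {v}
        ; *-assoc = λ x y z → ≈-pointwise ((x * y) * z) (x * (y * z))
            λ n → ℚ.*-assoc (seq x n) (seq y n) (seq z n)
        ; *-identity =
            (λ x → ≈-pointwise (D.fromℚ 1ℚ * x) x λ n → ℚ.*-identityˡ (seq x n)) ,
            (λ x → ≈-pointwise (x * D.fromℚ 1ℚ) x λ n → ℚ.*-identityʳ (seq x n))
        ; distrib =
            (λ x y z → ≈-pointwise (x * (y + z)) ((x * y) + (x * z))
              λ n → ℚ.*-distribˡ-+ (seq x n) (seq y n) (seq z n)) ,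
            (λ x y z → ≈-pointwise ((y + z) * x) ((y * x) + (z * x))
              λ n → ℚ.*-distribʳ-+ (seq x n) (seq y n) (seq z n))
        }
      ; *-comm = *-comm
      }
    ; ≤-reflexive = proj₁
    ; ≤-antisym = _,_
    ; ≤-trans = λ {x} {y} {z} → ≤-trans x y z
    ; +-mono-≤ = λ {x} {y} {u} {v} → +-mono-≤ x y u v
    ; *-nonNeg = λ {x} {y} → *-nonNeg x y
    ; ι-+ = λ p q → ≈-pointwise (D.fromℚ (p ℚ.+ q)) (D.fromℚ p + D.fromℚ q) λ _ → refl
    ; ι-* = λ p q → ≈-pointwise (D.fromℚ (p ℚ.* q)) (D.fromℚ p * D.fromℚ q) λ _ → refl
    ; ι-neg = λ p → ≈-pointwise (D.fromℚ (ℚ.- p)) (D.- D.fromℚ p) λ _ → refl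
    ; ι-mono = λ {p} {q} p≤q → ≤-pointwise (D.fromℚ p) (D.fromℚ q) λ _ → p≤q
    ; ι-cancel = λ {p} {q} → ι-cancel p q
    ; ≤-closed = λ {x} {y} → ≤-closed x y
    ; ≤-or-apart = ≤-or-apart
    ; approximate = approximate
    ; complete = λ a a-cauchy → let open Completion a a-cauchy in ℓ , a⟶ℓ
    }

-- Analysis from the axioms of `Reals`

module Analysis (𝓡 : Reals) where

  open Reals 𝓡 public
  open IsCommutativeRing isCommutativeRing public
    using (+-cong; *-cong; -‿cong; +-comm; *-comm; +-assoc; *-assoc; +-identityˡ; +-identityʳ;
           *-identityˡ; *-identityʳ; zeroˡ; zeroʳ)
    renaming (refl to ≈-refl; sym to ≈-sym; trans to ≈-trans; reflexive to ≈-reflexive)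

  infixl 6 _-_
  infixr 8 _^_
  infix  4 ∣_∣≤_

  commutativeRing : CommutativeRing 0ℓ 0ℓ
  commutativeRing = record { isCommutativeRing = isCommutativeRing }

  ι-cong : ∀ {p q} → p ≡ q → ι p ≈ ι q
  ι-cong refl = ≈-refl

  private
    -- With coefficients in ℚ the ring solver also evaluates constants such as ½ and ¼, so that
    -- identities containing them need no separate treatment.
    ℚ⟶R : CommutativeRing.rawRing ℚ.+-*-commutativeRing
          -Raw-AlmostCommutative⟶ fromCommutativeRing commutativeRing
    ℚ⟶R = record
      { ⟦_⟧ = ι ; +-homo = ι-+ ; *-homo = ι-* ; -‿homo = ι-neg ; 0-homo = ≈-refl ; 1-homo = ≈-refl }

    ι-≟ : ∀ p q → Maybe (ι p ≈ ι q)
    ι-≟ p q with p ℚ.≟ q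
    ... | yes p≡q = just (ι-cong p≡q)
    ... | no  _   = nothing

  open RingSolver _ _ ℚ⟶R ι-≟ public using (solve; con; _:+_; _:*_; _:-_; :-_; _:=_)

  𝟘 𝟙 : R
  𝟘 = ι 0ℚ
  𝟙 = ι 1ℚ

  _-_ : R → R → R
  x - y = x + (- y)

  ≤-refl : ∀ {x} → x ≤ x
  ≤-refl = ≤-reflexive ≈-refl

  ≤-preorder : Preorder 0ℓ 0ℓ 0ℓ
  ≤-preorder = record
    { isPreorder = record
      { isEquivalence = IsCommutativeRing.isEquivalence isCommutativeRing
      ; reflexive = ≤-reflexive
      ; trans = ≤-trans
      }
    }

  module ≤-Reasoning = PreorderReasoning ≤-preorder

  -- Order

  -- The standard way to prove an inequality below: the difference is written as a sum of products
  -- that are nonnegative factor by factor, and the identity is left to the ring solver.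
  ≤-by : ∀ {x y} d → 𝟘 ≤ d → y ≈ x + d → x ≤ y
  ≤-by {x} {y} d 0≤d y≈x+d = begin
    x      ≈⟨ ≈-sym (+-identityʳ x) ⟩
    x + 𝟘  ≲⟨ +-mono-≤ ≤-refl 0≤d ⟩
    x + d  ≈⟨ ≈-sym y≈x+d ⟩
    y      ∎
    where open ≤-Reasoning

  0≤diff : ∀ {x y} → x ≤ y → 𝟘 ≤ y - x
  0≤diff {x} {y} x≤y = begin
    𝟘      ≈⟨ solve 1 (λ x → con 0ℚ := x :- x) ≈-refl x ⟩
    x - x  ≲⟨ +-mono-≤ x≤y ≤-refl ⟩
    y - x  ∎
    where open ≤-Reasoning

  diff≥0 : ∀ {x y} → 𝟘 ≤ y - x → x ≤ y
  diff≥0 {x} {y} h = ≤-by (y - x) h (solve 2 (λ x y → y := x :+ (y :- x)) ≈-refl x y)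

  0≤+ : ∀ {x y} → 𝟘 ≤ x → 𝟘 ≤ y → 𝟘 ≤ x + y
  0≤+ {x} {y} 0≤x 0≤y = ≤-trans (≤-by 𝟘 ≤-refl (solve 0 (con 0ℚ :+ con 0ℚ := con 0ℚ :+ con 0ℚ) ≈-refl))
      (+-mono-≤ 0≤x 0≤y)

  0≤ι : ∀ {q} → 0ℚ ℚ.≤ q → 𝟘 ≤ ι q
  0≤ι = ι-mono

  0<⇒0≤ι : ∀ {q} → 0ℚ ℚ.< q → 𝟘 ≤ ι q
  0<⇒0≤ι 0<q = ι-mono (ℚ.<⇒≤ 0<q)

  0≤½ : 𝟘 ≤ ι ½
  0≤½ = 0<⇒0≤ι ½>0

  0≤1 : 𝟘 ≤ 𝟙
  0≤1 = 0<⇒0≤ι (ℚ.positive⁻¹ 1ℚ)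

  neg-antimono : ∀ {x y} → x ≤ y → - y ≤ - x
  neg-antimono {x} {y} x≤y =
    ≤-by (y - x) (0≤diff x≤y) (solve 2 (λ x y → :- x := (:- y) :+ (y :- x)) ≈-refl x y)

  *-monoˡ-≤ : ∀ {x y z} → 𝟘 ≤ z → x ≤ y → z * x ≤ z * y
  *-monoˡ-≤ {x} {y} {z} 0≤z x≤y = ≤-by (z * (y - x)) (*-nonNeg 0≤z (0≤diff x≤y))
    (solve 3 (λ x y z → z :* y := z :* x :+ z :* (y :- x)) ≈-refl x y z)

  *-monoʳ-≤ : ∀ {x y z} → 𝟘 ≤ z → x ≤ y → x * z ≤ y * z
  *-monoʳ-≤ {x} {y} {z} 0≤z x≤y = ≤-by (z * (y - x)) (*-nonNeg 0≤z (0≤diff x≤y))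
    (solve 3 (λ x y z → y :* z := x :* z :+ z :* (y :- x)) ≈-refl x y z)

  *-mono-≤ : ∀ {x y u v} → 𝟘 ≤ y → 𝟘 ≤ u → x ≤ y → u ≤ v → x * u ≤ y * v
  *-mono-≤ 0≤y 0≤u x≤y u≤v = ≤-trans (*-monoʳ-≤ 0≤u x≤y) (*-monoˡ-≤ 0≤y u≤v)

  ≤-respˡ : ∀ {x y z} → x ≈ y → x ≤ z → y ≤ z
  ≤-respˡ x≈y = ≤-trans (≤-reflexive (≈-sym x≈y))

  ≤-respʳ : ∀ {x y z} → x ≈ y → z ≤ x → z ≤ y
  ≤-respʳ x≈y z≤x = ≤-trans z≤x (≤-reflexive x≈y)

  x+δ≰x : ∀ {x δ} → 0ℚ ℚ.< δ → ¬ (x + ι δ ≤ x)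
  x+δ≰x {x} {δ} 0<δ h = ℚ.<-irrefl refl (ℚ.<-≤-trans 0<δ (ι-cancel (begin
    ι δ             ≈⟨ solve 2 (λ x d → d := (x :+ d) :- x) ≈-refl x (ι δ) ⟩
    (x + ι δ) - x   ≲⟨ +-mono-≤ h ≤-refl ⟩
    x - x           ≈⟨ solve 1 (λ x → x :- x := con 0ℚ) ≈-refl x ⟩
    𝟘               ∎)))
    where open ≤-Reasoning

  -- With an ε of room the comparison is available, and its second alternative puts x above y by a
  -- positive rational, which contradicts x ≤ y.
  ≤-stable : ∀ {x y} → ¬ ¬ (x ≤ y) → x ≤ y
  ≤-stable {x} {y} ¬¬x≤y = ≤-closed λ ε 0<ε → case (≤-or-apart x y ε 0<ε)
    where
    case : ∀ {ε} → x ≤ y + ι ε ⊎ (∃ λ δ → 0ℚ ℚ.< δ × y + ι δ ≤ x) → x ≤ y + ι ε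
    case (inj₁ h) = h
    case (inj₂ (δ , 0<δ , h)) = ⊥-elim (¬¬x≤y λ x≤y → x+δ≰x 0<δ (≤-trans h x≤y))

  ≰⇒≥ : ∀ {x y} → ¬ (x ≤ y) → y ≤ x
  ≰⇒≥ {x} {y} x≰y = ≤-closed λ ε 0<ε → case (≤-or-apart y x ε 0<ε)
    where
    case : ∀ {ε} → y ≤ x + ι ε ⊎ (∃ λ δ → 0ℚ ℚ.< δ × x + ι δ ≤ y) → y ≤ x + ι ε
    case (inj₁ h) = h
    case (inj₂ (δ , 0<δ , h)) =
      ⊥-elim (x≰y (≤-trans (≤-by (ι δ) (0<⇒0≤ι 0<δ) ≈-refl) h))

  -- Constructively valid because the order is total up to double negation and ≤ is
  -- stable under it.
  ≤-cases : ∀ x y {u v} → (x ≤ y → u ≤ v) → (y ≤ x → u ≤ v) → u ≤ v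
  ≤-cases x y f g = ≤-stable λ u≰v → u≰v (g (≰⇒≥ λ x≤y → u≰v (f x≤y)))

  square-nonNeg : ∀ x → 𝟘 ≤ x * x
  square-nonNeg x = ≤-cases 𝟘 x (λ h → *-nonNeg h h)
    (λ x≤0 → ≤-respʳ (solve 1 (λ x → (con 0ℚ :- x) :* (con 0ℚ :- x) := x :* x) ≈-refl x)
      (*-nonNeg (0≤diff x≤0) (0≤diff x≤0)))

  -- Absolute bounds

  record ∣_∣≤_ (x b : R) : Set where
    constructor bounds
    field
      upper : x ≤ b
      lower : - x ≤ b

  open ∣_∣≤_ public

  ∣∣≤-cong : ∀ {x y b} → x ≈ y → ∣ x ∣≤ b → ∣ y ∣≤ b
  ∣∣≤-cong x≈y (bounds u l) = bounds (≤-respˡ x≈y u) (≤-respˡ (-‿cong x≈y) l)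

  ∣∣≤-weaken : ∀ {x b c} → b ≤ c → ∣ x ∣≤ b → ∣ x ∣≤ c
  ∣∣≤-weaken b≤c (bounds u l) = bounds (≤-trans u b≤c) (≤-trans l b≤c)

  ∣∣≤-+ : ∀ {x y b c} → ∣ x ∣≤ b → ∣ y ∣≤ c → ∣ x + y ∣≤ b + c
  ∣∣≤-+ {x} {y} (bounds u l) (bounds u′ l′) = bounds (+-mono-≤ u u′)
    (≤-respˡ (solve 2 (λ x y → (:- x) :+ (:- y) := :- (x :+ y)) ≈-refl x y) (+-mono-≤ l l′))

  ∣∣≤-neg : ∀ {x b} → ∣ x ∣≤ b → ∣ - x ∣≤ b
  ∣∣≤-neg {x} (bounds u l) = bounds l (≤-respˡ (solve 1 (λ x → x := :- (:- x)) ≈-refl x) u)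

  -- No signs of x and y are known, so the proof rests on bc - xy = ½ ((b - x)(c + y) + (b + x)(c -
  -- y)).
  ∣∣≤-* : ∀ {x y b c} → ∣ x ∣≤ b → ∣ y ∣≤ c → ∣ x * y ∣≤ b * c
  ∣∣≤-* {x} {y} {b} {c} X Y = bounds (half X Y)
    (≤-respˡ (solve 2 (λ x y → (:- x) :* y := :- (x :* y)) ≈-refl x y) (half (∣∣≤-neg X) Y))
    where
    half : ∀ {x y b c} → ∣ x ∣≤ b → ∣ y ∣≤ c → x * y ≤ b * c
    half {x} {y} {b} {c} (bounds u l) (bounds u′ l′) = ≤-by _
      (*-nonNeg 0≤½ (0≤+ (*-nonNeg (0≤diff u) (0≤diff l′)) (*-nonNeg (0≤diff l) (0≤diff u′))))
      (solve 4 (λ x y b c → b :* c := x :* y :+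
         con ½ :* ((b :- x) :* (c :- (:- y)) :+ (b :- (:- x)) :* (c :- y))) ≈-refl x y b c)

  0≤⇒∣∣≤ : ∀ {x b} → 𝟘 ≤ x → x ≤ b → ∣ x ∣≤ b
  0≤⇒∣∣≤ {x} 0≤x x≤b = bounds x≤b (≤-trans
    (≤-by (x + x) (0≤+ 0≤x 0≤x) (solve 1 (λ x → x := (:- x) :+ (x :+ x)) ≈-refl x)) x≤b)

  ∣∣≤⇒0≤ : ∀ {x b} → ∣ x ∣≤ b → 𝟘 ≤ b
  ∣∣≤⇒0≤ {x} {b} (bounds u l) = ≤-by _ (*-nonNeg 0≤½ (0≤+ (0≤diff u) (0≤diff l)))
    (solve 2 (λ x b → b := con 0ℚ :+ con ½ :* ((b :- x) :+ (b :- (:- x)))) ≈-refl x b)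

  ∣𝟘∣≤ : ∀ {b} → 𝟘 ≤ b → ∣ 𝟘 ∣≤ b
  ∣𝟘∣≤ = 0≤⇒∣∣≤ ≤-refl

  ∣-∣-swap : ∀ {x y b} → ∣ x - y ∣≤ b → ∣ y - x ∣≤ b
  ∣-∣-swap {x} {y} h = ∣∣≤-cong (solve 2 (λ x y → :- (x :- y) := y :- x) ≈-refl x y) (∣∣≤-neg h)

  ∣∣≤⇒≤+ : ∀ {x y b} → ∣ x - y ∣≤ b → x ≤ y + b
  ∣∣≤⇒≤+ {x} {y} {b} (bounds u _) =
    ≤-by _ (0≤diff u) (solve 3 (λ x y b → y :+ b := x :+ (b :- (x :- y))) ≈-refl x y b)

  ≤+⇒∣∣≤ : ∀ {x y b} → x ≤ y + b → y ≤ x + b → ∣ x - y ∣≤ b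
  ≤+⇒∣∣≤ {x} {y} {b} h k = bounds
    (≤-by _ (0≤diff h) (solve 3 (λ x y b → b := (x :- y) :+ ((y :+ b) :- x)) ≈-refl x y b))
    (≤-by _ (0≤diff k) (solve 3 (λ x y b → b := (:- (x :- y)) :+ ((x :+ b) :- y)) ≈-refl x y b))

  abstract
    bounded : ∀ x → ∃ λ B → 0ℚ ℚ.< B × ∣ x ∣≤ ι B
    bounded x =
      let 0<1 = ℚ.positive⁻¹ 1ℚ
          q , x≤ , ≤x = approximate x 1ℚ 0<1
          ∣q∣ = ℚ.∣ q ∣
      in ℚ.∣ q ∣ ℚ.+ 1ℚ , ℚ.+-mono-≤-< (ℚ.0≤∣p∣ q) 0<1 , bounds
        (≤-trans x≤ (≤-trans (+-mono-≤ (ι-mono (p≤∣p∣ q)) ≤-refl) (≤-reflexive (≈-sym (ι-+ _ _)))))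
        (≤-trans (≤-trans (≤-by _ (0≤diff ≤x) (solve 2
            (λ q x → (:- q) :+ con 1ℚ := (:- x) :+ ((x :+ con 1ℚ) :- q)) ≈-refl (ι q) x))
           (+-mono-≤ (≤-respˡ (ι-neg q) (ι-mono (subst (ℚ.- q ℚ.≤_) (ℚ.∣-p∣≡∣p∣ q)
               (p≤∣p∣ (ℚ.- q))))) ≤-refl))
           (≤-reflexive (≈-sym (ι-+ _ _))))

  ≈-of-bounds : ∀ {x y} → (∀ ε → 0ℚ ℚ.< ε → ∣ x - y ∣≤ ι ε) → x ≈ y
  ≈-of-bounds h = ≤-antisym (≤-closed λ ε 0<ε → ∣∣≤⇒≤+ (h ε 0<ε))
    (≤-closed λ ε 0<ε → ∣∣≤⇒≤+ (∣-∣-swap (h ε 0<ε)))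

  -- Limits

  Lim : (ℕ → R) → R → Set
  Lim a ℓ = ∀ ε → 0ℚ ℚ.< ε → ∃ λ N → ∀ n → N ℕ.≤ n → ∣ a n - ℓ ∣≤ ι ε

  halves : ∀ ε → ι (½ ℚ.* ε) + ι (½ ℚ.* ε) ≈ ι ε
  halves ε = ≈-trans (≈-sym (ι-+ _ _)) (ι-cong (half+half ε))

  Lim-cong : ∀ {a b ℓ m} → (∀ n → a n ≈ b n) → ℓ ≈ m → Lim a ℓ → Lim b m
  Lim-cong a≈b ℓ≈m h ε 0<ε = let N , k = h ε 0<ε in
    N , λ n p → ∣∣≤-cong (+-cong (a≈b n) (-‿cong ℓ≈m)) (k n p)

  Lim-const : ∀ x → Lim (λ _ → x) x
  Lim-const x ε 0<ε = 0 , λ _ _ →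
    ∣∣≤-cong (solve 1 (λ x → con 0ℚ := x :- x) ≈-refl x) (∣𝟘∣≤ (0<⇒0≤ι 0<ε))

  Lim-+ : ∀ {a b ℓ m} → Lim a ℓ → Lim b m → Lim (λ n → a n + b n) (ℓ + m)
  Lim-+ {a} {b} {ℓ} {m} h k ε 0<ε = eventually₂
    (λ n p q → ∣∣≤-cong
      (solve 4 (λ a b ℓ m → (a :- ℓ) :+ (b :- m) := (a :+ b) :- (ℓ :+ m)) ≈-refl (a n) (b n) ℓ m)
      (∣∣≤-weaken (≤-reflexive (halves ε)) (∣∣≤-+ p q)))
    (h (½ ℚ.* ε) (half>0 0<ε)) (k (½ ℚ.* ε) (half>0 0<ε))

  Lim-neg : ∀ {a ℓ} → Lim a ℓ → Lim (λ n → - a n) (- ℓ)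
  Lim-neg {a} {ℓ} h ε 0<ε = let N , k = h ε 0<ε in N , λ n p → ∣∣≤-cong
    (solve 2 (λ a ℓ → :- (a :- ℓ) := (:- a) :- (:- ℓ)) ≈-refl (a n) ℓ) (∣∣≤-neg (k n p))

  -- The error is split as b (a - ℓ) + ℓ (b - m); once b is within 1 of m, its absolute value is at
  -- most B + 1, where B bounds that of m.
  Lim-* : ∀ {a b ℓ m} → Lim a ℓ → Lim b m → Lim (λ n → a n * b n) (ℓ * m)
  Lim-* {a} {b} {ℓ} {m} h k ε 0<ε =
    let A , 0<A , ∣ℓ∣≤A = bounded ℓ
        B , 0<B , ∣m∣≤B = bounded m
        0<B+1 = ℚ.+-mono-< 0<B (ℚ.positive⁻¹ 1ℚ)
        η , 0<η , eq  = divide 0<B+1 (½ ℚ.* ε) (half>0 0<ε)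
        θ , 0<θ , eq′ = divide 0<A (½ ℚ.* ε) (half>0 0<ε)
    in eventually₂
      (λ { n p (q , r) → ∣∣≤-cong
        (solve 4 (λ a b ℓ m → ((b :- m) :+ m) :* (a :- ℓ) :+ ℓ :* (b :- m) := a :* b :- ℓ :* m)
          ≈-refl (a n) (b n) ℓ m)
        (∣∣≤-weaken
          (≤-reflexive (≈-trans (+-cong
             (≈-trans (*-cong (≈-trans (+-comm _ _) (≈-sym (ι-+ _ _))) ≈-refl)
                 (≈-trans (≈-sym (ι-* _ _)) (ι-cong eq)))
             (≈-trans (≈-sym (ι-* _ _)) (ι-cong eq′))) (halves ε)))
          (∣∣≤-+ (∣∣≤-* (∣∣≤-+ q ∣m∣≤B) p) (∣∣≤-* ∣ℓ∣≤A r))) })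
      (h η 0<η)
      (eventually₂ (λ _ → _,_) (k 1ℚ (ℚ.positive⁻¹ 1ℚ)) (k θ 0<θ))

  Lim-unique : ∀ {a ℓ m} → Lim a ℓ → Lim a m → ℓ ≈ m
  Lim-unique {a} {ℓ} {m} h k = ≈-of-bounds λ ε 0<ε →
    let N , p = eventually₂ (λ _ → _,_) (h (½ ℚ.* ε) (half>0 0<ε)) (k (½ ℚ.* ε) (half>0 0<ε))
        q , r = p N ℕ.≤-refl
    in ∣∣≤-cong (solve 3 (λ a ℓ m → (ℓ :- a) :+ (a :- m) := ℓ :- m) ≈-refl (a N) ℓ m)
         (∣∣≤-weaken (≤-reflexive (halves ε)) (∣∣≤-+ (∣-∣-swap q) r))

  Lim-≤ : ∀ {a b ℓ m} → (∃ λ N → ∀ n → N ℕ.≤ n → a n ≤ b n) → Lim a ℓ → Lim b m → ℓ ≤ m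
  Lim-≤ {a} {b} {ℓ} {m} a≤b h k = ≤-closed λ ε 0<ε →
    let N , p = eventually₂ (λ _ → _,_) a≤b
                  (eventually₂ (λ _ → _,_) (h (½ ℚ.* ε) (half>0 0<ε)) (k (½ ℚ.* ε) (half>0 0<ε)))
        aN≤bN , q , r = p N ℕ.≤-refl
    in ≤-trans (∣∣≤⇒≤+ (∣-∣-swap q)) (≤-trans (+-mono-≤ (≤-trans aN≤bN (∣∣≤⇒≤+ r)) ≤-refl)
         (≤-reflexive (≈-trans (+-assoc _ _ _) (+-cong ≈-refl (halves ε)))))

  Lim-squeeze : ∀ {a c ℓ} → (∃ λ N → ∀ n → N ℕ.≤ n → ∣ a n - ℓ ∣≤ c n) → Lim c 𝟘 → Lim a ℓ
  Lim-squeeze {a} {c} h k ε 0<ε = eventually₂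
    (λ n p q → ∣∣≤-weaken (≤-trans
      (≤-reflexive (solve 1 (λ c → c := c :- con 0ℚ) ≈-refl (c n))) (upper q)) p) h (k ε 0<ε)

  Lim-∘ : ∀ {a ℓ} (f : ℕ → ℕ) → (∀ N → ∃ λ M → ∀ n → M ℕ.≤ n → N ℕ.≤ f n) → Lim a ℓ → Lim (λ n → a (f n)) ℓ
  Lim-∘ f f→∞ h ε 0<ε = let N , k = h ε 0<ε ; M , g = f→∞ N in M , λ n p → k (f n) (g n p)

  Lim-suc : ∀ {a ℓ} → Lim a ℓ → Lim (λ n → a (suc n)) ℓ
  Lim-suc = Lim-∘ suc λ N → N , λ n p → ℕ.m≤n⇒m≤1+n p

  Lim-∣∣≤ : ∀ {a ℓ x b} → (∃ λ N → ∀ n → N ℕ.≤ n → ∣ a n - x ∣≤ b) → Lim a ℓ → ∣ ℓ - x ∣≤ b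
  Lim-∣∣≤ {a} {ℓ} {x} {b} (N , h) k = bounds
    (Lim-≤ (N , λ n p → upper (h n p)) k-x (Lim-const b))
    (Lim-≤ (N , λ n p → lower (h n p)) (Lim-neg k-x) (Lim-const b))
    where
    k-x : Lim (λ n → a n - x) (ℓ - x)
    k-x = Lim-+ k (Lim-const (- x))

  -- Sums

  ∑ : (ℕ → R) → ℕ → R
  ∑ a zero    = 𝟘
  ∑ a (suc n) = ∑ a n + a n

  ∑-cong : ∀ {a b} → (∀ n → a n ≈ b n) → ∀ n → ∑ a n ≈ ∑ b n
  ∑-cong a≈b zero    = ≈-refl
  ∑-cong a≈b (suc n) = +-cong (∑-cong a≈b n) (a≈b n)

  ∑-mono : ∀ {a b} → (∀ n → a n ≤ b n) → ∀ n → ∑ a n ≤ ∑ b n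
  ∑-mono a≤b zero    = ≤-refl
  ∑-mono a≤b (suc n) = +-mono-≤ (∑-mono a≤b n) (a≤b n)

  ∑-nonNeg : ∀ {a} → (∀ n → 𝟘 ≤ a n) → ∀ n → 𝟘 ≤ ∑ a n
  ∑-nonNeg 0≤a zero    = ≤-refl
  ∑-nonNeg 0≤a (suc n) = 0≤+ (∑-nonNeg 0≤a n) (0≤a n)

  ∑-head : ∀ a n → ∑ a (suc n) ≈ a 0 + ∑ (λ i → a (suc i)) n
  ∑-head a zero    = +-comm _ _
  ∑-head a (suc n) = ≈-trans (+-cong (∑-head a n) ≈-refl) (+-assoc _ _ _)

  ∑-+ : ∀ a b n → ∑ (λ i → a i + b i) n ≈ ∑ a n + ∑ b n
  ∑-+ a b zero    = ≈-sym (+-identityʳ 𝟘)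
  ∑-+ a b (suc n) = ≈-trans (+-cong (∑-+ a b n) ≈-refl)
    (solve 4 (λ s t a b → (s :+ t) :+ (a :+ b) := (s :+ a) :+ (t :+ b)) ≈-refl (∑ a n) (∑ b n) (a n) (b n))

  ∑-*ˡ : ∀ x a n → ∑ (λ i → x * a i) n ≈ x * ∑ a n
  ∑-*ˡ x a zero    = ≈-sym (zeroʳ x)
  ∑-*ˡ x a (suc n) = ≈-trans (+-cong (∑-*ˡ x a n) ≈-refl)
    (solve 3 (λ x s a → x :* s :+ x :* a := x :* (s :+ a)) ≈-refl x (∑ a n) (a n))

  -- Comparison with a telescoping series gives convergence together with the explicit tail bound
  -- `c M`. The exponential series, the logarithm iteration, the Dirichlet series and the sieved
  -- sums are all controlled in this way.
  module Telescoping {a c : ℕ → R} (∣a∣≤ : ∀ n → ∣ a n ∣≤ c n - c (suc n)) (c→0 : Lim c 𝟘) where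

    step : ∀ M k → ∣ ∑ a (k ℕ.+ M) - ∑ a M ∣≤ c M - c (k ℕ.+ M)
    step M zero    = ∣∣≤-cong (solve 1 (λ s → con 0ℚ := s :- s) ≈-refl (∑ a M))
      (∣𝟘∣≤ (≤-reflexive (solve 1 (λ s → con 0ℚ := s :- s) ≈-refl (c M))))
    step M (suc k) = ∣∣≤-cong
      (solve 3 (λ s t a → (s :- t) :+ a := (s :+ a) :- t) ≈-refl (∑ a (k ℕ.+ M)) (∑ a M) (a (k ℕ.+ M)))
      (∣∣≤-weaken (≤-reflexive (solve 3 (λ x y z → (x :- y) :+ (y :- z) := x :- z) ≈-refl (c M)
          (c (k ℕ.+ M)) (c (suc k ℕ.+ M))))
        (∣∣≤-+ (step M k) (∣a∣≤ (k ℕ.+ M))))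

    step-≤ : ∀ M n → M ℕ.≤ n → ∣ ∑ a n - ∑ a M ∣≤ c M - c n
    step-≤ M n M≤n = subst (λ n → ∣ ∑ a n - ∑ a M ∣≤ c M - c n) (ℕ.m∸n+n≡m M≤n) (step M (n ℕ.∸ M))

    -- The differences `c M - c n` bound absolute values, so `c` decreases, and its limit is 0.
    c≥0 : ∀ M → 𝟘 ≤ c M
    c≥0 M = Lim-≤ (M , λ n M≤n → diff≥0 (∣∣≤⇒0≤ (step-≤ M n M≤n))) c→0 (Lim-const (c M))

    tail : ∀ M n → M ℕ.≤ n → ∣ ∑ a n - ∑ a M ∣≤ c M
    tail M n M≤n = ∣∣≤-weaken
      (≤-by (c n) (c≥0 n) (solve 2 (λ x y → x := (x :- y) :+ y) ≈-refl (c M) (c n))) (step-≤ M n M≤n)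

    abstract
      convergent : ∃ λ S → Lim (∑ a) S
      convergent =
        let S , h = complete (∑ a) λ ε 0<ε →
              let N , k = c→0 (½ ℚ.* ε) (half>0 0<ε)
                  cN≤ = ≤-respˡ (solve 1 (λ c → c :- con 0ℚ := c) ≈-refl (c N)) (upper (k N ℕ.≤-refl))
              in N , λ m n N≤m N≤n → ≤-trans (∣∣≤⇒≤+ (tail N m N≤m)) (≤-trans
                   (+-mono-≤ (∣∣≤⇒≤+ (∣-∣-swap (tail N n N≤n))) ≤-refl)
                   (≤-respˡ (≈-sym (+-assoc _ _ _)) (+-mono-≤ ≤-refl
                     (≤-respʳ (halves ε) (+-mono-≤ cN≤ cN≤)))))
        in S , λ ε 0<ε → let N , k = h ε 0<ε in N , λ n p → ≤+⇒∣∣≤ (proj₁ (k n p)) (proj₂ (k n p))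

    tail-limit : ∀ {S} → Lim (∑ a) S → ∀ M → ∣ S - ∑ a M ∣≤ c M
    tail-limit h M = Lim-∣∣≤ (M , tail M) h

  -- Powers

  _^_ : R → ℕ → R
  x ^ zero  = 𝟙
  x ^ suc k = x * x ^ k

  ^-nonNeg : ∀ {x} → 𝟘 ≤ x → ∀ n → 𝟘 ≤ x ^ n
  ^-nonNeg 0≤x zero    = 0≤1
  ^-nonNeg 0≤x (suc n) = *-nonNeg 0≤x (^-nonNeg 0≤x n)

  ^-mono : ∀ {x y} → 𝟘 ≤ x → x ≤ y → ∀ n → x ^ n ≤ y ^ n
  ^-mono 0≤x x≤y zero    = ≤-refl
  ^-mono 0≤x x≤y (suc n) = *-mono-≤ (≤-trans 0≤x x≤y) (^-nonNeg 0≤x n) x≤y (^-mono 0≤x x≤y n)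

  -- Bernoulli's inequality without division. The induction step is (1 - δ)(1 + (n + 1)δ) = 1 + nδ -
  -- (n + 1)δ².
  ^-bernoulli : ∀ {r δ} → 𝟘 ≤ r → 0ℚ ℚ.< δ → r + ι δ ≤ 𝟙 → ∀ n → r ^ n * (𝟙 + ι (nat n) * ι δ) ≤ 𝟙
  ^-bernoulli {r} {δ} 0≤r 0<δ h zero =
    ≤-reflexive (solve 1 (λ d → con 1ℚ :* (con 1ℚ :+ con 0ℚ :* d) := con 1ℚ) ≈-refl (ι δ))
  ^-bernoulli {r} {δ} 0≤r 0<δ h (suc n) = begin
    (r * r ^ n) * (𝟙 + ι (nat (suc n)) * ι δ)
      ≈⟨ *-cong ≈-refl (+-cong ≈-refl (*-cong (≈-trans (ι-cong (nat-suc n)) (ι-+ _ _)) ≈-refl)) ⟩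
    (r * r ^ n) * (𝟙 + (𝟙 + ι (nat n)) * ι δ)   ≲⟨ ≤-by _ (*-nonNeg (^-nonNeg 0≤r n) (0≤+
                                                      (*-nonNeg (0≤diff h)
                                                          (0≤+ 0≤1 (*-nonNeg (0≤+ 0≤1 0≤n) 0≤δ)))
                                                      (*-nonNeg (0≤+ 0≤1 0≤n) (*-nonNeg 0≤δ 0≤δ))))
                                                    (solve 4 (λ r p n d →
                                                      p :* (con 1ℚ :+ n :* d) :=
                                                      (r :* p) :* (con 1ℚ :+ (con 1ℚ :+ n) :* d) :+
                                                      p :* ((con 1ℚ :- (r :+ d)) :*
                                                          (con 1ℚ :+ (con 1ℚ :+ n) :* d) :+
                                                          (con 1ℚ :+ n) :* (d :* d)))
                                                      ≈-refl r (r ^ n) (ι (nat n)) (ι δ)) ⟩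
    r ^ n * (𝟙 + ι (nat n) * ι δ)               ≲⟨ ^-bernoulli 0≤r 0<δ h n ⟩
    𝟙                                           ∎
    where
    open ≤-Reasoning
    0≤n = 0≤ι (nat-mono {0} {n} ℕ.z≤n)
    0≤δ = 0<⇒0≤ι 0<δ

  Lim-^ : ∀ {r δ} → 𝟘 ≤ r → 0ℚ ℚ.< δ → r + ι δ ≤ 𝟙 → Lim (r ^_) 𝟘
  Lim-^ {r} {δ} 0≤r 0<δ h ε 0<ε =
    let N , big = archimedes (δ ℚ.* ε) (*-pos 0<δ 0<ε) in
    N , λ n N≤n → let 0≤rⁿ = ^-nonNeg 0≤r n in
      ∣∣≤-cong (solve 1 (λ x → x := x :- con 0ℚ) ≈-refl (r ^ n)) (0≤⇒∣∣≤ 0≤rⁿ (begin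
        r ^ n                                ≈⟨ ≈-sym (*-identityʳ _) ⟩
        r ^ n * 𝟙                            ≲⟨ *-monoˡ-≤ 0≤rⁿ (ι-mono (big n N≤n)) ⟩
        r ^ n * ι (nat n ℚ.* (δ ℚ.* ε))
          ≈⟨ *-cong ≈-refl (≈-trans (ι-* _ _) (*-cong ≈-refl (ι-* _ _))) ⟩
        r ^ n * (ι (nat n) * (ι δ * ι ε))    ≲⟨ ≤-by _ (*-nonNeg 0≤rⁿ (0<⇒0≤ι 0<ε)) (solve 4 (λ p n d e →
                                                  (p :* (con 1ℚ :+ n :* d)) :* e := p :*
                                                      (n :* (d :* e)) :+ p :* e) ≈-refl (r ^ n)
                                                      (ι (nat n)) (ι δ) (ι ε)) ⟩
        (r ^ n * (𝟙 + ι (nat n) * ι δ)) * ι ε ≲⟨ *-monoʳ-≤ (0<⇒0≤ι 0<ε) (^-bernoulli 0≤r 0<δ h n) ⟩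
        𝟙 * ι ε                              ≈⟨ *-identityˡ _ ⟩
        ι ε                                  ∎))
    where open ≤-Reasoning

  -- Geometrically dominated sequences and their Cauchy products

  𝕙 𝕢 : R
  𝕙 = ι ½
  𝕢 = ι ¼

  0≤𝕢 : 𝟘 ≤ 𝕢
  0≤𝕢 = 0<⇒0≤ι (ℚ.positive⁻¹ ¼)

  𝕢≤𝕙 : 𝕢 ≤ 𝕙
  𝕢≤𝕙 = ι-mono (ℚ.≤ᵇ⇒≤ _)

  Lim-𝕢^ : Lim (𝕢 ^_) 𝟘
  Lim-𝕢^ = Lim-^ 0≤𝕢 ½>0 (ι-mono-≤)
    where
    ι-mono-≤ : 𝕢 + ι ½ ≤ 𝟙
    ι-mono-≤ = ≤-by 𝕢 0≤𝕢 (solve 0 (con 1ℚ := (con ¼ :+ con ½) :+ con ¼) ≈-refl)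

  Lim-𝕙^ : Lim (𝕙 ^_) 𝟘
  Lim-𝕙^ = Lim-^ 0≤½ ½>0 (≤-reflexive (solve 0 (con ½ :+ con ½ := con 1ℚ) ≈-refl))

  -- The ratio ¼ is fixed for all sequences: the terms of the exponential series eventually beat any
  -- ratio, and ¼ leaves room for the product of two such series to converge at the rate ½.
  Dominated : (ℕ → R) → R → Set
  Dominated a A = ∀ k → ∣ a k ∣≤ A * 𝕢 ^ k

  Dominated-suc : ∀ {a A} → Dominated a A → Dominated (λ k → a (suc k)) (A * 𝕢)
  Dominated-suc d k = ∣∣≤-weaken (≤-reflexive (≈-sym (*-assoc _ _ _))) (d (suc k))

  -- A ratio bound valid only from K on is made global by enlarging the constant. Each of the first
  -- K terms is peeled off in turn; the shift by one index turns a constant A for the rest into 4A.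
  dominate : ∀ K (a : ℕ → R) → (∀ k b → K ℕ.≤ k → ∣ a k ∣≤ b → ∣ a (suc k) ∣≤ 𝕢 * b) → ∃ (Dominated a)
  dominate zero a h = let B , _ , b = bounded (a 0) in ι B , bound B b
    where
    bound : ∀ B → ∣ a 0 ∣≤ ι B → Dominated a (ι B)
    bound B b zero    = ∣∣≤-weaken (≤-reflexive (≈-sym (*-identityʳ _))) b
    bound B b (suc k) = ∣∣≤-weaken
      (≤-reflexive (solve 3 (λ q B p → q :* (B :* p) := B :* (q :* p)) ≈-refl 𝕢 (ι B) (𝕢 ^ k)))
      (h k _ ℕ.z≤n (bound B b k))
  dominate (suc K) a h =
    let B , 0<B , b = bounded (a 0)
        A , d = dominate K (λ k → a (suc k)) (λ k b K≤k → h (suc k) b (ℕ.s≤s K≤k))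
    in ι B + ι four * A , bound B 0<B b A d
    where
    four = + 4 ℚ./ 1
    bound : ∀ B → 0ℚ ℚ.< B → ∣ a 0 ∣≤ ι B → ∀ A → Dominated (λ k → a (suc k)) A → Dominated a
        (ι B + ι four * A)
    bound B 0<B b A d zero = ∣∣≤-weaken (≤-by (ι four * A)
      (*-nonNeg (0<⇒0≤ι (ℚ.positive⁻¹ four)) (≤-respʳ (*-identityʳ A) (∣∣≤⇒0≤ (d 0))))
      (*-identityʳ _)) b
    bound B 0<B b A d (suc k) = ∣∣≤-weaken (≤-by (ι B * (𝕢 * 𝕢 ^ k))
      (*-nonNeg (0<⇒0≤ι 0<B) (^-nonNeg 0≤𝕢 (suc k)))
      (solve 3 (λ B A p → (B :+ con four :* A) :* (con ¼ :* p) := A :* p :+ B :* (con ¼ :* p)) ≈-refl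
          (ι B) A (𝕢 ^ k)))
      (d k)

  module DominatedSum {a A} (d : Dominated a A) where

    0≤A : 𝟘 ≤ A
    0≤A = ≤-respʳ (*-identityʳ A) (∣∣≤⇒0≤ (d 0))

    -- The exact tail of the geometric majorant is (4/3) A ¼^n; the rounder factor 2 leaves a
    -- surplus of ½ A ¼^n in each difference.
    c : ℕ → R
    c n = (A + A) * 𝕢 ^ n

    c→0 : Lim c 𝟘
    c→0 = Lim-cong (λ _ → ≈-refl) (zeroʳ _) (Lim-* (Lim-const (A + A)) Lim-𝕢^)

    open Telescoping {a} {c} (λ n → ∣∣≤-weaken (≤-by (𝕙 * (A * 𝕢 ^ n))
        (*-nonNeg 0≤½ (*-nonNeg 0≤A (^-nonNeg 0≤𝕢 n)))
      (solve 2 (λ A p → (A :+ A) :* p :- (A :+ A) :* (con ¼ :* p) := A :* p :+ con ½ :*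
          (A :* p)) ≈-refl A (𝕢 ^ n))) (d n))
      c→0 public

  -- The Cauchy product, the sum of a(i) b(n - i), with its first summand peeled off by shifting
  -- `a`; inductions over it therefore quantify over `a`.
  conv : (a b : ℕ → R) → ℕ → R
  conv a b zero    = a 0 * b 0
  conv a b (suc n) = a 0 * b (suc n) + conv (λ i → a (suc i)) b n

  conv-cong : ∀ {a a′ b b′} → (∀ n → a n ≈ a′ n) → (∀ n → b n ≈ b′ n) → ∀ n → conv a b n ≈ conv a′ b′ n
  conv-cong p q zero    = *-cong (p 0) (q 0)
  conv-cong p q (suc n) = +-cong (*-cong (p 0) (q (suc n))) (conv-cong (λ i → p (suc i)) q n)

  conv-+ˡ : ∀ a a′ b n → conv (λ i → a i + a′ i) b n ≈ conv a b n + conv a′ b n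
  conv-+ˡ a a′ b zero    = solve 3 (λ a a′ b → (a :+ a′) :* b := a :* b :+ a′ :* b) ≈-refl (a 0) (a′ 0)
      (b 0)
  conv-+ˡ a a′ b (suc n) = ≈-trans (+-cong ≈-refl (conv-+ˡ _ _ b n))
    (solve 5 (λ a a′ b u v → (a :+ a′) :* b :+ (u :+ v) := (a :* b :+ u) :+ (a′ :* b :+ v)) ≈-refl (a 0)
        (a′ 0) (b (suc n)) _ _)

  conv-*ˡ : ∀ x a b n → conv (λ i → x * a i) b n ≈ x * conv a b n
  conv-*ˡ x a b zero    = *-assoc _ _ _
  conv-*ˡ x a b (suc n) = ≈-trans (+-cong ≈-refl (conv-*ˡ x _ b n))
    (solve 4 (λ x a b u → (x :* a) :* b :+ x :* u := x :* (a :* b :+ u)) ≈-refl x (a 0) (b (suc n)) _)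

  conv-*ʳ : ∀ x a b n → conv a (λ i → x * b i) n ≈ x * conv a b n
  conv-*ʳ x a b zero    = solve 3 (λ x a b → a :* (x :* b) := x :* (a :* b)) ≈-refl x (a 0) (b 0)
  conv-*ʳ x a b (suc n) = ≈-trans (+-cong ≈-refl (conv-*ʳ x _ b n))
    (solve 4 (λ x a b u → a :* (x :* b) :+ x :* u := x :* (a :* b :+ u)) ≈-refl x (a 0) (b (suc n)) _)

  ∑-conv : ∀ a b n → ∑ (conv a b) (suc n) ≈ a 0 * ∑ b (suc n) + ∑ (conv (λ i → a (suc i)) b) n
  ∑-conv a b zero    = solve 2 (λ a b → con 0ℚ :+ a :* b := a :* (con 0ℚ :+ b) :+ con 0ℚ) ≈-refl (a 0) (b 0)
  ∑-conv a b (suc n) = ≈-trans (+-cong (∑-conv a b n) ≈-refl)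
    (solve 5 (λ a s u b v → (a :* s :+ u) :+ (a :* b :+ v) := a :* (s :+ b) :+ (u :+ v)) ≈-refl
      (a 0) (∑ b (suc n)) (∑ (conv (λ i → a (suc i)) b) n) (b (suc n)) (conv (λ i → a (suc i)) b n))

  module _ {b : ℕ → R} {B β : R} (dB : Dominated b B) (b→β : Lim (∑ b) β) where

    -- Peeling off a(0) leaves a(0) times a tail of the series of `b`, plus the same error for the
    -- shifted sequence, whose constant is A / 4. The two contributions are ½ A B ¼^n and ½ A B ½^n,
    -- together at most A B ½^n.
    conv-error : ∀ n {a A} → Dominated a A → ∣ ∑ (conv a b) n - ∑ a n * β ∣≤ ((A + A) * B) * 𝕙 ^ n
    conv-error zero {a} {A} dA = ∣∣≤-cong (solve 1 (λ β → con 0ℚ := con 0ℚ :- con 0ℚ :* β) ≈-refl β)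
      (∣𝟘∣≤ (*-nonNeg (*-nonNeg (0≤+ 0≤A 0≤A) 0≤B) 0≤1))
      where
      0≤A = DominatedSum.0≤A dA
      0≤B = DominatedSum.0≤A dB
    conv-error (suc n) {a} {A} dA = ∣∣≤-cong
      (≈-sym (≈-trans (+-cong (∑-conv a b n) (-‿cong (*-cong (∑-head a n) ≈-refl)))
        (solve 5 (λ a s β u v → (a :* s :+ u) :- (a :+ v) :* β := (:- (a :* (β :- s))) :+
            (u :- v :* β)) ≈-refl
          (a 0) (∑ b (suc n)) β (∑ (conv (λ i → a (suc i)) b) n) (∑ (λ i → a (suc i)) n))))
      (∣∣≤-weaken
        (≤-by ((A + A) * B * 𝕢 * (𝕙 ^ n - 𝕢 ^ n))
          (*-nonNeg (*-nonNeg (*-nonNeg (0≤+ 0≤A 0≤A) 0≤B) 0≤𝕢) (0≤diff (^-mono 0≤𝕢 𝕢≤𝕙 n)))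
          (solve 4 (λ A B p h →
              ((A :+ A) :* B) :* (con ½ :* h) :=
              ((A :* con 1ℚ) :* ((B :+ B) :* (con ¼ :* p)) :+ ((A :* con ¼ :+ A :* con ¼) :* B) :* h) :+
              (A :+ A) :* B :* con ¼ :* (h :- p)) ≈-refl A B (𝕢 ^ n) (𝕙 ^ n)))
        (∣∣≤-+ (∣∣≤-neg (∣∣≤-* (dA 0) (DominatedSum.tail-limit dB b→β (suc n))))
            (conv-error n (Dominated-suc dA))))
      where
      0≤A = DominatedSum.0≤A dA
      0≤B = DominatedSum.0≤A dB

    Lim-conv : ∀ {a A α} → Dominated a A → Lim (∑ a) α → Lim (∑ (conv a b)) (α * β)
    Lim-conv {a} {A} {α} dA a→α = Lim-cong
      (λ n → solve 2 (λ u v → (u :- v) :+ v := u) ≈-refl (∑ (conv a b) n) (∑ a n * β))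
      (+-identityˡ _)
      (Lim-+ (Lim-squeeze (0 , λ n _ → ∣∣≤-cong (solve 1 (λ x → x := x :- con 0ℚ) ≈-refl _)
          (conv-error n dA))
               (Lim-cong (λ _ → ≈-refl) (zeroʳ _) (Lim-* (Lim-const ((A + A) * B)) Lim-𝕙^)))
             (Lim-* a→α (Lim-const β)))

  -- Formal differentiation of the power series with coefficients `a`. The Leibniz rule
  -- `derive-conv` takes the place of the binomial theorem in the addition formula for exp.
  derive : (ℕ → R) → ℕ → R
  derive a k = ι (nat (suc k)) * a (suc k)

  ι-nat-suc : ∀ n → ι (nat (suc n)) ≈ 𝟙 + ι (nat n)
  ι-nat-suc n = ≈-trans (ι-cong (nat-suc n)) (ι-+ _ _)

  derive-conv : ∀ n a b → derive (conv a b) n ≈ conv (derive a) b n + conv a (derive b) n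
  derive-conv zero a b = solve 5 (λ m a a′ b b′ → m :* (a :* b′ :+ a′ :* b) := (m :* a′) :* b :+ a :*
      (m :* b′)) ≈-refl
    (ι (nat 1)) (a 0) (a 1) (b 0) (b 1)
  derive-conv (suc n) a b = begin-equality
    ι (nat (suc (suc n))) * (a 0 * b (suc (suc n)) + conv a′ b (suc n))
      ≈⟨ ≈-trans (solve 4 (λ m x y u → m :* (x :* y :+ u) := x :* (m :* y) :+ m :* u) ≈-refl
          (ι (nat (suc (suc n)))) (a 0) (b (suc (suc n))) (conv a′ b (suc n)))
           (+-cong ≈-refl (≈-trans (*-cong (ι-nat-suc (suc n)) ≈-refl)
             (solve 2 (λ m u → (con 1ℚ :+ m) :* u := u :+ m :* u) ≈-refl (ι (nat (suc n)))
                 (conv a′ b (suc n))))) ⟩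
    a 0 * derive b (suc n) + (conv a′ b (suc n) + ι (nat (suc n)) * conv a′ b (suc n))
      ≈⟨ +-cong ≈-refl (+-cong ≈-refl (derive-conv n a′ b)) ⟩
    a 0 * derive b (suc n) + ((a 1 * b (suc n) + conv a″ b n) +
        (conv (derive a′) b n + conv a′ (derive b) n))
      ≈⟨ solve 7 (λ p x x′ y u v w → (p :* w) :+ ((x :* y :+ u) :+ (v :+ x′)) :=
          ((con 1ℚ :* x) :* y :+ (v :+ u)) :+ (p :* w :+ x′)) ≈-refl
           (a 0) (a 1) (conv a′ (derive b) n) (b (suc n)) (conv a″ b n) (conv (derive a′) b n)
               (derive b (suc n)) ⟩
    (derive a 0 * b (suc n) + (conv (derive a′) b n + conv a″ b n)) + conv a (derive b) (suc n)
      ≈⟨ +-cong (+-cong ≈-refl (≈-trans (≈-sym (conv-+ˡ (derive a′) a″ b n))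
           (conv-cong (λ k → ≈-trans (solve 2 (λ m x → m :* x :+ x := (con 1ℚ :+ m) :* x) ≈-refl
               (ι (nat (suc k))) (a″ k))
                         (*-cong (≈-sym (ι-nat-suc (suc k))) ≈-refl)) (λ _ → ≈-refl) n))) ≈-refl ⟩
    conv (derive a) b (suc n) + conv a (derive b) (suc n) ∎
    where
    open ≤-Reasoning
    a′ a″ : ℕ → R
    a′ k = a (suc k)
    a″ k = a (suc (suc k))

  -- The exponential function

  term : R → ℕ → R
  term x zero    = 𝟙
  term x (suc k) = ι (recip k) * (x * term x k)

  ι-recip : ∀ k → ι (recip k) * ι (nat (suc k)) ≈ 𝟙
  ι-recip k = ≈-trans (≈-sym (ι-* _ _)) (ι-cong (recip-* k))

  derive-term : ∀ x k → derive (term x) k ≈ x * term x k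
  derive-term x k = ≈-trans
    (solve 3 (λ m r y → m :* (r :* y) := (r :* m) :* y) ≈-refl (ι (nat (suc k))) (ι (recip k))
        (x * term x k))
    (≈-trans (*-cong (ι-recip k) ≈-refl) (*-identityˡ _))

  term-cong : ∀ {x y} → x ≈ y → ∀ k → term x k ≈ term y k
  term-cong x≈y zero    = ≈-refl
  term-cong x≈y (suc k) = *-cong ≈-refl (*-cong x≈y (term-cong x≈y k))

  -- The step from term k to the next multiplies by x / (k + 1), which is at most ¼ in absolute
  -- value once 1/(k + 1) is at most ¼ divided by a bound of |x|.
  term-dominated : ∀ x → ∃ (Dominated (term x))
  term-dominated x =
    let B , 0<B , ∣x∣≤B = bounded x
        η , 0<η , Bη≡¼ = divide 0<B ¼ (ℚ.positive⁻¹ ¼)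
        N , small = recip-small η 0<η
    in dominate N (term x) λ k b N≤k h → ∣∣≤-weaken
         (≤-reflexive (≈-trans (solve 3 (λ η B b → η :* (B :* b) := (B :* η) :* b) ≈-refl (ι η) (ι B) b)
           (*-cong (≈-trans (≈-sym (ι-* _ _)) (ι-cong Bη≡¼)) ≈-refl)))
         (∣∣≤-* (0≤⇒∣∣≤ (0<⇒0≤ι (recip>0 k)) (ι-mono (ℚ.≤-trans (recip-antimono N≤k) small)))
             (∣∣≤-* ∣x∣≤B h))

  abstract
    exp-sum : ∀ x → ∃ λ S → Lim (∑ (term x)) S
    exp-sum x = DominatedSum.convergent (proj₂ (term-dominated x))

  exp : R → R
  exp x = proj₁ (exp-sum x)

  exp-limit : ∀ x → Lim (∑ (term x)) (exp x)
  exp-limit x = proj₂ (exp-sum x)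

  exp-cong : ∀ {x y} → x ≈ y → exp x ≈ exp y
  exp-cong {x} {y} x≈y = Lim-unique (Lim-cong (∑-cong (term-cong x≈y)) ≈-refl (exp-limit x)) (exp-limit y)

  -- The series of exp x satisfies derive c = x c. By the Leibniz rule the Cauchy product satisfies
  -- the same equation with x + y, and that equation together with c(0) = 1 determines all
  -- coefficients.
  term-+ : ∀ x y n → term (x + y) n ≈ conv (term x) (term y) n
  term-+ x y zero    = ≈-sym (*-identityˡ 𝟙)
  term-+ x y (suc n) = begin-equality
    ι (recip n) * ((x + y) * term (x + y) n)
      ≈⟨ *-cong ≈-refl (*-cong ≈-refl (term-+ x y n)) ⟩
    ι (recip n) * ((x + y) * c n)
      ≈⟨ *-cong ≈-refl (≈-trans (solve 3 (λ x y c → (x :+ y) :* c := x :* c :+ y :* c) ≈-refl x y (c n))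
           (+-cong
             (≈-trans (≈-sym (conv-*ˡ x _ _ n)) (conv-cong (λ k → ≈-sym (derive-term x k))
                 (λ _ → ≈-refl) n))
             (≈-trans (≈-sym (conv-*ʳ y _ _ n)) (conv-cong (λ _ → ≈-refl)
                 (λ k → ≈-sym (derive-term y k)) n)))) ⟩
    ι (recip n) * (conv (derive (term x)) (term y) n + conv (term x) (derive (term y)) n)
      ≈⟨ *-cong ≈-refl (≈-sym (derive-conv n (term x) (term y))) ⟩
    ι (recip n) * (ι (nat (suc n)) * c (suc n))
      ≈⟨ ≈-trans (≈-sym (*-assoc _ _ _)) (≈-trans (*-cong (ι-recip n) ≈-refl) (*-identityˡ _)) ⟩
    c (suc n) ∎
    where
    open ≤-Reasoning
    c : ℕ → R
    c = conv (term x) (term y)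

  exp-+ : ∀ x y → exp (x + y) ≈ exp x * exp y
  exp-+ x y = Lim-unique (exp-limit (x + y))
    (Lim-cong (∑-cong (λ n → ≈-sym (term-+ x y n))) ≈-refl
      (Lim-conv (proj₂ (term-dominated y)) (exp-limit y) (proj₂ (term-dominated x)) (exp-limit x)))

  term-nonNeg : ∀ {x} → 𝟘 ≤ x → ∀ k → 𝟘 ≤ term x k
  term-nonNeg 0≤x zero    = 0≤1
  term-nonNeg 0≤x (suc k) = *-nonNeg (0<⇒0≤ι (recip>0 k)) (*-nonNeg 0≤x (term-nonNeg 0≤x k))

  1+x≤exp-nonNeg : ∀ {x} → 𝟘 ≤ x → 𝟙 + x ≤ exp x
  1+x≤exp-nonNeg {x} 0≤x = Lim-≤ (2 , bound) (Lim-const _) (exp-limit x)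
    where
    bound : ∀ n → 2 ℕ.≤ n → 𝟙 + x ≤ ∑ (term x) n
    bound (suc (suc n)) _ = ≤-by (∑ (λ k → term x (suc (suc k))) n)
        (∑-nonNeg (λ k → term-nonNeg 0≤x (suc (suc k))) n)
      (≈-trans (∑-head (term x) (suc n)) (≈-trans (+-cong ≈-refl (∑-head (λ k → term x (suc k)) n))
        (solve 2 (λ x s → con 1ℚ :+ (con 1ℚ :* (x :* con 1ℚ) :+ s) := (con 1ℚ :+ x) :+ s) ≈-refl x _)))
    bound (suc zero) (ℕ.s≤s ())

  -- Since term x (k + 1) ≤ x · term x k.
  exp≤1+x*exp : ∀ {x} → 𝟘 ≤ x → exp x ≤ 𝟙 + x * exp x
  exp≤1+x*exp {x} 0≤x = Lim-≤ (0 , λ n _ → bound n) (Lim-suc (exp-limit x))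
    (Lim-+ (Lim-const 𝟙) (Lim-* (Lim-const x) (exp-limit x)))
    where
    bound : ∀ n → ∑ (term x) (suc n) ≤ 𝟙 + x * ∑ (term x) n
    bound n = ≤-respˡ (≈-sym (∑-head (term x) n)) (+-mono-≤ ≤-refl (≤-respʳ (∑-*ˡ x (term x) n)
      (∑-mono (λ k → ≤-respʳ (*-identityˡ _) (*-monoʳ-≤ (*-nonNeg 0≤x (term-nonNeg 0≤x k))
          (ι-mono (recip-antimono {0} {k} ℕ.z≤n)))) n)))

  exp-𝟘 : exp 𝟘 ≈ 𝟙
  exp-𝟘 = ≤-antisym
    (≤-respʳ (solve 1 (λ e → con 1ℚ :+ con 0ℚ :* e := con 1ℚ) ≈-refl (exp 𝟘)) (exp≤1+x*exp ≤-refl))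
    (≤-respˡ (+-identityʳ 𝟙) (1+x≤exp-nonNeg ≤-refl))

  exp-inverse : ∀ x → exp x * exp (- x) ≈ 𝟙
  exp-inverse x = ≈-trans (≈-sym (exp-+ x (- x)))
    (≈-trans (exp-cong (solve 1 (λ x → x :- x := con 0ℚ) ≈-refl x)) exp-𝟘)

  exp-nonNeg : ∀ x → 𝟘 ≤ exp x
  exp-nonNeg x = ≤-respʳ
    (≈-trans (≈-sym (exp-+ (𝕙 * x) (𝕙 * x))) (exp-cong
        (solve 1 (λ x → con ½ :* x :+ con ½ :* x := x) ≈-refl x)))
    (square-nonNeg (exp (𝕙 * x)))

  -- For negative x, `exp≤1+x*exp` at -x reads (1 + x) e^(-x) ≤ 1, and this is multiplied by e^x.
  1+x≤exp : ∀ x → 𝟙 + x ≤ exp x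
  1+x≤exp x = ≤-cases 𝟘 x 1+x≤exp-nonNeg λ x≤0 → begin
    𝟙 + x                            ≈⟨ ≈-sym (*-identityʳ _) ⟩
    (𝟙 + x) * 𝟙                      ≈⟨ *-cong ≈-refl (≈-sym (exp-inverse x)) ⟩
    (𝟙 + x) * (exp x * exp (- x))
      ≲⟨ ≤-by _ (*-nonNeg (exp-nonNeg x) (0≤diff (exp≤1+x*exp
          (≤-respˡ (solve 0 (:- con 0ℚ := con 0ℚ) ≈-refl) (neg-antimono x≤0)))))
                                          (solve 3 (λ x e f → e := (con 1ℚ :+ x) :* (e :* f) :+ e :*
                                              ((con 1ℚ :+ (:- x) :* f) :- f)) ≈-refl x (exp x)
                                              (exp (- x))) ⟩
    exp x                            ∎
    where open ≤-Reasoning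

  exp-mono : ∀ {x y} → x ≤ y → exp x ≤ exp y
  exp-mono {x} {y} x≤y = begin
    exp x                    ≲⟨ ≤-by _ (*-nonNeg (exp-nonNeg x) (0≤diff x≤y))
                                 (solve 3 (λ x y e → e :* (con 1ℚ :+ (y :- x)) := e :+ e :*
                                     (y :- x)) ≈-refl x y (exp x)) ⟩
    exp x * (𝟙 + (y - x))    ≲⟨ *-monoˡ-≤ (exp-nonNeg x) (1+x≤exp (y - x)) ⟩
    exp x * exp (y - x)      ≈⟨ ≈-sym (exp-+ x (y - x)) ⟩
    exp (x + (y - x))        ≈⟨ exp-cong (solve 2 (λ x y → x :+ (y :- x) := y) ≈-refl x y) ⟩
    exp y                    ∎
    where open ≤-Reasoning

  -- From 1 + (x - y) ≤ e^(x - y) ≤ 1, a direct argument that decides nothing about the order of x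
  -- and y.
  exp-cancel-≤ : ∀ {x y} → exp x ≤ exp y → x ≤ y
  exp-cancel-≤ {x} {y} h = ≤-by _ (0≤diff (begin
    𝟙 + (x - y)            ≲⟨ 1+x≤exp (x - y) ⟩
    exp (x - y)            ≈⟨ exp-+ x (- y) ⟩
    exp x * exp (- y)      ≲⟨ *-monoʳ-≤ (exp-nonNeg (- y)) h ⟩
    exp y * exp (- y)      ≈⟨ exp-inverse y ⟩
    𝟙                      ∎))
    (solve 2 (λ x y → y := x :+ (con 1ℚ :- (con 1ℚ :+ (x :- y)))) ≈-refl x y)
    where open ≤-Reasoning

  exp-injective : ∀ {x y} → exp x ≈ exp y → x ≈ y
  exp-injective h = ≤-antisym (exp-cancel-≤ (≤-reflexive h)) (exp-cancel-≤ (≤-reflexive (≈-sym h)))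

  -- |e^h - 1| ≤ 2|h| for |h| ≤ 1/2: the upper bound is 1/(1 - h) ≤ 1 + 2|h|.
  exp-near-0 : ∀ {h η} → ∣ h ∣≤ η → η ≤ 𝕙 → ∣ exp h - 𝟙 ∣≤ η + η
  exp-near-0 {h} {η} H η≤½ = ≤+⇒∣∣≤
    (begin
      exp h
        ≲⟨ ≤-by _ (*-nonNeg (exp-nonNeg h) (0≤+ (0≤+ (0≤diff (upper H))
            (*-nonNeg 0≤η (0≤+ (0≤diff η≤½) (0≤diff η≤½)))) (*-nonNeg (0≤+ 0≤η 0≤η) (0≤diff (upper H)))))
                                         (solve 3 (λ h η e → (e :* (con 1ℚ :- h)) :* (con 1ℚ :+ (η :+ η)) :=
                                            e :+ e :* ((η :- h) :+ η :*
                                                ((con ½ :- η) :+ (con ½ :- η)) :+ (η :+ η) :*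
                                                (η :- h))) ≈-refl h η (exp h)) ⟩
      (exp h * (𝟙 - h)) * (𝟙 + (η + η))
        ≲⟨ *-monoʳ-≤ (0≤+ 0≤1 (0≤+ 0≤η 0≤η)) (≤-respʳ (exp-inverse h)
            (*-monoˡ-≤ (exp-nonNeg h) (1+x≤exp (- h)))) ⟩
      𝟙 * (𝟙 + (η + η))              ≈⟨ *-identityˡ _ ⟩
      𝟙 + (η + η)                    ∎)
    (≤-trans (≤-by _ (0≤+ 0≤η (0≤diff (lower H)))
       (solve 2 (λ h η → (con 1ℚ :+ h) :+ (η :+ η) := con 1ℚ :+ (η :+ (η :- (:- h)))) ≈-refl h η))
       (+-mono-≤ (1+x≤exp h) ≤-refl))
    where
    open ≤-Reasoning
    0≤η = ∣∣≤⇒0≤ H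

  exp-continuous : ∀ {a ℓ} → Lim a ℓ → Lim (λ n → exp (a n)) (exp ℓ)
  exp-continuous {a} {ℓ} a→ℓ = Lim-cong
    (λ n → ≈-trans (≈-sym (exp-+ ℓ (a n - ℓ))) (exp-cong
        (solve 2 (λ a ℓ → ℓ :+ (a :- ℓ) := a) ≈-refl (a n) ℓ)))
    (*-identityʳ _)
    (Lim-* (Lim-const (exp ℓ)) near-1)
    where
    near-1 : Lim (λ n → exp (a n - ℓ)) 𝟙
    -- `exp-near-0` holds only for |h| ≤ ½, so both ε/2 and ½ are imposed and the smaller of the two
    -- is used.
    near-1 ε 0<ε = eventually₂ (λ n p q → pick p q (ℚ.≤-total (½ ℚ.* ε) ½))
      (a→ℓ (½ ℚ.* ε) (half>0 0<ε)) (a→ℓ ½ ½>0)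
      where
      pick : ∀ {h} → ∣ h ∣≤ ι (½ ℚ.* ε) → ∣ h ∣≤ 𝕙 → ½ ℚ.* ε ℚ.≤ ½ ⊎ ½ ℚ.≤ ½ ℚ.* ε → ∣ exp h - 𝟙 ∣≤ ι ε
      pick p q (inj₁ h) = ∣∣≤-weaken (≤-reflexive (halves ε)) (exp-near-0 p (ι-mono h))
      pick p q (inj₂ h) = ∣∣≤-weaken (≤-respʳ (halves ε) (+-mono-≤ (ι-mono h) (ι-mono h)))
          (exp-near-0 q ≤-refl)

  -- A bound B for the inverse y gives the rational lower bound 1 / B for x, which is what
  -- positivity means here.
  positive-inverse : ∀ {x y} → 𝟘 ≤ x → x * y ≈ 𝟙 → ∃ λ δ → 0ℚ ℚ.< δ × ι δ ≤ x
  positive-inverse {x} {y} 0≤x xy≈1 =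
    let B , 0<B , ∣y∣≤B = bounded y
        η , 0<η , Bη≡1 = divide 0<B 1ℚ (ℚ.positive⁻¹ 1ℚ)
    in η , 0<η , (begin
      ι η                 ≈⟨ ≈-trans (≈-sym (*-identityʳ _)) (*-cong ≈-refl (≈-sym xy≈1)) ⟩
      ι η * (x * y)       ≲⟨ *-monoˡ-≤ (0<⇒0≤ι 0<η) (*-monoˡ-≤ 0≤x (upper ∣y∣≤B)) ⟩
      ι η * (x * ι B)     ≈⟨ solve 3 (λ η x B → η :* (x :* B) := (B :* η) :* x) ≈-refl (ι η) x (ι B) ⟩
      (ι B * ι η) * x     ≈⟨ *-cong (≈-trans (≈-sym (ι-* _ _)) (ι-cong Bη≡1)) ≈-refl ⟩
      𝟙 * x               ≈⟨ *-identityˡ x ⟩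
      x                   ∎)
    where open ≤-Reasoning

  exp-positive : ∀ x → ∃ λ δ → 0ℚ ℚ.< δ × ι δ ≤ exp x
  exp-positive x = positive-inverse (exp-nonNeg x) (exp-inverse x)

  x*exp[1-x]≤1 : ∀ x → x * exp (𝟙 - x) ≤ 𝟙
  x*exp[1-x]≤1 x = begin
    x * exp (𝟙 - x)
      ≲⟨ *-monoʳ-≤ (exp-nonNeg _) (≤-respˡ (solve 1 (λ x → con 1ℚ :+ (x :- con 1ℚ) := x) ≈-refl x)
          (1+x≤exp (x - 𝟙))) ⟩
    exp (x - 𝟙) * exp (𝟙 - x)
      ≈⟨ *-cong ≈-refl (exp-cong (solve 1 (λ x → con 1ℚ :- x := :- (x :- con 1ℚ)) ≈-refl x)) ⟩
    exp (x - 𝟙) * exp (- (x - 𝟙)) ≈⟨ exp-inverse _ ⟩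
    𝟙                            ∎
    where open ≤-Reasoning

  -- Newton's iteration l ↦ l + (y e^(-l) - 1) for e^l = y, started at l = y - 1
  -- and recorded through the residual factor r = y e^(-l), which the step maps to
  -- r e^(1 - r).  Its distance u = 1 - r from 1 satisfies 0 ≤ u′ ≤ u².

  module Logarithm (y : R) (δ : ℚ) (0<δ : 0ℚ ℚ.< δ) (δ≤y : ι δ ≤ y) where

    r u : ℕ → R
    r zero    = y * exp (𝟙 - y)
    r (suc n) = r n * exp (𝟙 - r n)
    u n       = 𝟙 - r n

    r≤1 : ∀ n → r n ≤ 𝟙
    r≤1 zero    = x*exp[1-x]≤1 y
    r≤1 (suc n) = x*exp[1-x]≤1 (r n)

    r₀-positive : ∃ λ κ → 0ℚ ℚ.< κ × ι κ ≤ r 0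
    r₀-positive =
      let κ , 0<κ , h = exp-positive (𝟙 - y)
      in δ ℚ.* κ , *-pos 0<δ 0<κ , ≤-respˡ (≈-sym (ι-* _ _))
           (*-mono-≤ (≤-trans (0<⇒0≤ι 0<δ) δ≤y) (0<⇒0≤ι 0<κ) δ≤y h)

    module _ (κ : ℚ) (0<κ : 0ℚ ℚ.< κ) (κ≤r₀ : ι κ ≤ r 0) where

      ρ : R
      ρ = 𝟙 - ι κ

      0≤ρ : 𝟘 ≤ ρ
      0≤ρ = 0≤diff (≤-trans κ≤r₀ (r≤1 0))

      ρ≤1 : ρ ≤ 𝟙
      ρ≤1 = ≤-by (ι κ) (0<⇒0≤ι 0<κ) (solve 1 (λ k → con 1ℚ := (con 1ℚ :- k) :+ k) ≈-refl (ι κ))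

      0≤u : ∀ n → 𝟘 ≤ u n
      0≤u n = 0≤diff (r≤1 n)

      -- Because e^(1 - r) ≥ 2 - r, the new distance 1 - r e^(1 - r) is at most 1 - r (2 - r) = (1 -
      -- r)².
      u-square : ∀ n → 𝟘 ≤ r n → u (suc n) ≤ u n * u n
      u-square n 0≤r = ≤-by _ (*-nonNeg 0≤r (0≤diff (1+x≤exp (𝟙 - r n))))
        (solve 2 (λ r e → (con 1ℚ :- r) :* (con 1ℚ :- r) := (con 1ℚ :- r :* e) :+ r :*
            (e :- (con 1ℚ :+ (con 1ℚ :- r)))) ≈-refl (r n) (exp (𝟙 - r n)))

      u≤ρ⇒0≤r : ∀ n → u n ≤ ρ → 𝟘 ≤ r n
      u≤ρ⇒0≤r n h = ≤-trans (0<⇒0≤ι 0<κ) (≤-by _ (0≤diff h)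
        (solve 2 (λ r k → r := k :+ ((con 1ℚ :- k) :- (con 1ℚ :- r))) ≈-refl (r n) (ι κ)))

      -- The uniform bound by ρ is carried along since it keeps r ≥ κ, hence nonnegative as
      -- `u-square` demands. Quadratic convergence is then used only as contraction by ρ.
      u-bound : ∀ n → u n ≤ ρ × u n ≤ ρ ^ n
      u-bound zero = u₀≤ρ , ≤-trans u₀≤ρ ρ≤1
        where u₀≤ρ = +-mono-≤ ≤-refl (neg-antimono κ≤r₀)
      u-bound (suc n) =
        let u≤ρ , u≤ρⁿ = u-bound n
            u′≤u² = u-square n (u≤ρ⇒0≤r n u≤ρ)
        in ≤-trans u′≤u² (≤-trans (*-mono-≤ 0≤ρ (0≤u n) u≤ρ (≤-trans u≤ρ ρ≤1))
                (≤-reflexive (*-identityʳ ρ)))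
         , ≤-trans u′≤u² (*-mono-≤ 0≤ρ (0≤u n) u≤ρ u≤ρⁿ)

      ρ^→0 : Lim (ρ ^_) 𝟘
      ρ^→0 = Lim-^ 0≤ρ 0<κ (≤-reflexive (solve 1 (λ k → (con 1ℚ :- k) :+ k := con 1ℚ) ≈-refl (ι κ)))

      module _ (κ⁻¹ : ℚ) (κκ⁻¹≡1 : κ ℚ.* κ⁻¹ ≡ 1ℚ) where

        -- As 1 - ρ = κ, consecutive values of κ⁻¹ ρ^n differ by exactly ρ^n.
        open Telescoping {u} {λ n → ι κ⁻¹ * ρ ^ n}
          (λ n → ∣∣≤-weaken (≤-reflexive (≈-trans (≈-sym (*-identityˡ _))
              (≈-trans (*-cong (≈-trans (ι-cong (sym κκ⁻¹≡1)) (ι-* κ κ⁻¹)) ≈-refl)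
                (solve 3 (λ k i p → (k :* i) :* p := i :* p :- i :* ((con 1ℚ :- k) :* p)) ≈-refl (ι κ)
                    (ι κ⁻¹) (ρ ^ n)))))
            (0≤⇒∣∣≤ (0≤u n) (proj₂ (u-bound n))))
          (Lim-cong (λ _ → ≈-refl) (zeroʳ (ι κ⁻¹)) (Lim-* (Lim-const (ι κ⁻¹)) ρ^→0))

        l : R
        l = (y - 𝟙) - proj₁ convergent

        r→1 : Lim r 𝟙
        r→1 = Lim-squeeze (0 , λ n _ → ∣-∣-swap (0≤⇒∣∣≤ (0≤u n) (proj₂ (u-bound n)))) ρ^→0

        -- Every step adds r - 1 = -u to the iterate, which after n steps is therefore (y - 1) -
        -- (sum of the first n values of u); r is y divided by its exponential.
        invariant : ∀ n → r n * exp ((y - 𝟙) - ∑ u n) ≈ y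
        invariant zero = ≈-trans (*-assoc _ _ _) (≈-trans (*-cong ≈-refl
          (≈-trans (*-cong ≈-refl (exp-cong (solve 1
              (λ y → (y :- con 1ℚ) :- con 0ℚ := :- (con 1ℚ :- y)) ≈-refl y)))
            (exp-inverse (𝟙 - y)))) (*-identityʳ y))
        invariant (suc n) = ≈-trans (*-assoc _ _ _) (≈-trans (*-cong ≈-refl
          (≈-trans (≈-sym (exp-+ _ _)) (exp-cong
            (solve 3 (λ y s u → u :+ ((y :- con 1ℚ) :- (s :+ u)) := (y :- con 1ℚ) :- s) ≈-refl y (∑ u n)
                (u n)))))
          (invariant n))

        exp-l : exp l ≈ y
        exp-l = Lim-unique
          (Lim-cong (λ _ → ≈-refl) (*-identityˡ (exp l))
            (Lim-* r→1 (exp-continuous (Lim-+ (Lim-const (y - 𝟙)) (Lim-neg (proj₂ convergent))))))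
          (Lim-cong (λ n → ≈-sym (invariant n)) ≈-refl (Lim-const y))

  abstract
    log-exists : ∀ y δ → 0ℚ ℚ.< δ → ι δ ≤ y → ∃ λ l → exp l ≈ y
    log-exists y δ 0<δ δ≤y =
      let κ , 0<κ , κ≤r₀ = Logarithm.r₀-positive y δ 0<δ δ≤y
          κ⁻¹ , _ , κκ⁻¹≡1 = divide 0<κ 1ℚ (ℚ.positive⁻¹ 1ℚ)
      in Logarithm.l y δ 0<δ δ≤y κ 0<κ κ≤r₀ κ⁻¹ κκ⁻¹≡1 , Logarithm.exp-l y δ 0<δ δ≤y κ 0<κ κ≤r₀ κ⁻¹ κκ⁻¹≡1

  -- Logarithms of natural numbers

  1≤nat-suc : ∀ i → 𝟙 ≤ ι (nat (suc i))
  1≤nat-suc i = ι-mono (nat-mono {1} {suc i} (ℕ.s≤s ℕ.z≤n))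

  log-nat : ∀ i → ∃ λ l → exp l ≈ ι (nat (suc i))
  log-nat i = log-exists (ι (nat (suc i))) 1ℚ (ℚ.positive⁻¹ 1ℚ) (1≤nat-suc i)

  -- log 0 is the junk value 0.
  log : ℕ → R
  log zero    = 𝟘
  log (suc i) = proj₁ (log-nat i)

  exp-log : ∀ i → exp (log (suc i)) ≈ ι (nat (suc i))
  exp-log i = proj₂ (log-nat i)

  log-* : ∀ i j → log (suc i ℕ.* suc j) ≈ log (suc i) + log (suc j)
  log-* i j = exp-injective (begin-equality
    exp (log (suc i ℕ.* suc j))             ≈⟨ exp-log _ ⟩
    ι (nat (suc i ℕ.* suc j))               ≈⟨ ≈-trans (ι-cong (nat-* (suc i) (suc j))) (ι-* _ _) ⟩
    ι (nat (suc i)) * ι (nat (suc j))       ≈⟨ *-cong (≈-sym (exp-log i)) (≈-sym (exp-log j)) ⟩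
    exp (log (suc i)) * exp (log (suc j))   ≈⟨ ≈-sym (exp-+ _ _) ⟩
    exp (log (suc i) + log (suc j))         ∎)
    where open ≤-Reasoning

  log-1 : log 1 ≈ 𝟘
  log-1 = exp-injective (≈-trans (exp-log 0) (≈-sym exp-𝟘))

  0≤log : ∀ i → 𝟘 ≤ log (suc i)
  0≤log i = exp-cancel-≤ (≤-respˡ (≈-sym exp-𝟘) (≤-respʳ (≈-sym (exp-log i)) (1≤nat-suc i)))

  exp-neg-log : ∀ i → exp (- log (suc i)) ≈ ι (recip i)
  exp-neg-log i = begin-equality
    exp (- log (suc i))                                            ≈⟨ ≈-sym (*-identityˡ _) ⟩
    𝟙 * exp (- log (suc i))                                        ≈⟨ *-cong (≈-sym (ι-recip i)) ≈-refl ⟩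
    (ι (recip i) * ι (nat (suc i))) * exp (- log (suc i))          ≈⟨ *-assoc _ _ _ ⟩
    ι (recip i) * (ι (nat (suc i)) * exp (- log (suc i)))
      ≈⟨ *-cong ≈-refl (*-cong (≈-sym (exp-log i)) ≈-refl) ⟩
    ι (recip i) * (exp (log (suc i)) * exp (- log (suc i)))        ≈⟨ *-cong ≈-refl (exp-inverse _) ⟩
    ι (recip i) * 𝟙                                                ≈⟨ *-identityʳ _ ⟩
    ι (recip i)                                                    ∎
    where open ≤-Reasoning

  -- With n = i + 2, exponentiating reduces the claim to (n - 1)/n = 1 - 1/n ≤ e^(-1/n).
  recip≤log-diff : ∀ i → ι (recip (suc i)) ≤ log (suc (suc i)) - log (suc i)
  recip≤log-diff i = ≤-by _ (0≤diff (exp-cancel-≤ {L - L′} { - ρ} (begin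
    exp (L - L′)                               ≈⟨ exp-+ _ _ ⟩
    exp L * exp (- L′)                         ≈⟨ *-cong (exp-log i) (exp-neg-log (suc i)) ⟩
    ι (nat (suc i)) * ρ
      ≈⟨ solve 2 (λ n r → n :* r := r :* (con 1ℚ :+ n) :- r) ≈-refl (ι (nat (suc i))) ρ ⟩
    ρ * (𝟙 + ι (nat (suc i))) - ρ
      ≈⟨ +-cong (≈-trans (*-cong ≈-refl (≈-sym (ι-nat-suc (suc i)))) (ι-recip (suc i))) ≈-refl ⟩
    𝟙 - ρ                                      ≲⟨ 1+x≤exp (- ρ) ⟩
    exp (- ρ)                                  ∎)))
    (solve 3 (λ r l l′ → l′ :- l := r :+ ((:- r) :- (l :- l′))) ≈-refl ρ L L′)
    where
    open ≤-Reasoning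
    L  = log (suc i)
    L′ = log (suc (suc i))
    ρ  = ι (recip (suc i))

  log-large : ∀ B → ∃ λ N → ∀ n → N ℕ.≤ n → ι B ≤ log (suc n)
  log-large B =
    let Q , 0<Q , expB≤Q = bounded (exp (ι B))
        N , h = nat-large Q 0<Q
    in N , λ n N≤n → exp-cancel-≤ (≤-respʳ (≈-sym (exp-log n))
         (≤-trans (upper expB≤Q) (ι-mono (h (suc n) (ℕ.m≤n⇒m≤1+n N≤n)))))

  -- The powers m^(-s) and their telescoping majorant

  module Powers (s : R) (δ : ℚ) (0<δ : 0ℚ ℚ.< δ) (1+δ≤s : 𝟙 + ι δ ≤ s) where

    -- power m is m^(-s), with the junk value 0 at m = 0.
    power : ℕ → R
    power zero    = 𝟘
    power (suc i) = exp ((- s) * log (suc i))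

    power-nonNeg : ∀ m → 𝟘 ≤ power m
    power-nonNeg zero    = ≤-refl
    power-nonNeg (suc i) = exp-nonNeg _

    power-1 : power 1 ≈ 𝟙
    power-1 = ≈-trans (exp-cong (≈-trans (*-cong ≈-refl log-1) (zeroʳ _))) exp-𝟘

    power-* : ∀ m n → power (m ℕ.* n) ≈ power m * power n
    power-* zero    n       = ≈-sym (zeroˡ _)
    power-* (suc i) zero    = ≈-trans (≈-reflexive (cong power (ℕ.*-zeroʳ i))) (≈-sym (zeroʳ _))
    power-* (suc i) (suc j) = ≈-trans
      (exp-cong (≈-trans (*-cong ≈-refl (log-* i j))
        (solve 3 (λ s x y → s :* (x :+ y) := s :* x :+ s :* y) ≈-refl (- s) (log (suc i)) (log (suc j)))))
      (exp-+ _ _)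

    σ : R
    σ = s - 𝟙

    δ≤σ : ι δ ≤ σ
    δ≤σ = ≤-by _ (0≤diff 1+δ≤s) (solve 2 (λ s d → s :- con 1ℚ := d :+ (s :- (con 1ℚ :+ d))) ≈-refl s (ι δ))

    0≤δ : 𝟘 ≤ ι δ
    0≤δ = 0<⇒0≤ι 0<δ

    -- This is (i + 1)^(1 - s), the antiderivative-like quantity whose differences dominate the
    -- powers.
    g : ℕ → R
    g i = exp (- (σ * log (suc i)))

    power-g : ∀ i → power (suc i) ≈ g i * ι (recip i)
    power-g i = begin-equality
      exp ((- s) * L)
        ≈⟨ exp-cong (solve 2 (λ s l → (:- s) :* l := (:- ((s :- con 1ℚ) :* l)) :+ (:- l)) ≈-refl s L) ⟩
      exp (- (σ * L) + (- L))      ≈⟨ exp-+ _ _ ⟩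
      g i * exp (- L)              ≈⟨ *-cong ≈-refl (exp-neg-log i) ⟩
      g i * ι (recip i)            ∎
      where
      open ≤-Reasoning
      L = log (suc i)

    g≤1 : ∀ i → g i ≤ 𝟙
    g≤1 i = ≤-respʳ exp-𝟘 (exp-mono (≤-by (σ * log (suc i)) (*-nonNeg (≤-trans 0≤δ δ≤σ) (0≤log i))
      (solve 1 (λ x → con 0ℚ := (:- x) :+ x) ≈-refl (σ * log (suc i)))))

    power≤recip : ∀ i → power (suc i) ≤ ι (recip i)
    power≤recip i = ≤-respˡ (≈-sym (power-g i)) (≤-respʳ (*-identityˡ _)
        (*-monoʳ-≤ (0<⇒0≤ι (recip>0 i)) (g≤1 i)))

    -- With m = i + 2, the difference is m^(1 - s) (e^x - 1) for x = σ (log m - log (m - 1)), and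
    -- e^x - 1 ≥ x ≥ δ / m. The rational δ stands in for s - 1, so that the later division is by a
    -- rational.
    power-telescope : ∀ i → ι δ * power (suc (suc i)) ≤ g i - g (suc i)
    power-telescope i = begin
      ι δ * power (suc (suc i))    ≈⟨ *-cong ≈-refl (power-g (suc i)) ⟩
      ι δ * (g (suc i) * ρ)
        ≈⟨ solve 3 (λ d g r → d :* (g :* r) := g :* (d :* r)) ≈-refl (ι δ) (g (suc i)) ρ ⟩
      g (suc i) * (ι δ * ρ)
        ≲⟨ *-monoˡ-≤ (exp-nonNeg _) (*-mono-≤ (≤-trans 0≤δ δ≤σ) (0<⇒0≤ι (recip>0 (suc i))) δ≤σ
            (recip≤log-diff i)) ⟩
      g (suc i) * (σ * (L′ - L))   ≲⟨ ≤-by _ (*-nonNeg (exp-nonNeg _) (0≤diff (1+x≤exp (σ * (L′ - L)))))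
                                       (solve 3 (λ g x e → g :* e :- g := g :* x :+ g :*
                                           (e :- (con 1ℚ :+ x))) ≈-refl (g (suc i)) (σ * (L′ - L))
                                           (exp (σ * (L′ - L)))) ⟩
      g (suc i) * exp (σ * (L′ - L)) - g (suc i)
                                   ≈⟨ +-cong (≈-trans (≈-sym (exp-+ _ _))
                                       (exp-cong (solve 3
                                       (λ σ l l′ → (:- (σ :* l′)) :+ σ :* (l′ :- l) := :-
                                       (σ :* l)) ≈-refl σ L L′))) ≈-refl ⟩
      g i - g (suc i)              ∎
      where
      open ≤-Reasoning
      L  = log (suc i)
      L′ = log (suc (suc i))
      ρ  = ι (recip (suc i))

    -- Put x = σ log (n + 1), so that `g n` is e^(-x). Once log (n + 1) ≥ B = 1/(δε), x ≥ 1/ε, and x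
    -- ≤ e^x gives e^(-x) ≤ ε.
    g→0 : Lim g 𝟘
    g→0 ε 0<ε =
      let B , 0<B , δεB≡1 = divide (*-pos 0<δ 0<ε) 1ℚ (ℚ.positive⁻¹ 1ℚ)
          N , h = log-large B
      in N , λ n N≤n → ∣∣≤-cong (solve 1 (λ x → x := x :- con 0ℚ) ≈-refl (g n))
           (0≤⇒∣∣≤ (exp-nonNeg _) (small B δεB≡1 0<B (h n N≤n)))
      where
      open ≤-Reasoning
      0≤ε = 0<⇒0≤ι 0<ε
      small : ∀ {n} B → (δ ℚ.* ε) ℚ.* B ≡ 1ℚ → 0ℚ ℚ.< B → ι B ≤ log (suc n) → g n ≤ ι ε
      small {n} B eq 0<B B≤L = begin
        g n                            ≈⟨ ≈-sym (*-identityʳ _) ⟩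
        g n * 𝟙
          ≈⟨ *-cong ≈-refl (≈-trans (ι-cong (sym eq)) (≈-trans (ι-* _ _) (*-cong (ι-* _ _) ≈-refl))) ⟩
        g n * ((ι δ * ι ε) * ι B)
          ≈⟨ solve 4 (λ g d e b → g :* ((d :* e) :* b) := (e :* g) :* (d :* b)) ≈-refl (g n) (ι δ) (ι ε)
              (ι B) ⟩
        (ι ε * g n) * (ι δ * ι B)
          ≲⟨ *-monoˡ-≤ (*-nonNeg 0≤ε (exp-nonNeg _)) (*-mono-≤ (≤-trans 0≤δ δ≤σ) (0<⇒0≤ι 0<B) δ≤σ B≤L) ⟩
        (ι ε * g n) * x
          ≲⟨ *-monoˡ-≤ (*-nonNeg 0≤ε (exp-nonNeg _)) (≤-trans (≤-by 𝟙 0≤1 (+-comm _ _)) (1+x≤exp x)) ⟩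
        (ι ε * g n) * exp x
          ≈⟨ solve 3 (λ e g x → (e :* g) :* x := e :* (x :* g)) ≈-refl (ι ε) (g n) (exp x) ⟩
        ι ε * (exp x * g n)            ≈⟨ *-cong ≈-refl (exp-inverse x) ⟩
        ι ε * 𝟙                        ≈⟨ *-identityʳ _ ⟩
        ι ε                            ∎
        where x = σ * log (suc n)

    δ⁻¹ : ℚ
    δ⁻¹ = proj₁ (divide 0<δ 1ℚ (ℚ.positive⁻¹ 1ℚ))

    0<δ⁻¹ : 0ℚ ℚ.< δ⁻¹
    0<δ⁻¹ = proj₁ (proj₂ (divide 0<δ 1ℚ (ℚ.positive⁻¹ 1ℚ)))

    δδ⁻¹≈1 : ι δ * ι δ⁻¹ ≈ 𝟙
    δδ⁻¹≈1 = ≈-trans (≈-sym (ι-* _ _)) (ι-cong (proj₂ (proj₂ (divide 0<δ 1ℚ (ℚ.positive⁻¹ 1ℚ)))))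

    -- `remainder i` bounds the sum of m^(-s) over m > i. The term m = 1 is counted separately,
    -- since (m - 1)^(1 - s) is undefined there.
    remainder : ℕ → R
    remainder zero    = 𝟙 + ι δ⁻¹ * g 0
    remainder (suc i) = ι δ⁻¹ * g i

    power≤remainder : ∀ i → power (suc i) ≤ remainder i - remainder (suc i)
    power≤remainder zero    = ≤-reflexive (≈-trans power-1
      (solve 1 (λ x → con 1ℚ := (con 1ℚ :+ x) :- x) ≈-refl (ι δ⁻¹ * g 0)))
    power≤remainder (suc i) = begin
      power (suc (suc i))
        ≈⟨ ≈-trans (≈-sym (*-identityˡ _)) (*-cong (≈-sym δδ⁻¹≈1) ≈-refl) ⟩
      (ι δ * ι δ⁻¹) * power (suc (suc i))
        ≈⟨ solve 3 (λ d e x → (d :* e) :* x := e :* (d :* x)) ≈-refl (ι δ) (ι δ⁻¹) (power (suc (suc i))) ⟩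
      ι δ⁻¹ * (ι δ * power (suc (suc i)))      ≲⟨ *-monoˡ-≤ (0<⇒0≤ι 0<δ⁻¹) (power-telescope i) ⟩
      ι δ⁻¹ * (g i - g (suc i))
        ≈⟨ solve 3 (λ e x y → e :* (x :- y) := e :* x :- e :* y) ≈-refl (ι δ⁻¹) (g i) (g (suc i)) ⟩
      ι δ⁻¹ * g i - ι δ⁻¹ * g (suc i)          ∎
      where open ≤-Reasoning

    remainder→0 : Lim remainder 𝟘
    remainder→0 = Lim-unsuc (Lim-cong (λ _ → ≈-refl) (zeroʳ (ι δ⁻¹)) (Lim-* (Lim-const (ι δ⁻¹)) g→0))
      where
      Lim-unsuc : ∀ {a ℓ} → Lim (λ n → a (suc n)) ℓ → Lim a ℓ
      Lim-unsuc {a} {ℓ} h ε 0<ε = let N , k = h ε 0<ε in suc N , later k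
        where
        later : ∀ {N} → (∀ n → N ℕ.≤ n → ∣ a (suc n) - ℓ ∣≤ ι ε) → ∀ n → suc N ℕ.≤ n → ∣ a n - ℓ ∣≤ ι ε
        later k (suc n) (ℕ.s≤s p) = k n p

    module _ {a : ℕ → R} (∣a∣≤ : ∀ m → ∣ a m ∣≤ power m) where
      open Telescoping {λ i → a (suc i)} {remainder}
        (λ i → ∣∣≤-weaken (power≤remainder i) (∣a∣≤ (suc i))) remainder→0 public

  -- The surviving summands sit at p, 2p, 3p and so on. The summand and the counter branch on the
  -- same test, so one Boolean motive splits both.
  ∑-multiples : ∀ k (g : ℕ → R) M → let p = suc k in
    ∑ (λ i → if does (p ∣? suc i) then g (suc i) else 𝟘) M ≈ ∑ (λ j → g (p ℕ.* suc j)) (multiples p M)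
  ∑-multiples k g zero    = ≈-refl
  ∑-multiples k g (suc M) = does-elim
    (λ b → ∑ (λ i → if does (suc k ∣? suc i) then g (suc i) else 𝟘) M + (if b then g (suc M) else 𝟘) ≈
           ∑ (λ j → g (suc k ℕ.* suc j)) (if b then suc (multiples (suc k) M) else multiples (suc k) M))
    (suc k ∣? suc M)
    (λ h → +-cong (∑-multiples k g M) (≈-reflexive (cong g (next-multiple k M h))))
    (λ _ → ≈-trans (+-identityʳ _) (∑-multiples k g M))

  ∑-zero : ∀ {a : ℕ → R} n → (∀ i → i ℕ.< n → a i ≈ 𝟘) → ∑ a n ≈ 𝟘
  ∑-zero zero    h = ≈-refl
  ∑-zero (suc n) h = ≈-trans (+-cong (∑-zero n λ i p → h i (ℕ.m≤n⇒m≤1+n p)) (h n ℕ.≤-refl)) (+-identityʳ 𝟘)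

  -- Euler's product by sieving: removing the multiples of the primes up to k from
  -- Σ a(m) multiplies the sum by Π (1 - a(p)), and leaves 1 plus terms with m > k.

  module Euler (a : ℕ → R) (a-1 : a 1 ≈ 𝟙) (a-* : ∀ m n → a (m ℕ.* n) ≈ a m * a n)
    {c : ℕ → R} (∣a∣≤ : ∀ i → ∣ a (suc i) ∣≤ c i - c (suc i)) (c→0 : Lim c 𝟘)
    {A : R} (a→A : Lim (∑ (λ i → a (suc i))) A) where

    sieve : ℕ → ℕ → R
    sieve zero    m = a m
    sieve (suc k) m = if does (prime? (suc k) ×-dec suc k ∣? m) then 𝟘 else sieve k m

    eulerProduct : ℕ → R
    eulerProduct zero    = 𝟙
    eulerProduct (suc k) = if does (prime? (suc k)) then
        (𝟙 - a (suc k)) * eulerProduct k else eulerProduct k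

    ∣sieve∣≤ : ∀ k i → ∣ sieve k (suc i) ∣≤ c i - c (suc i)
    ∣sieve∣≤ zero    i = ∣a∣≤ i
    ∣sieve∣≤ (suc k) i = if-elim (λ x → ∣ x ∣≤ c i - c (suc i)) (prime? (suc k) ×-dec suc k ∣? suc i)
      (λ _ → ∣𝟘∣≤ (∣∣≤⇒0≤ (∣a∣≤ i))) (λ _ → ∣sieve∣≤ k i)

    sieve-1 : ∀ k → sieve k 1 ≈ 𝟙
    sieve-1 zero    = a-1
    sieve-1 (suc k) = ≈-trans (≈-reflexive (if-no (prime? (suc k) ×-dec suc k ∣? 1)
      λ (k-prime , k∣1) → ¬prime[1] (subst Prime (∣1⇒≡1 k∣1) k-prime))) (sieve-1 k)

    sieve-divisible : ∀ k {p m} → Prime p → p ∣ m → p ℕ.≤ k → sieve k m ≈ 𝟘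
    sieve-divisible zero    {zero} () _ _
    sieve-divisible zero    {suc p} _ _ ()
    sieve-divisible (suc k) {p} {m} p-prime p∣m p≤1+k = if-elim (_≈ 𝟘) (prime? (suc k) ×-dec suc k ∣? m)
      (λ _ → ≈-refl)
      (λ ¬h → sieve-divisible k p-prime p∣m
        (ℕ.s≤s⁻¹ (ℕ.≤∧≢⇒< p≤1+k λ p≡1+k → ¬h (subst Prime p≡1+k p-prime , subst (_∣ m) p≡1+k p∣m))))

    -- By Euclid's lemma a prime at most k divides pm only if it divides m, as it cannot equal the
    -- larger prime p; both sides thus pass the same tests.
    sieve-* : ∀ k {p} m → Prime p → k ℕ.< p → sieve k (p ℕ.* m) ≈ a p * sieve k m
    sieve-* zero    m _ _ = a-* _ m
    sieve-* (suc k) {p} m p-prime k<p = if-elim (λ x → sieve (suc k) (p ℕ.* m) ≈ a p * x)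
        (prime? (suc k) ×-dec suc k ∣? m)
      (λ (k-prime , k∣m) → ≈-trans (≈-reflexive (if-yes (prime? (suc k) ×-dec suc k ∣? (p ℕ.* m))
          (k-prime , ∣n⇒∣m*n p k∣m)))
                             (≈-sym (zeroʳ (a p))))
      (λ ¬h → ≈-trans (≈-reflexive (if-no (prime? (suc k) ×-dec suc k ∣? (p ℕ.* m))
                 λ (k-prime , k∣pm) → coprime k-prime (λ k∣m → ¬h (k-prime , k∣m))
                     (euclidsLemma p m k-prime k∣pm)))
               (sieve-* k m p-prime (ℕ.<-trans ℕ.≤-refl k<p)))
      where
      coprime : Prime (suc k) → ¬ (suc k ∣ m) → ¬ (suc k ∣ p ⊎ suc k ∣ m)
      coprime k-prime ∤m (inj₂ ∣m) = ∤m ∣m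
      coprime k-prime ∤m (inj₁ ∣p) with prime⇒irreducible p-prime ∣p
      ... | inj₁ k≡1 = ¬prime[1] (subst Prime k≡1 k-prime)
      ... | inj₂ k≡p = ℕ.<⇒≢ k<p k≡p

    S : ℕ → ℕ → R
    S k = ∑ (λ i → sieve k (suc i))

    -- With p = k + 1, the terms newly removed sit at m = pj, where `sieve-*` extracts a(p); the
    -- loss up to M is a(p) times the previous sum up to M / p.
    S-prime : ∀ k → Prime (suc k) → ∀ M → S (suc k) M ≈ S k M - a (suc k) * S k (multiples (suc k) M)
    S-prime k k-prime M = begin-equality
      S (suc k) M
        ≈⟨ solve 2 (λ s t → s := (s :+ t) :- t) ≈-refl (S (suc k) M) (∑ hit M) ⟩
      (S (suc k) M + ∑ hit M) - ∑ hit M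
        ≈⟨ +-cong (≈-trans (≈-sym (∑-+ _ _ M)) (∑-cong (λ i → split (suc i)) M)) (-‿cong (begin-equality
             ∑ hit M                                                    ≈⟨ ∑-multiples k (sieve k) M ⟩
             ∑ (λ j → sieve k (suc k ℕ.* suc j)) (multiples (suc k) M)  ≈⟨ ∑-cong
                 (λ j → sieve-* k (suc j) k-prime ℕ.≤-refl) (multiples (suc k) M) ⟩
             ∑ (λ j → a (suc k) * sieve k (suc j)) (multiples (suc k) M) ≈⟨ ∑-*ˡ (a (suc k)) _
                 (multiples (suc k) M) ⟩
             a (suc k) * S k (multiples (suc k) M)                      ∎)) ⟩
      S k M - a (suc k) * S k (multiples (suc k) M) ∎
      where
      open ≤-Reasoning
      hit : ℕ → R
      hit i = if does (suc k ∣? suc i) then sieve k (suc i) else 𝟘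
      split : ∀ m → sieve (suc k) m + (if does (suc k ∣? m) then sieve k m else 𝟘) ≈ sieve k m
      split m = if-elim (λ x → sieve (suc k) m + x ≈ sieve k m) (suc k ∣? m)
        (λ h → ≈-trans (+-cong (≈-reflexive (if-yes (prime? (suc k) ×-dec suc k ∣? m)
            (k-prime , h))) ≈-refl) (+-identityˡ _))
        (λ ¬h → ≈-trans (+-identityʳ _) (≈-reflexive
            (if-no (prime? (suc k) ×-dec suc k ∣? m) λ (_ , h) → ¬h h)))

    -- M and M / p tend to infinity together, so both sums in `S-prime` have the same limit, which
    -- is multiplied by 1 - a(p).
    S-limit : ∀ k → Lim (S k) (eulerProduct k * A)
    S-limit zero    = Lim-cong (λ _ → ≈-refl) (≈-sym (*-identityˡ A)) a→A
    S-limit (suc k) = if-elim (λ x → Lim (S (suc k)) (x * A)) (prime? (suc k))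
      (λ k-prime → Lim-cong (λ M → ≈-sym (S-prime k k-prime M))
        (solve 3 (λ a e A → e :* A :- a :* (e :* A) := ((con 1ℚ :- a) :* e) :* A) ≈-refl (a (suc k))
            (eulerProduct k) A)
        (Lim-+ (S-limit k) (Lim-neg (Lim-* (Lim-const (a (suc k)))
          (Lim-∘ (multiples (suc k)) (multiples-large k) (S-limit k))))))
      (λ ¬prime → Lim-cong (∑-cong λ i → ≈-reflexive
          (sym (if-no (prime? (suc k) ×-dec suc k ∣? suc i) λ (h , _) → ¬prime h)))
        ≈-refl (S-limit k))

    -- Each m from 2 to k + 1 has a prime divisor at most k + 1 and has been sieved out; only m = 1
    -- is left.
    S-initial : ∀ k → S (suc k) (suc k) ≈ 𝟙
    S-initial k = ≈-trans (∑-head _ k) (≈-trans (+-cong (sieve-1 (suc k))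
      (∑-zero k λ i i<k → let p , p-prime , p∣m = prime-divisor (suc (suc i)) (ℕ.s≤s (ℕ.s≤s ℕ.z≤n)) in
        sieve-divisible (suc k) p-prime p∣m (ℕ.≤-trans (∣⇒≤ p∣m) (ℕ.s≤s i<k))))
      (+-identityʳ 𝟙))

    -- Sieving only replaces terms by 0, so one majorant `c` serves every stage, and the k-th sieved
    -- sum differs from its initial part 1 by at most `c k`.
    eulerProduct-limit : Lim (λ k → eulerProduct k * A) 𝟙
    eulerProduct-limit = Lim-squeeze (1 , bound) c→0
      where
      bound : ∀ k → 1 ℕ.≤ k → ∣ eulerProduct k * A - 𝟙 ∣≤ c k
      bound (suc k) _ = ∣∣≤-cong (+-cong ≈-refl (-‿cong (S-initial k)))
        (Telescoping.tail-limit (∣sieve∣≤ (suc k)) c→0 (S-limit (suc k)) (suc k))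

  -- (1 + x) / (1 - x) lies between e^(2x - x²) and e^(2x + 2x²).

  1+x≤[1-x]exp : ∀ {x} → 𝟘 ≤ x → x ≤ 𝕙 → 𝟙 + x ≤ (𝟙 - x) * exp ((x + x) + (x * x + x * x))
  1+x≤[1-x]exp {x} 0≤x x≤½ = begin
    𝟙 + x                    ≲⟨ 1+x≤exp x ⟩
    exp x                    ≈⟨ ≈-sym (*-identityˡ _) ⟩
    𝟙 * exp x                ≲⟨ *-monoʳ-≤ (exp-nonNeg x) (≤-by _
                                  (0≤+ (*-nonNeg (*-nonNeg 0≤x 0≤x) (0≤+ (0≤diff x≤½) (0≤diff x≤½)))
                                       (*-nonNeg 0≤1-x (0≤diff (1+x≤exp y))))
                                  (solve 2 (λ x e → (con 1ℚ :- x) :* e :=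
                                    con 1ℚ :+ (x :* x :* ((con ½ :- x) :+ (con ½ :- x)) :+
                                    (con 1ℚ :- x) :* (e :-
                                        (con 1ℚ :+ (x :+ (x :* x :+ x :* x)))))) ≈-refl x (exp y))) ⟩
    ((𝟙 - x) * exp y) * exp x ≈⟨ ≈-trans (*-assoc _ _ _) (*-cong ≈-refl (≈-trans (≈-sym (exp-+ y x))
                                  (exp-cong (solve 1 (λ x → (x :+ (x :* x :+ x :* x)) :+ x :=
                                      (x :+ x) :+ (x :* x :+ x :* x)) ≈-refl x)))) ⟩
    (𝟙 - x) * exp ((x + x) + (x * x + x * x)) ∎
    where
    open ≤-Reasoning
    y = x + (x * x + x * x)
    0≤1-x = 0≤diff (≤-trans x≤½ (ι-mono (ℚ.≤ᵇ⇒≤ _)))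

  [1-x]exp≤1+x : ∀ {x} → 𝟘 ≤ x → (𝟙 - x) * exp ((x + x) - x * x) ≤ 𝟙 + x
  [1-x]exp≤1+x {x} 0≤x = begin
    (𝟙 - x) * exp ((x + x) - x * x)  ≲⟨ *-monoʳ-≤ (exp-nonNeg _) (1+x≤exp (- x)) ⟩
    exp (- x) * exp ((x + x) - x * x)
      ≈⟨ ≈-trans (≈-sym (exp-+ _ _)) (exp-cong (solve 1
          (λ x → (:- x) :+ ((x :+ x) :- x :* x) := x :- x :* x) ≈-refl x)) ⟩
    exp y                            ≈⟨ ≈-sym (*-identityˡ _) ⟩
    𝟙 * exp y                        ≲⟨ *-monoʳ-≤ (exp-nonNeg y) (≤-by _
                                          (0≤+ (*-nonNeg (*-nonNeg 0≤x 0≤x) 0≤x)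
                                              (*-nonNeg (0≤+ 0≤1 0≤x) (0≤diff (1+x≤exp (- y)))))
                                          (solve 2 (λ x e → (con 1ℚ :+ x) :* e :=
                                            con 1ℚ :+ (x :* x :* x :+ (con 1ℚ :+ x) :*
                                                (e :- (con 1ℚ :+ (:- (x :- x :* x)))))) ≈-refl x
                                                (exp (- y)))) ⟩
    ((𝟙 + x) * exp (- y)) * exp y
      ≈⟨ ≈-trans (*-assoc _ _ _) (*-cong ≈-refl (≈-trans (*-comm _ _) (exp-inverse y))) ⟩
    (𝟙 + x) * 𝟙                      ≈⟨ *-identityʳ _ ⟩
    𝟙 + x                            ∎
    where
    open ≤-Reasoning
    y = x - x * x

  -- U and V are partial Euler products for ζ and for C, P is the partial sum over the selected
  -- primes, and w is the error accumulated in the exponent. The quotient V / U is multiplied out.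
  record Sandwich (U V P w : R) : Set where
    field
      0≤U : 𝟘 ≤ U
      0≤V : 𝟘 ≤ V
      lo  : U * exp ((P + P) - w) ≤ V
      up  : V ≤ U * exp ((P + P) + w)

  open Sandwich

  sandwich-weaken : ∀ {U V P P′ w w′} → P ≈ P′ → w ≤ w′ → Sandwich U V P w → Sandwich U V P′ w′
  sandwich-weaken P≈P′ w≤w′ h = record
    { 0≤U = 0≤U h
    ; 0≤V = 0≤V h
    ; lo = ≤-trans (*-monoˡ-≤ (0≤U h) (exp-mono (+-mono-≤ (≤-reflexive (≈-sym (+-cong P≈P′ P≈P′)))
        (neg-antimono w≤w′)))) (lo h)
    ; up = ≤-trans (up h) (*-monoˡ-≤ (0≤U h) (exp-mono (+-mono-≤ (≤-reflexive (+-cong P≈P′ P≈P′)) w≤w′)))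
    }

  sandwich-cong : ∀ {U V V′ P w} → V ≈ V′ → Sandwich U V P w → Sandwich U V′ P w
  sandwich-cong V≈V′ h = record
    { 0≤U = 0≤U h ; 0≤V = ≤-respʳ V≈V′ (0≤V h) ; lo = ≤-respʳ V≈V′ (lo h) ; up = ≤-respˡ V≈V′ (up h) }

  sandwich-scale : ∀ {U V P w f} → 𝟘 ≤ f → Sandwich U V P w → Sandwich (f * U) (f * V) P w
  sandwich-scale 0≤f h = record
    { 0≤U = *-nonNeg 0≤f (0≤U h)
    ; 0≤V = *-nonNeg 0≤f (0≤V h)
    ; lo = ≤-respˡ (≈-sym (*-assoc _ _ _)) (*-monoˡ-≤ 0≤f (lo h))
    ; up = ≤-respʳ (≈-sym (*-assoc _ _ _)) (*-monoˡ-≤ 0≤f (up h))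
    }

  -- The lower estimate for (1 + x)/(1 - x) costs x² in the exponent, the upper one 2x²; the larger
  -- is charged on both sides to keep a single w.
  sandwich-factor : ∀ {U V P w x} → 𝟘 ≤ x → x ≤ 𝕙 → Sandwich U V P w →
                    Sandwich ((𝟙 - x) * U) ((𝟙 + x) * V) (P + x) (w + (x * x + x * x))
  sandwich-factor {U} {V} {P} {w} {x} 0≤x x≤½ h = record
    { 0≤U = *-nonNeg 0≤1-x (0≤U h)
    ; 0≤V = *-nonNeg 0≤1+x (0≤V h)
    ; lo = begin
        ((𝟙 - x) * U) * exp (((P + x) + (P + x)) - (w + (x * x + x * x)))
          ≲⟨ *-monoˡ-≤ (*-nonNeg 0≤1-x (0≤U h)) (exp-mono (≤-by (x * x) (*-nonNeg 0≤x 0≤x)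
               (solve 3 (λ p x w → ((p :+ p) :- w) :+ ((x :+ x) :- x :* x) :=
                 (((p :+ x) :+ (p :+ x)) :- (w :+ (x :* x :+ x :* x))) :+ x :* x) ≈-refl P x w))) ⟩
        ((𝟙 - x) * U) * exp (((P + P) - w) + ((x + x) - x * x))
          ≈⟨ ≈-trans (*-cong ≈-refl (exp-+ _ _)) (solve 4
              (λ f u e e′ → (f :* u) :* (e :* e′) := (f :* e′) :* (u :* e)) ≈-refl _ _ _ _) ⟩
        ((𝟙 - x) * exp ((x + x) - x * x)) * (U * exp ((P + P) - w))
          ≲⟨ *-mono-≤ 0≤1+x (*-nonNeg (0≤U h) (exp-nonNeg _)) ([1-x]exp≤1+x 0≤x) (lo h) ⟩
        (𝟙 + x) * V ∎
    ; up = begin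
        (𝟙 + x) * V
          ≲⟨ *-mono-≤ (*-nonNeg 0≤1-x (exp-nonNeg _)) (0≤V h) (1+x≤[1-x]exp 0≤x x≤½) (up h) ⟩
        ((𝟙 - x) * exp ((x + x) + (x * x + x * x))) * (U * exp ((P + P) + w))
          ≈⟨ ≈-trans (solve 4 (λ f u e e′ → (f :* e′) :* (u :* e) := (f :* u) :* (e :* e′)) ≈-refl _ _ _ _)
               (*-cong ≈-refl (≈-trans (≈-sym (exp-+ _ _)) (exp-cong
                 (solve 3 (λ p x w → ((p :+ p) :+ w) :+ ((x :+ x) :+ (x :* x :+ x :* x)) :=
                   ((p :+ x) :+ (p :+ x)) :+ (w :+ (x :* x :+ x :* x))) ≈-refl P x w)))) ⟩
        ((𝟙 - x) * U) * exp (((P + x) + (P + x)) + (w + (x * x + x * x))) ∎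
    }
    where
    open ≤-Reasoning
    0≤1-x = 0≤diff (≤-trans x≤½ (ι-mono (ℚ.≤ᵇ⇒≤ _)))
    0≤1+x = 0≤+ 0≤1 0≤x

  -- Partial sums of a telescoping majorant of Σ 2/m².
  slack : ℕ → R
  slack k = ι 4ℚ * (𝟙 - ι (recip k))

  -- With n = k + 1, r = 1/n and r′ = 1/(n + 1) one has r - r′ = r r′, and 4(r - r′) - 2r² = 2r² r′
  -- (n - 1) is nonnegative.
  slack-step : ∀ k → slack k + (ι (recip k) * ι (recip k) + ι (recip k) * ι (recip k)) ≤ slack (suc k)
  slack-step k = ≤-by (ι 4ℚ * (r - r′) - (r * r + r * r))
    (begin
      𝟘                                        ≲⟨ *-nonNeg (0≤+ 0≤r 0≤r)
          (*-nonNeg 0≤rr′ (0≤diff (1≤nat-suc k))) ⟩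
      (r + r) * ((r * r′) * (n - 𝟙))
        ≈⟨ solve 3 (λ r r′ n → (r :+ r) :* ((r :* r′) :* (n :- con 1ℚ)) :=
                                                    con 4ℚ :* (r :* (r′ :* (r :* n))) :-
                                                        ((r :* (r′ :* (con 1ℚ :+ n))) :* r :+
                                                        (r :* (r′ :* (con 1ℚ :+ n))) :* r)) ≈-refl r r′ n ⟩
      ι 4ℚ * (r * (r′ * (r * n))) - ((r * (r′ * (𝟙 + n))) * r + (r * (r′ * (𝟙 + n))) * r)
        ≈⟨ +-cong (*-cong ≈-refl (begin-equality
             r * (r′ * (r * n))
               ≈⟨ *-cong ≈-refl (≈-trans (*-cong ≈-refl rn≈1) (*-identityʳ r′)) ⟩
             r * r′
               ≈⟨ solve 3 (λ r r′ n → r :* r′ := r :* (r′ :* (con 1ℚ :+ n)) :- r′ :*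
                   (r :* n)) ≈-refl r r′ n ⟩
             r * (r′ * (𝟙 + n)) - r′ * (r * n)
               ≈⟨ +-cong rr′n≈r (-‿cong (≈-trans (*-cong ≈-refl rn≈1) (*-identityʳ r′))) ⟩
             r - r′                             ∎))
             (-‿cong (+-cong (*-cong rr′n≈r ≈-refl) (*-cong rr′n≈r ≈-refl))) ⟩
      ι 4ℚ * (r - r′) - (r * r + r * r)         ∎)
    (solve 2 (λ r r′ → con 4ℚ :* (con 1ℚ :- r′) :=
      (con 4ℚ :* (con 1ℚ :- r) :+ (r :* r :+ r :* r)) :+
          (con 4ℚ :* (r :- r′) :- (r :* r :+ r :* r))) ≈-refl r r′)
    where
    open ≤-Reasoning
    r  = ι (recip k)
    r′ = ι (recip (suc k))
    n  = ι (nat (suc k))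
    0≤r = 0<⇒0≤ι (recip>0 k)
    0≤rr′ = *-nonNeg 0≤r (0<⇒0≤ι (recip>0 (suc k)))
    rn≈1 : r * n ≈ 𝟙
    rn≈1 = ι-recip k
    rr′n≈r : r * (r′ * (𝟙 + n)) ≈ r
    rr′n≈r = ≈-trans (*-cong ≈-refl (≈-trans (*-cong ≈-refl (≈-sym (ι-nat-suc (suc k))))
        (ι-recip (suc k)))) (*-identityʳ r)

  slack-mono : ∀ k → slack k ≤ slack (suc k)
  slack-mono k = ≤-trans (≤-by _ (0≤+ 0≤r² 0≤r²) ≈-refl) (slack-step k)
    where 0≤r² = *-nonNeg (0<⇒0≤ι (recip>0 k)) (0<⇒0≤ι (recip>0 k))

  slack≤4 : ∀ k → slack k ≤ ι 4ℚ
  slack≤4 k = ≤-by (ι 4ℚ * ι (recip k)) (*-nonNeg (0<⇒0≤ι (ℚ.positive⁻¹ 4ℚ)) (0<⇒0≤ι (recip>0 k)))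
    (solve 1 (λ r → con 4ℚ := con 4ℚ :* (con 1ℚ :- r) :+ con 4ℚ :* r) ≈-refl (ι (recip k)))

  -- Some E(N) A is at least ½. With B bounding E(N) and δ = 1/(4B), A ≤ δ would make that product
  -- at most ¼.
  limit-positive : ∀ {E : ℕ → R} {A} → (∀ k → 𝟘 ≤ E k) → Lim (λ k → E k * A) 𝟙 → ∃ λ δ → 0ℚ ℚ.< δ × ι δ ≤ A
  limit-positive {E} {A} 0≤E EA→1 =
    let N , h = EA→1 ½ ½>0
        B , 0<B , E≤B = bounded (E N)
        δ , 0<δ , Bδ≡¼ = divide 0<B ¼ (ℚ.positive⁻¹ ¼)
        ½≤EA = ≤-respˡ (solve 0 (con 1ℚ :- con ½ := con ½) ≈-refl)
                 (≤-by _ (0≤diff (lower (h N ℕ.≤-refl)))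
                   (solve 1 (λ x → x := (con 1ℚ :- con ½) :+ (con ½ :- (:- (x :- con 1ℚ)))) ≈-refl
                       (E N * A)))
    in δ , 0<δ , ≤-cases A (ι δ)
         (λ A≤δ → ⊥-elim (absurd (≤-trans ½≤EA (≤-trans (*-monoˡ-≤ (0≤E N) A≤δ)
           (≤-trans (*-monoʳ-≤ (0<⇒0≤ι 0<δ) (upper E≤B))
               (≤-reflexive (≈-trans (≈-sym (ι-* B δ)) (ι-cong Bδ≡¼))))))))
         id
    where
    absurd : ¬ (𝕙 ≤ 𝕢)
    absurd h = x+δ≰x {𝕢} {¼} (ℚ.positive⁻¹ ¼) (≤-trans
        (≤-reflexive (solve 0 (con ¼ :+ con ¼ := con ½) ≈-refl)) h)

  -- Comparison of the two Euler products

  module Comparison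
    (s : R) (δ : ℚ) (0<δ : 0ℚ ℚ.< δ) (1+δ≤s : 𝟙 + ι δ ≤ s)
    (Selected : ℕ → Set) (selected? : ∀ p → Dec (Selected p))
        (selected⇒prime : ∀ {p} → Selected p → Prime p)
    (χ : ℕ → R) (∣χ∣≤1 : ∀ m → ∣ χ m ∣≤ 𝟙) (χ-1 : χ 1 ≈ 𝟙)
    (χ-* : ∀ m n → χ (suc m ℕ.* suc n) ≈ χ (suc m) * χ (suc n))
    (χ-selected : ∀ {p} → Selected p → χ p ≈ - 𝟙)
    (χ-unselected : ∀ {p} → Prime p → ¬ Selected p → χ p ≈ 𝟙) where

    open Powers s δ 0<δ 1+δ≤s public

    indicator : ℕ → R
    indicator p = if does (selected? p) then 𝟙 else 𝟘

    ∣power∣≤ : ∀ m → ∣ power m ∣≤ power m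
    ∣power∣≤ m = 0≤⇒∣∣≤ (power-nonNeg m) ≤-refl

    twisted : ℕ → R
    twisted m = χ m * power m

    ∣twisted∣≤ : ∀ m → ∣ twisted m ∣≤ power m
    ∣twisted∣≤ m = ∣∣≤-weaken (≤-reflexive (*-identityˡ _)) (∣∣≤-* (∣χ∣≤1 m) (∣power∣≤ m))

    twisted-1 : twisted 1 ≈ 𝟙
    twisted-1 = ≈-trans (*-cong χ-1 power-1) (*-identityˡ 𝟙)

    twisted-* : ∀ m n → twisted (m ℕ.* n) ≈ twisted m * twisted n
    twisted-* zero    n       = ≈-trans (zeroʳ _) (≈-sym (≈-trans (*-cong (zeroʳ _) ≈-refl) (zeroˡ _)))
    twisted-* (suc i) zero    = ≈-trans (*-cong ≈-refl (≈-trans (power-* (suc i) zero) (zeroʳ _)))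
      (≈-trans (zeroʳ _) (≈-sym (≈-trans (*-cong ≈-refl (zeroʳ _)) (zeroʳ _))))
    twisted-* (suc i) (suc j) = ≈-trans (*-cong (χ-* i j) (power-* (suc i) (suc j)))
      (solve 4 (λ a b c d → (a :* b) :* (c :* d) := (a :* c) :* (b :* d)) ≈-refl _ _ _ _)

    selectedPower : ℕ → R
    selectedPower m = indicator m * power m

    ∣selectedPower∣≤ : ∀ m → ∣ selectedPower m ∣≤ power m
    ∣selectedPower∣≤ m = if-elim (λ x → ∣ x * power m ∣≤ power m) (selected? m)
      (λ _ → ∣∣≤-cong (≈-sym (*-identityˡ _)) (∣power∣≤ m))
      (λ _ → ∣∣≤-cong (≈-sym (zeroˡ _)) (∣𝟘∣≤ (power-nonNeg m)))

    Z C P : R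
    Z = proj₁ (convergent ∣power∣≤)
    C = proj₁ (convergent ∣twisted∣≤)
    P = proj₁ (convergent ∣selectedPower∣≤)

    Z-sum : Lim (∑ (λ i → power (suc i))) Z
    Z-sum = proj₂ (convergent ∣power∣≤)

    C-sum : Lim (∑ (λ i → twisted (suc i))) C
    C-sum = proj₂ (convergent ∣twisted∣≤)

    P-sum : Lim (∑ (λ i → selectedPower (suc i))) P
    P-sum = proj₂ (convergent ∣selectedPower∣≤)

    module EZ = Euler power power-1 power-*
      (λ i → ∣∣≤-weaken (power≤remainder i) (∣power∣≤ (suc i))) remainder→0 Z-sum
    module EC = Euler twisted twisted-1 twisted-*
      (λ i → ∣∣≤-weaken (power≤remainder i) (∣twisted∣≤ (suc i))) remainder→0 C-sum

    U V Pₖ : ℕ → R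
    U  = EZ.eulerProduct
    V  = EC.eulerProduct
    Pₖ = ∑ (λ i → selectedPower (suc i))

    power-prime≤½ : ∀ {p} → Prime p → power p ≤ 𝕙
    power-prime≤½ {zero}        ()
    power-prime≤½ {suc zero}    p-prime = contradiction p-prime ¬prime[1]
    power-prime≤½ {suc (suc i)} _ = ≤-trans (power≤recip (suc i))
        (ι-mono (recip-antimono {1} {suc i} (ℕ.s≤s ℕ.z≤n)))

    -- Stage k + 1 treats the integer p = k + 1, for which x = p^(-s) ≤ 1/(k + 1), so `slack-step`
    -- pays for the 2x² of a selected prime. Any other prime multiplies U and V by the same 1 - x,
    -- and a non-prime changes nothing.
    sandwich : ∀ k → Sandwich (U k) (V k) (Pₖ k) (slack k)
    sandwich zero = record { 0≤U = 0≤1 ; 0≤V = 0≤1 ; lo = ≤-reflexive e≈1 ; up = ≤-reflexive (≈-sym e≈1′) }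
      where
      e≈1 : 𝟙 * exp ((𝟘 + 𝟘) - slack 0) ≈ 𝟙
      e≈1 = ≈-trans (*-identityˡ _) (≈-trans (exp-cong
        (solve 0 ((con 0ℚ :+ con 0ℚ) :- con 4ℚ :* (con 1ℚ :- con 1ℚ) := con 0ℚ) ≈-refl)) exp-𝟘)
      e≈1′ : 𝟙 * exp ((𝟘 + 𝟘) + slack 0) ≈ 𝟙
      e≈1′ = ≈-trans (*-identityˡ _) (≈-trans (exp-cong
        (solve 0 ((con 0ℚ :+ con 0ℚ) :+ con 4ℚ :* (con 1ℚ :- con 1ℚ) := con 0ℚ) ≈-refl)) exp-𝟘)
    sandwich (suc k) = does-elim
      (λ b → Sandwich (if b then (𝟙 - x) * U k else U k) (if b then (𝟙 - χ p * x) * V k else V k)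
          (Pₖ (suc k)) (slack (suc k)))
      (prime? p)
      (λ p-prime → if-elim
        (λ i → Sandwich ((𝟙 - x) * U k) ((𝟙 - χ p * x) * V k) (Pₖ k + i * x) (slack (suc k)))
        (selected? p)
        (λ sel → sandwich-weaken (+-cong ≈-refl (≈-sym (*-identityˡ x)))
          (≤-trans (+-mono-≤ ≤-refl (+-mono-≤ x²≤r² x²≤r²)) (slack-step k))
          (sandwich-cong (*-cong (≈-trans (solve 1
              (λ x → con 1ℚ :+ x := con 1ℚ :- (:- con 1ℚ) :* x) ≈-refl x)
              (+-cong ≈-refl (-‿cong (*-cong (≈-sym (χ-selected sel)) ≈-refl)))) ≈-refl)
            (sandwich-factor 0≤x (power-prime≤½ p-prime) (sandwich k))))
        (λ ¬sel → sandwich-weaken (unchanged x) (slack-mono k)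
          (sandwich-cong (*-cong (+-cong ≈-refl (-‿cong (≈-trans (≈-sym (*-identityˡ x))
              (*-cong (≈-sym (χ-unselected p-prime ¬sel)) ≈-refl)))) ≈-refl)
            (sandwich-scale (0≤diff (≤-trans (power-prime≤½ p-prime) (ι-mono (ℚ.≤ᵇ⇒≤ _)))) (sandwich k)))))
      (λ ¬prime → if-elim (λ i → Sandwich (U k) (V k) (Pₖ k + i * x) (slack (suc k))) (selected? p)
        (λ sel → contradiction (selected⇒prime sel) ¬prime)
        (λ _ → sandwich-weaken (unchanged x) (slack-mono k) (sandwich k)))
      where
      p = suc k
      x = power p
      0≤x = power-nonNeg p
      x²≤r² : x * x ≤ ι (recip k) * ι (recip k)
      x²≤r² = *-mono-≤ (0<⇒0≤ι (recip>0 k)) 0≤x (power≤recip k) (power≤recip k)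
      unchanged : ∀ x → Pₖ k ≈ Pₖ k + 𝟘 * x
      unchanged x = solve 2 (λ p x → p := p :+ con 0ℚ :* x) ≈-refl (Pₖ k) x

    sandwich₄ : ∀ k → Sandwich (U k) (V k) (Pₖ k) (ι 4ℚ)
    sandwich₄ k = sandwich-weaken ≈-refl (slack≤4 k) (sandwich k)

    Z-positive : ∃ λ δ → 0ℚ ℚ.< δ × ι δ ≤ Z
    Z-positive = limit-positive (λ k → 0≤U (sandwich k)) EZ.eulerProduct-limit

    C-positive : ∃ λ δ → 0ℚ ℚ.< δ × ι δ ≤ C
    C-positive = limit-positive (λ k → 0≤V (sandwich k)) EC.eulerProduct-limit

    0≤Z : 𝟘 ≤ Z
    0≤Z = let _ , 0<δ , h = Z-positive in ≤-trans (0<⇒0≤ι 0<δ) h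

    0≤C : 𝟘 ≤ C
    0≤C = let _ , 0<δ , h = C-positive in ≤-trans (0<⇒0≤ι 0<δ) h

    Pₖ-exp : ∀ w → Lim (λ k → exp ((Pₖ k + Pₖ k) + w)) (exp ((P + P) + w))
    Pₖ-exp w = exp-continuous (Lim-+ (Lim-+ P-sum P-sum) (Lim-const w))

    -- Multiplied by Z C, the lower half of the sandwich reads (U Z)(C e^(2P - 4)) ≤ (V C) Z with P
    -- a partial sum; then U Z and V C tend to 1.
    C*exp≤Z : C * exp ((P + P) - ι 4ℚ) ≤ Z
    C*exp≤Z = ≤-respˡ (*-identityˡ _) (≤-respʳ (*-identityˡ _) (Lim-≤
      (0 , λ k _ → ≤-respˡ (solve 4 (λ u e z c → (z :* c) :* (u :* e) := (u :* z) :* (c :* e)) ≈-refl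
          (U k) _ Z C)
        (≤-respʳ (solve 3 (λ v z c → (z :* c) :* v := (v :* c) :* z) ≈-refl (V k) Z C)
          (*-monoˡ-≤ (*-nonNeg 0≤Z 0≤C) (lo (sandwich₄ k)))))
      (Lim-* EZ.eulerProduct-limit (Lim-* (Lim-const C) (Pₖ-exp (- ι 4ℚ))))
      (Lim-* EC.eulerProduct-limit (Lim-const Z))))

    Z≤C*exp : Z ≤ C * exp ((P + P) + ι 4ℚ)
    Z≤C*exp = ≤-respˡ (*-identityˡ _) (≤-respʳ (*-identityˡ _) (Lim-≤
      (0 , λ k _ → ≤-respʳ (solve 4 (λ u e z c → (z :* c) :* (u :* e) := (u :* z) :* (c :* e)) ≈-refl
          (U k) _ Z C)
        (≤-respˡ (solve 3 (λ v z c → (z :* c) :* v := (v :* c) :* z) ≈-refl (V k) Z C)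
          (*-monoˡ-≤ (*-nonNeg 0≤Z 0≤C) (up (sandwich₄ k)))))
      (Lim-* EC.eulerProduct-limit (Lim-const Z))
      (Lim-* EZ.eulerProduct-limit (Lim-* (Lim-const C) (Pₖ-exp (ι 4ℚ))))))

    module _ {logZ logC : R} (exp-logZ : exp logZ ≈ Z) (exp-logC : exp logC ≈ C) where

      log-ratio : ∣ (P + P) - (logZ - logC) ∣≤ ι 4ℚ
      log-ratio = bounds
        (≤-by _ (0≤diff (exp-cancel-≤ {logC + ((P + P) - ι 4ℚ)} {logZ}
          (≤-respˡ (≈-trans (*-cong (≈-sym exp-logC) ≈-refl) (≈-sym (exp-+ _ _)))
              (≤-respʳ (≈-sym exp-logZ) C*exp≤Z))))
          (solve 4 (λ p f z c → f := (p :- (z :- c)) :+ (z :- (c :+ (p :- f)))) ≈-refl (P + P)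
              (ι 4ℚ) logZ logC))
        (≤-by _ (0≤diff (exp-cancel-≤ {logZ} {logC + ((P + P) + ι 4ℚ)}
          (≤-respʳ (≈-trans (*-cong (≈-sym exp-logC) ≈-refl) (≈-sym (exp-+ _ _)))
              (≤-respˡ (≈-sym exp-logZ) Z≤C*exp))))
          (solve 4 (λ p f z c → f := (:- (p :- (z :- c))) :+ ((c :+ (p :+ f)) :- z)) ≈-refl (P + P)
              (ι 4ℚ) logZ logC))

  -- The function ψ and the Dirichlet series of the statement

  fromℤ : ℤ → R
  fromℤ i = ι (i ℚ./ 1)

  module _ (q t : ℕ) where

    χ : ℕ → R
    χ zero    = 𝟘
    χ (suc m) = fromℤ (D.ψ q t (suc m))

    Sign-bound : ∀ {i} → Sign i → ∣ fromℤ i ∣≤ 𝟙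
    Sign-bound plus  = 0≤⇒∣∣≤ 0≤1 ≤-refl
    Sign-bound minus = ∣∣≤-cong (≈-sym (ι-neg 1ℚ)) (∣∣≤-neg (0≤⇒∣∣≤ 0≤1 ≤-refl))

    fromℤ-sign-* : ∀ {i j} → Sign i → Sign j → fromℤ (i ℤ.* j) ≈ fromℤ i * fromℤ j
    fromℤ-sign-* plus  plus  = ι-* 1ℚ 1ℚ
    fromℤ-sign-* plus  minus = ι-* 1ℚ (ℚ.- 1ℚ)
    fromℤ-sign-* minus plus  = ι-* (ℚ.- 1ℚ) 1ℚ
    fromℤ-sign-* minus minus = ι-* (ℚ.- 1ℚ) (ℚ.- 1ℚ)

    ∣χ∣≤1 : ∀ m → ∣ χ m ∣≤ 𝟙
    ∣χ∣≤1 zero    = ∣𝟘∣≤ 0≤1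
    ∣χ∣≤1 (suc m) = Sign-bound (ψ-sign q t m)

    χ-* : ∀ m n → χ (suc m ℕ.* suc n) ≈ χ (suc m) * χ (suc n)
    χ-* m n = ≈-trans (≈-reflexive (cong fromℤ (ψ-* q t m n))) (fromℤ-sign-* (ψ-sign q t m) (ψ-sign q t n))

    χ-prime : ∀ {p} → Prime p → χ p ≈ fromℤ (D.ψ-prime q t p)
    χ-prime {zero}  ()
    χ-prime {suc p} p-prime = ≈-reflexive (cong fromℤ (ψ-at-prime q t p-prime))

    χ-selected : ∀ {p} → D.HasIndex q t p → χ p ≈ - 𝟙
    χ-selected {p} h@(p-prime , _) = ≈-trans (χ-prime p-prime)
      (≈-trans (≈-reflexive (cong fromℤ (if-yes (D.hasIndex? q t p) h))) (ι-neg 1ℚ))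

    χ-unselected : ∀ {p} → Prime p → ¬ D.HasIndex q t p → χ p ≈ 𝟙
    χ-unselected {p} p-prime ¬h = ≈-trans (χ-prime p-prime)
      (≈-reflexive (cong fromℤ (if-no (D.hasIndex? q t p) ¬h)))

  -- The recursive terms suit the differential equation of exp; this identifies them with the
  -- literal x^k / k! by which exponentials are specified.
  term≈ : ∀ x k → term x k ≈ (x ^ k) * ι (invFactorial k)
  term≈ x zero    = ≈-sym (*-identityˡ 𝟙)
  term≈ x (suc k) = begin-equality
    ι (recip k) * (x * term x k)                         ≈⟨ *-cong ≈-refl (*-cong ≈-refl (term≈ x k)) ⟩
    ι (recip k) * (x * ((x ^ k) * ι (invFactorial k)))
      ≈⟨ solve 4 (λ r x p f → r :* (x :* (p :* f)) := (x :* p) :* (r :* f)) ≈-refl (ι (recip k)) x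
          (x ^ k) (ι (invFactorial k)) ⟩
    (x * (x ^ k)) * (ι (recip k) * ι (invFactorial k))
      ≈⟨ *-cong ≈-refl (≈-trans (≈-sym (ι-* (recip k) (invFactorial k)))
          (ι-cong (sym (invFactorial-suc k)))) ⟩
    (x * (x ^ k)) * ι (invFactorial (suc k))           ∎
    where open ≤-Reasoning

  expTerm : R → ℕ → R
  expTerm x k = (x ^ k) * ι (invFactorial k)

  IsExp : R → R → Set
  IsExp x y = Lim (∑ (expTerm x)) y

  isExp : ∀ {x y} → exp x ≈ y → IsExp x y
  isExp {x} exp-x≈y = Lim-cong (∑-cong (term≈ x)) exp-x≈y (exp-limit x)

  IsPower : ℕ → R → R → Set
  IsPower b x y = ∃ λ l → IsExp l (fromℤ (+ b)) × IsExp (x * l) y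

  dirichletTerm : (∀ m → .{{NonZero m}} → ℤ) → (ℕ → R) → ℕ → R
  dirichletTerm a pow m = fromℤ (a (suc m)) * pow m

  IsDirichletSeries : (∀ m → .{{NonZero m}} → ℤ) → R → R → Set
  IsDirichletSeries a s S = Σ (ℕ → R) λ pow →
    (∀ m → IsPower (suc m) (- s) (pow m)) × Lim (∑ (dirichletTerm a pow)) S

  module _ (q t : ℕ) (s : R) (δ : ℚ) (0<δ : 0ℚ ℚ.< δ) (1+δ≤s : 𝟙 + ι δ ≤ s) where

    open Comparison s δ 0<δ 1+δ≤s (D.HasIndex q t) (D.hasIndex? q t) proj₁
      (χ q t) (∣χ∣≤1 q t) ≈-refl (χ-* q t) (χ-selected q t) (χ-unselected q t)

    isPower : ∀ m → IsPower (suc m) (- s) (power (suc m))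
    isPower m = log (suc m) , isExp (≈-trans (exp-log m) (ι-cong (nat≡/1 (suc m)))) , isExp ≈-refl

    dirichletSeries : ∀ (a : ∀ m → .{{NonZero m}} → ℤ) (b : ℕ → R) {S} →
        (∀ m → b (suc m) ≈ fromℤ (a (suc m)) * power (suc m)) →
                      Lim (∑ (λ m → b (suc m))) S → IsDirichletSeries a s S
    dirichletSeries a b b≈a h = (λ m → power (suc m)) , isPower , Lim-cong (∑-cong b≈a) ≈-refl h

    comparison : Σ R λ P → Σ R λ Z → Σ R λ C → Σ R λ logZ → Σ R λ logC →
      IsDirichletSeries (D.indexIndicator q t) s P ×
      IsDirichletSeries (λ _ → 1ℤ) s Z × IsExp logZ Z ×
      IsDirichletSeries (D.ψ q t) s C × IsExp logC C ×
      ∣ fromℤ (+ 2) * P - (logZ - logC) ∣≤ ι 4ℚ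
    comparison =
      let _ , 0<κ , κ≤Z = Z-positive
          _ , 0<λ , λ≤C = C-positive
          logZ , exp-logZ = log-exists Z _ 0<κ κ≤Z
          logC , exp-logC = log-exists C _ 0<λ λ≤C
      in P , Z , C , logZ , logC
        , dirichletSeries (D.indexIndicator q t) selectedPower
            (λ m → *-cong (indicator≈ (suc m)) ≈-refl) P-sum
        , dirichletSeries (λ _ → 1ℤ) power (λ m → ≈-sym (*-identityˡ _)) Z-sum
        , isExp exp-logZ
        , dirichletSeries (D.ψ q t) twisted (λ m → ≈-refl) C-sum
        , isExp exp-logC
        , ∣∣≤-cong (solve 3 (λ p z c → (p :+ p) :- (z :- c) := con (+ 2 ℚ./ 1) :* p :-
            (z :- c)) ≈-refl P logZ logC)
            (log-ratio exp-logZ exp-logC)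
      where
      indicator≈ : ∀ m .{{_ : NonZero m}} → indicator m ≈ fromℤ (D.indexIndicator q t m)
      indicator≈ m = does-elim (λ b → (if b then 𝟙 else 𝟘) ≈ fromℤ (if b then 1ℤ else ℤ.0ℤ))
          (D.hasIndex? q t m)
        (λ _ → ≈-refl) (λ _ → ≈-refl)

open import Defs
open CauchyReals using (cauchyReals)

-- From cauchyReals to the notions of Defs, comparing representatives termwise

∣p∣≤ : ∀ {p b} → p ℚ.≤ b → ℚ.- p ℚ.≤ b → ℚ.∣ p ∣ ℚ.≤ b
∣p∣≤ {p} {b} h k with ℚ.∣p∣≡p∨∣p∣≡-p p
... | inj₁ eq = subst (ℚ._≤ b) (sym eq) h
... | inj₂ eq = subst (ℚ._≤ b) (sym eq) k

∣∣≤⇒abs≤ : ∀ x b → x ≤ b → - x ≤ b → ∣ x ∣ ≤ b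
∣∣≤⇒abs≤ x b u l ε 0<ε = eventually₂ (λ n → ∣p∣≤ {seq x n} {seq b n ℚ.+ ε}) (u ε 0<ε) (l ε 0<ε)

-- The strict order asks for a positive rational gap. The bound ε/4 with tolerance ε/4 stays below
-- ε/2, and the other half is the gap.
abs<ε : ∀ x ε → 0ℚ ℚ.< ε → x ≤ fromℚ (½ ℚ.* (½ ℚ.* ε)) → - x ≤ fromℚ (½ ℚ.* (½ ℚ.* ε)) → ∣ x ∣ < fromℚ ε
abs<ε x ε 0<ε u l =
  let N , bound = ∣∣≤⇒abs≤ x (fromℚ (½ ℚ.* (½ ℚ.* ε))) u l (½ ℚ.* (½ ℚ.* ε)) (half>0 (half>0 0<ε))
  in ½ ℚ.* ε , half>0 0<ε , N , λ n N≤n → subst (ℚ.∣ seq x n ∣ ℚ.+ ½ ℚ.* ε ℚ.≤_) (half+half ε)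
       (ℚ.+-monoˡ-≤ (½ ℚ.* ε) (subst (ℚ.∣ seq x n ∣ ℚ.≤_) (half+half (½ ℚ.* ε)) (bound n N≤n)))

-- The two recursions are separate definitions and agree only by induction on n, but then as an
-- exact equality of the rational terms.
∑≗partialSum : ∀ a b → (∀ n i → seq (a n) i ≡ seq (b n) i) →
               ∀ n i → seq (Analysis.∑ cauchyReals a n) i ≡ seq (partialSum b n) i
∑≗partialSum a b a≗b zero    i = refl
∑≗partialSum a b a≗b (suc n) i = cong₂ ℚ._+_ (∑≗partialSum a b a≗b n i) (a≗b n i)

Lim⇒HasSum : ∀ a b S T → (∀ n i → seq (a n) i ≡ seq (b n) i) → (∀ i → seq S i ≡ seq T i) →
             Analysis.Lim cauchyReals (Analysis.∑ cauchyReals a) S → HasSum b T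
Lim⇒HasSum a b S T a≗b S≗T h ε 0<ε =
  let N , k = h (½ ℚ.* (½ ℚ.* ε)) (half>0 (half>0 0<ε))
  in N , λ n N≤n →
    let δ , 0<δ , M , bound = abs<ε (Analysis.∑ cauchyReals a n - S) ε 0<ε (Analysis.upper (k n N≤n))
            (Analysis.lower (k n N≤n))
    in δ , 0<δ , M , λ i M≤i → subst (λ x → ℚ.∣ x ∣ ℚ.+ δ ℚ.≤ ε)
         (cong₂ ℚ._-_ (∑≗partialSum a b a≗b n i) (S≗T i)) (bound i M≤i)

^≗^ : ∀ x x′ → (∀ i → seq x i ≡ seq x′ i) → ∀ k i → seq (Analysis._^_ cauchyReals x k) i ≡ seq (x′ ^ k) i
^≗^ x x′ x≗x′ zero    i = refl
^≗^ x x′ x≗x′ (suc k) i = cong₂ ℚ._*_ (x≗x′ i) (^≗^ x x′ x≗x′ k i)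

toIsExp : ∀ x x′ y y′ → (∀ i → seq x i ≡ seq x′ i) →
    (∀ i → seq y i ≡ seq y′ i) → Analysis.IsExp cauchyReals x y → IsExp x′ y′
toIsExp x x′ y y′ x≗x′ = Lim⇒HasSum (Analysis.expTerm cauchyReals x)
    (λ k → x′ ^ k * fromℚ ((1ℤ ℚ./ (k !)) {{k ℕ.!≢0}})) y y′
  (λ k i → cong (ℚ._* invFactorial k) (^≗^ x x′ x≗x′ k i))

toIsPower : ∀ b x x′ y → (∀ i → seq x i ≡ seq x′ i) → Analysis.IsPower cauchyReals b x y → IsPower b x′ y
toIsPower b x x′ y x≗x′ (l , exp-l , exp-xl) =
  l , toIsExp l l (Analysis.fromℤ cauchyReals (+ b)) (fromℕ b) (λ _ → refl) (λ _ → refl) exp-l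
    , toIsExp (Reals._*_ cauchyReals x l) (x′ * l) y y (λ i → cong (ℚ._* seq l i) (x≗x′ i))
        (λ _ → refl) exp-xl

toIsDirichletSeries : ∀
    (a : ∀ m → .{{NonZero m}} → ℤ) s S → Analysis.IsDirichletSeries cauchyReals a s S → IsDirichletSeries a s S
toIsDirichletSeries a s S (pow , isPower , sum) =
  pow , (λ m → toIsPower (suc m) (Reals.-_ cauchyReals s) (- s) (pow m) (λ _ → refl) (isPower m))
      , Lim⇒HasSum (Analysis.dirichletTerm cauchyReals a pow) (λ m → fromℤ (a (suc m)) * pow m) S S
          (λ _ _ → refl) (λ _ → refl) sum

mainTheorem4 : (q : ℕ) → Prime q → (t : ℕ) → .{{_ : NonZero t}} →
    Σ ℝ λ K → (s : ℝ) → fromℕ 1 < s →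
    Σ ℝ λ P → Σ ℝ λ Z → Σ ℝ λ C → Σ ℝ λ logZ → Σ ℝ λ logC →
    IsIndexPrimeSum q t s P ×
    Isζ s Z × IsLog Z logZ ×
    IsC q t s C × IsLog C logC ×
    ∣ fromℕ 2 * P - (logZ - logC) ∣ ≤ K
-- The constant is the bound of `slack≤4`, chosen before s. Unfolding 1 < s yields the rational δ
-- with 1 + δ ≤ s on which all convergence depends.
mainTheorem4 q _ t = fromℚ 4ℚ , λ { s (δ , 0<δ , N , 1+δ≤s) →
  let P , Z , C , logZ , logC , P-sum , Z-sum , logZ-log , C-sum , logC-log , bound =
        Analysis.comparison cauchyReals q t s δ 0<δ (λ ε 0<ε → N , λ n N≤n → ℚ.≤-trans (1+δ≤s n N≤n)
          (ℚ.≤-trans (ℚ.≤-reflexive (sym (ℚ.+-identityʳ (seq s n)))) (ℚ.+-monoʳ-≤ (seq s n) (ℚ.<⇒≤ 0<ε))))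
  in P , Z , C , logZ , logC
   , toIsDirichletSeries (indexIndicator q t) s P P-sum
   , toIsDirichletSeries (λ _ → 1ℤ) s Z Z-sum
   , toIsExp logZ logZ Z Z (λ _ → refl) (λ _ → refl) logZ-log
   , toIsDirichletSeries (ψ q t) s C C-sum
   , toIsExp logC logC C C (λ _ → refl) (λ _ → refl) logC-log
   , ∣∣≤⇒abs≤ (fromℕ 2 * P - (logZ - logC)) (fromℚ 4ℚ) (Analysis.upper bound) (Analysis.lower bound) }
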